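{- Let $(f_n)_{n\ge 1}$, $f_n:\{0,1\}^n\to\{0,1\}$, be a family of Boolean functions in $\mathrm{ACC}^0$. Then there is a constant $C>0$ (depending only on the family) such that for every $n\ge 1$ and every $\varepsilon\in(0,1)$ there is a torus polynomial of degree at most $C(\log(n/\varepsilon))^{C}$ that $\varepsilon$-approximates $f_n$. In other words, $\overline{\deg}_{\varepsilon}(f_n)\le \mathrm{polylog}(n/\varepsilon)$.
   Context: Logarithms are base 2. Let $\mathbb{T}=\mathbb{R}/\mathbb{Z}$. For $z\in\mathbb{T}$, $|z \bmod 1|$ denotes $|\iota(z)|$, where $\iota(z)$ is the unique representative of $z$ in $[-1/2,1/2)$. For $F:\{0,1\}^n\to\mathbb{T}$, $\|F \bmod 1\|_\infty=\max_{x\in\{0,1\}^n}|F(x)\bmod 1|$. A torus polynomial of degree (at most) $d$ is a function $P:\{0,1\}^n\to\mathbb{T}$ of the form $P(x)=\sum_{S\subseteq[n],|S|\le d}P_S\prod_{i\in S}x_i \bmod 1$ with $P_S\in\mathbb{R}$. It $\varepsilon$-approximates $f:\{0,1\}^n\to\{0,1\}$ if $\|P-\tfrac{f}{2}\bmod 1\|_\infty\le\varepsilon$. The toroidal $\varepsilon$-approximation degree $\overline{\deg}_\varepsilon(f)$ is the minimal $d\ge0$ for which a torus polynomial of degree $d$ that $\varepsilon$-approximates $f$ exists. A $\mathrm{MOD}_m$ gate outputs $1$ if and only if the sum of its (Boolean) inputs is congruent to a non-zero value modulo $m$. A family $(f_n)$ is in $\mathrm{ACC}^0$ if there are constants $m\ge2$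 (possibly composite) and $\ell$ and a polynomial $s$ such that each $f_n$ is computed by a Boolean circuit of depth at most $\ell$ and size at most $s(n)$ consisting of unbounded fan-in AND and OR gates, NOT gates, and unbounded fan-in $\mathrm{MOD}_m$ gates. -}

module Defs where

open import Data.Bool.Base using (Bool; not; if_then_else_)
open import Data.Fin.Base using (Fin)
open import Data.Fin.Subset as Subset using (Subset; inside; outside)
open import Data.Fin.Subset.Properties using (_∈?_)
open import Data.Integer.Base as ℤ using (ℤ)
import Data.Integer.Properties as ℤ
open import Data.Bool.ListAction using (all; any)
open import Data.Nat.ListAction using (sum)
open import Data.List.Base
  using (List; []; _∷_; _++_; foldr; map; filter; allFin)
open import Data.Nat.Base as ℕ using (ℕ; zero; suc; NonZero)
import Data.Nat.Properties as ℕ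
open import Data.Nat.Divisibility using (_∣?_)
open import Data.Nat.Induction using (<-rec)
open import Data.Nat.Logarithm using (⌊log₂_⌋; ⌊log₂⌋-mono-≤; ⌊log₂[2^n]⌋≡n; ⌊log₂⌊n/2⌋⌋≡⌊log₂n⌋∸1)
import Data.Nat.Solver as ℕ-Solver
open import Data.Product.Base using (∃-syntax; Σ-syntax; _×_; _,_; proj₁; proj₂)
open import Data.Rational.Base as ℚ using (ℚ; mkℚ; 0ℚ; 1ℚ; ½; -½; toℚᵘ)
import Data.Rational.Properties as ℚ
import Data.Rational.Solver as ℚ-Solver
import Data.Rational.Unnormalised.Base as ℚᵘ
import Data.Rational.Unnormalised.Properties as ℚᵘ
open import Data.Sum.Base using (_⊎_; inj₁; inj₂; [_,_]′)
open import Data.Vec.Base as Vec using (Vec; lookup)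
open import Function.Base using (_∘_; _$_)
open import Relation.Binary.PropositionalEquality
  using (_≡_; refl; sym; trans; cong; cong₂; subst; subst₂)
open import Relation.Nullary.Decidable.Core using (⌊_⌋)

module ℕ-Lemmas where
  open import Data.Nat.Base
  open import Data.Nat.Properties
  open ℕ-Solver.+-*-Solver using (solve; _:=_; _:+_; _:*_; con)
  open ≤-Reasoning

  n<2^1+⌊log₂n⌋ : ∀ n → n < 2 ^ suc ⌊log₂ n ⌋
  n<2^1+⌊log₂n⌋ n = ≰⇒> λ p → <-irrefl refl
    (subst (_≤ ⌊log₂ n ⌋) (⌊log₂[2^n]⌋≡n (suc ⌊log₂ n ⌋)) (⌊log₂⌋-mono-≤ p))

  2*⌊n/2⌋≤n : ∀ n → 2 * ⌊ n /2⌋ ≤ n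
  2*⌊n/2⌋≤n n = begin
    2 * ⌊ n /2⌋          ≡⟨ cong (⌊ n /2⌋ +_) (+-identityʳ _) ⟩
    ⌊ n /2⌋ + ⌊ n /2⌋    ≤⟨ +-monoʳ-≤ ⌊ n /2⌋ (⌊n/2⌋≤⌈n/2⌉ n) ⟩
    ⌊ n /2⌋ + ⌈ n /2⌉    ≡⟨ ⌊n/2⌋+⌈n/2⌉≡n n ⟩
    n                    ∎

  m≤1+[m∸1] : ∀ m → m ≤ suc (m ∸ 1)
  m≤1+[m∸1] zero    = z≤n
  m≤1+[m∸1] (suc m) = ≤-refl

  2^⌊log₂n⌋≤n : ∀ n → 1 ≤ n → 2 ^ ⌊log₂ n ⌋ ≤ n
  2^⌊log₂n⌋≤n = <-rec _ go
    where
    go : ∀ n → (∀ {k} → k < n → 1 ≤ k → 2 ^ ⌊log₂ k ⌋ ≤ k) → 1 ≤ n → 2 ^ ⌊log₂ n ⌋ ≤ n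
    go 1               rec _ = ≤-refl
    go n@(suc (suc m)) rec _ = begin
      2 ^ ⌊log₂ n ⌋                ≤⟨ ^-monoʳ-≤ 2 (m≤1+[m∸1] ⌊log₂ n ⌋) ⟩
      2 ^ suc (⌊log₂ n ⌋ ∸ 1)      ≡⟨ cong (λ k → 2 ^ suc k) (⌊log₂⌊n/2⌋⌋≡⌊log₂n⌋∸1 n) ⟨
      2 * 2 ^ ⌊log₂ ⌊ n /2⌋ ⌋      ≤⟨ *-monoʳ-≤ 2 (rec (⌊n/2⌋<n (suc m)) (s≤s z≤n)) ⟩
      2 * ⌊ n /2⌋                  ≤⟨ 2*⌊n/2⌋≤n n ⟩
      n                            ∎

  ^-cancelʳ-≤ : ∀ {m n} → 2 ^ m ≤ 2 ^ n → m ≤ n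
  ^-cancelʳ-≤ p = ≮⇒≥ λ n<m → <⇒≱ (^-monoʳ-< 2 (s≤s (s≤s z≤n)) n<m) p

  ^-distribʳ-* : ∀ m n o → (m * n) ^ o ≡ m ^ o * n ^ o
  ^-distribʳ-* m n zero    = refl
  ^-distribʳ-* m n (suc o) = begin-equality
    m * n * (m * n) ^ o        ≡⟨ cong (m * n *_) (^-distribʳ-* m n o) ⟩
    m * n * (m ^ o * n ^ o)    ≡⟨ solve 4 (λ a b x y → a :* b :* (x :* y) := a :* x :* (b :* y)) refl m n (m ^ o) (n ^ o) ⟩
    m * m ^ o * (n * n ^ o)    ∎

  bernoulli : ∀ N M → 1 ≤ N → N * suc N ^ M ≤ N ^ M * (N + 4 ^ M)
  bernoulli N zero    _   = begin
    N * 1          ≡⟨ *-identityʳ N ⟩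
    N              ≤⟨ m≤m+n N 1 ⟩
    N + 1          ≡⟨ *-identityˡ (N + 1) ⟨
    1 * (N + 1)    ∎
  bernoulli N (suc M) 1≤N = begin
    N * (suc N * suc N ^ M)        ≡⟨ solve 3 (λ n s x → n :* (s :* x) := n :* x :* s) refl N (suc N) (suc N ^ M) ⟩
    N * suc N ^ M * suc N          ≤⟨ *-monoˡ-≤ (suc N) (bernoulli N M 1≤N) ⟩
    N ^ M * (N + F) * suc N        ≡⟨ *-assoc (N ^ M) (N + F) (suc N) ⟩
    N ^ M * ((N + F) * suc N)      ≤⟨ *-monoʳ-≤ (N ^ M) step ⟩
    N ^ M * (N * (N + 4 * F))      ≡⟨ solve 3 (λ n x y → x :* (n :* y) := n :* x :* y) refl N (N ^ M) (N + 4 * F) ⟩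
    N * N ^ M * (N + 4 * F)        ∎
    where
    F = 4 ^ M
    step : (N + F) * suc N ≤ N * (N + 4 * F)
    step = begin
      (N + F) * suc N                            ≡⟨ solve 2 (λ n f → (n :+ f) :* (con 1 :+ n) := n :* n :+ n :* f :+ n :* con 1 :+ con 1 :* f) refl N F ⟩
      N * N + N * F + N * 1 + 1 * F              ≤⟨ +-mono-≤ (+-monoʳ-≤ (N * N + N * F) (*-monoʳ-≤ N (m^n>0 4 M))) (*-monoˡ-≤ F 1≤N) ⟩
      N * N + N * F + N * F + N * F              ≤⟨ m≤m+n _ (N * F) ⟩
      N * N + N * F + N * F + N * F + N * F      ≡⟨ solve 2 (λ n f → n :* n :+ n :* f :+ n :* f :+ n :* f :+ n :* f := n :* (n :+ con 4 :* f)) refl N F ⟩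
      N * (N + 4 * F)                            ∎

  [1+4^M]^M≤2*[4^M]^M : ∀ M → suc (4 ^ M) ^ M ≤ 2 * (4 ^ M) ^ M
  [1+4^M]^M≤2*[4^M]^M M = *-cancelˡ-≤ N {{m^n≢0 4 M}} $ begin
    N * suc N ^ M        ≤⟨ bernoulli N M (m^n>0 4 M) ⟩
    N ^ M * (N + N)      ≡⟨ solve 2 (λ n x → x :* (n :+ n) := n :* (con 2 :* x)) refl N (N ^ M) ⟩
    N * (2 * N ^ M)      ∎
    where N = 4 ^ M

  -- If a / b ≤ (c / d) (1 + 1/N) and (1 + 1/N) ^ M ≤ 2, then
  -- log₂ (a / b) ≤ log₂ (c / d) + 1/M; here with K-th and J-th powers in
  -- the logarithms, rounded down, and all denominators cleared.
  ⌊log₂⌋-compare : ∀ a b c d K J M N → 1 ≤ a → 1 ≤ b → 1 ≤ c → 1 ≤ d → .{{_ : NonZero N}} →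
    suc N ^ M ≤ 2 * N ^ M → a * d * N ≤ c * b * suc N →
    ⌊log₂ a ^ K ⌋ * (J * M) + ⌊log₂ d ^ J ⌋ * (K * M) ≤
    ⌊log₂ c ^ J ⌋ * (K * M) + ⌊log₂ b ^ K ⌋ * (J * M) + (K * M + J * M + K * J)
  ⌊log₂⌋-compare a b c d K J M N 1≤a 1≤b 1≤c 1≤d N-bound le =
    ^-cancelʳ-≤ $ *-cancelʳ-≤ _ _ (N ^ E) {{m^n≢0 N E}} $ begin
      2 ^ (α * (J * M) + δ * (K * M)) * N ^ E
        ≡⟨ cong (_* N ^ E) (^-distribˡ-+-* 2 (α * (J * M)) (δ * (K * M))) ⟩
      2 ^ (α * (J * M)) * 2 ^ (δ * (K * M)) * N ^ E
        ≤⟨ *-monoˡ-≤ (N ^ E) (*-mono-≤ (lower a K (J * M) 1≤a refl) (lower d J (K * M) 1≤d E≡₁)) ⟩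
      a ^ E * d ^ E * N ^ E
        ≡⟨ distrib₃ a d N ⟨
      (a * d * N) ^ E
        ≤⟨ ^-monoˡ-≤ E le ⟩
      (c * b * suc N) ^ E
        ≡⟨ distrib₃ c b (suc N) ⟩
      c ^ E * b ^ E * suc N ^ E
        ≤⟨ *-mono-≤ (*-mono-≤ (upper c J (K * M) E≡₁) (upper b K (J * M) refl)) N-part ⟩
      2 ^ (suc γ * (K * M)) * 2 ^ (suc β * (J * M)) * (2 ^ (K * J) * N ^ E)
        ≡⟨ *-assoc (2 ^ (suc γ * (K * M)) * 2 ^ (suc β * (J * M))) (2 ^ (K * J)) (N ^ E) ⟨
      2 ^ (suc γ * (K * M)) * 2 ^ (suc β * (J * M)) * 2 ^ (K * J) * N ^ E
        ≡⟨ cong (_* N ^ E) (trans (cong (_* 2 ^ (K * J)) (sym (^-distribˡ-+-* 2 (suc γ * (K * M)) (suc β * (J * M)))))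
                                  (sym (^-distribˡ-+-* 2 (suc γ * (K * M) + suc β * (J * M)) (K * J)))) ⟩
      2 ^ (suc γ * (K * M) + suc β * (J * M) + K * J) * N ^ E
        ≡⟨ cong (λ e → 2 ^ e * N ^ E) (solve 5 (λ g be km jm kj →
             (con 1 :+ g) :* km :+ (con 1 :+ be) :* jm :+ kj := g :* km :+ be :* jm :+ (km :+ jm :+ kj))
             refl γ β (K * M) (J * M) (K * J)) ⟩
      2 ^ (γ * (K * M) + β * (J * M) + (K * M + J * M + K * J)) * N ^ E
        ∎
    where
    E = K * (J * M)
    α = ⌊log₂ a ^ K ⌋
    β = ⌊log₂ b ^ K ⌋
    γ = ⌊log₂ c ^ J ⌋
    δ = ⌊log₂ d ^ J ⌋
    E≡₁ : J * (K * M) ≡ E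
    E≡₁ = solve 3 (λ k j m → j :* (k :* m) := k :* (j :* m)) refl K J M
    E≡₂ : M * (K * J) ≡ E
    E≡₂ = solve 3 (λ k j m → m :* (k :* j) := k :* (j :* m)) refl K J M
    distrib₃ : ∀ x y z → (x * y * z) ^ E ≡ x ^ E * y ^ E * z ^ E
    distrib₃ x y z = trans (^-distribʳ-* (x * y) z E) (cong (_* z ^ E) (^-distribʳ-* x y E))
    lower : ∀ x e r → 1 ≤ x → e * r ≡ E → 2 ^ (⌊log₂ x ^ e ⌋ * r) ≤ x ^ E
    lower x e r 1≤x eq = begin
      2 ^ (⌊log₂ x ^ e ⌋ * r)      ≡⟨ ^-*-assoc 2 ⌊log₂ x ^ e ⌋ r ⟨
      (2 ^ ⌊log₂ x ^ e ⌋) ^ r      ≤⟨ ^-monoˡ-≤ r (2^⌊log₂n⌋≤n (x ^ e) (m^n>0 x {{>-nonZero 1≤x}} e)) ⟩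
      (x ^ e) ^ r                  ≡⟨ ^-*-assoc x e r ⟩
      x ^ (e * r)                  ≡⟨ cong (x ^_) eq ⟩
      x ^ E                        ∎
    upper : ∀ x e r → e * r ≡ E → x ^ E ≤ 2 ^ (suc ⌊log₂ x ^ e ⌋ * r)
    upper x e r eq = begin
      x ^ E                          ≡⟨ cong (x ^_) eq ⟨
      x ^ (e * r)                    ≡⟨ ^-*-assoc x e r ⟨
      (x ^ e) ^ r                    ≤⟨ ^-monoˡ-≤ r (<⇒≤ (n<2^1+⌊log₂n⌋ (x ^ e))) ⟩
      (2 ^ suc ⌊log₂ x ^ e ⌋) ^ r    ≡⟨ ^-*-assoc 2 (suc ⌊log₂ x ^ e ⌋) r ⟩
      2 ^ (suc ⌊log₂ x ^ e ⌋ * r)    ∎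
    N-part : suc N ^ E ≤ 2 ^ (K * J) * N ^ E
    N-part = begin
      suc N ^ E                        ≡⟨ cong (suc N ^_) E≡₂ ⟨
      suc N ^ (M * (K * J))            ≡⟨ ^-*-assoc (suc N) M (K * J) ⟨
      (suc N ^ M) ^ (K * J)            ≤⟨ ^-monoˡ-≤ (K * J) N-bound ⟩
      (2 * N ^ M) ^ (K * J)            ≡⟨ ^-distribʳ-* 2 (N ^ M) (K * J) ⟩
      2 ^ (K * J) * (N ^ M) ^ (K * J)  ≡⟨ cong (2 ^ (K * J) *_) (trans (^-*-assoc N M (K * J)) (cong (N ^_) E≡₂)) ⟩
      2 ^ (K * J) * N ^ E              ∎

module ℚ-Lemmas where
  open import Data.Rational.Base
  open import Data.Rational.Properties
  open ℚ-Solver.+-*-Solver using (solve; _:=_; _:+_; _:*_; :-_; _:-_; con)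
  open ≤-Reasoning

  fromℤ : ℤ → ℚ
  fromℤ i = i / 1

  fromℤ-≃ : ∀ i → toℚᵘ (fromℤ i) ℚᵘ.≃ ℚᵘ.mkℚᵘ i 0
  fromℤ-≃ i = toℚᵘ-fromℚᵘ (ℚᵘ.mkℚᵘ i 0)

  fromℤ-+ : ∀ i j → fromℤ (i ℤ.+ j) ≡ fromℤ i + fromℤ j
  fromℤ-+ i j = toℚᵘ-injective $
    ℚᵘ.≃-trans (fromℤ-≃ (i ℤ.+ j)) $
    ℚᵘ.≃-trans (ℚᵘ.*≡* (cong (ℤ._* ℤ.1ℤ) (sym (cong₂ ℤ._+_ (ℤ.*-identityʳ i) (ℤ.*-identityʳ j))))) $
    ℚᵘ.≃-trans (ℚᵘ.+-cong (ℚᵘ.≃-sym (fromℤ-≃ i)) (ℚᵘ.≃-sym (fromℤ-≃ j))) $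
    ℚᵘ.≃-sym (toℚᵘ-homo-+ (fromℤ i) (fromℤ j))

  fromℤ-* : ∀ i j → fromℤ (i ℤ.* j) ≡ fromℤ i * fromℤ j
  fromℤ-* i j = toℚᵘ-injective $
    ℚᵘ.≃-trans (fromℤ-≃ (i ℤ.* j)) $
    ℚᵘ.≃-trans (ℚᵘ.*-cong (ℚᵘ.≃-sym (fromℤ-≃ i)) (ℚᵘ.≃-sym (fromℤ-≃ j))) $
    ℚᵘ.≃-sym (toℚᵘ-homo-* (fromℤ i) (fromℤ j))

  fromℤ-mono : ∀ {i j} → i ℤ.≤ j → fromℤ i ≤ fromℤ j
  fromℤ-mono {i} {j} i≤j = toℚᵘ-cancel-≤ $
    ℚᵘ.≤-respˡ-≃ (ℚᵘ.≃-sym (fromℤ-≃ i)) $ ℚᵘ.≤-respʳ-≃ (ℚᵘ.≃-sym (fromℤ-≃ j)) $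
    ℚᵘ.*≤* (ℤ.*-monoʳ-≤-nonNeg ℤ.1ℤ i≤j)

  fromℤ-cancel : ∀ {i j} → fromℤ i ≤ fromℤ j → i ℤ.≤ j
  fromℤ-cancel {i} {j} p =
    subst₂ ℤ._≤_ (ℤ.*-identityʳ i) (ℤ.*-identityʳ j) $ ℚᵘ.drop-*≤* $
    ℚᵘ.≤-respˡ-≃ (fromℤ-≃ i) $ ℚᵘ.≤-respʳ-≃ (fromℤ-≃ j) (toℚᵘ-mono-≤ p)

  fromℕ : ℕ → ℚ
  fromℕ n = fromℤ (ℤ.+ n)

  fromℕ-* : ∀ m n → fromℕ (m ℕ.* n) ≡ fromℕ m * fromℕ n
  fromℕ-* m n = trans (cong fromℤ (ℤ.pos-* m n)) (fromℤ-* (ℤ.+ m) (ℤ.+ n))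

  fromℕ-*₃ : ∀ m n o → fromℕ (m ℕ.* n ℕ.* o) ≡ fromℕ m * fromℕ n * fromℕ o
  fromℕ-*₃ m n o = trans (fromℕ-* (m ℕ.* n) o) (cong (_* fromℕ o) (fromℕ-* m n))

  fromℕ-+ : ∀ m n → fromℕ (m ℕ.+ n) ≡ fromℕ m + fromℕ n
  fromℕ-+ m n = fromℤ-+ (ℤ.+ m) (ℤ.+ n)

  fromℕ-mono : ∀ {m n} → m ℕ.≤ n → fromℕ m ≤ fromℕ n
  fromℕ-mono p = fromℤ-mono (ℤ.+≤+ p)

  fromℕ-cancel : ∀ {m n} → fromℕ m ≤ fromℕ n → m ℕ.≤ n
  fromℕ-cancel p = ℤ.drop‿+≤+ (fromℤ-cancel p)

  unit : (k : ℕ) → ℚ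
  unit k = ℤ.+ 1 / suc k

  i/n≡i*unit : ∀ i k → i / suc k ≡ fromℤ i * unit k
  i/n≡i*unit i k = toℚᵘ-injective $
    ℚᵘ.≃-trans (toℚᵘ-fromℚᵘ (ℚᵘ.mkℚᵘ i k)) $
    ℚᵘ.≃-trans (ℚᵘ.*≡* (cong₂ ℤ._*_ (sym (ℤ.*-identityʳ i)) (cong (λ m → ℤ.+ suc m) (ℕ.+-identityʳ k))))  $
    ℚᵘ.≃-trans (ℚᵘ.*-cong (ℚᵘ.≃-sym (fromℤ-≃ i)) (ℚᵘ.≃-sym (toℚᵘ-fromℚᵘ (ℚᵘ.mkℚᵘ ℤ.1ℤ k)))) $
    ℚᵘ.≃-sym (toℚᵘ-homo-* (fromℤ i) (unit k))

  n/n≡1 : ∀ k → fromℕ (suc k) * unit k ≡ 1ℚ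
  n/n≡1 k = trans (sym (i/n≡i*unit (ℤ.+ suc k) k)) $ toℚᵘ-injective $
    ℚᵘ.≃-trans (toℚᵘ-fromℚᵘ (ℚᵘ.mkℚᵘ (ℤ.+ suc k) k)) (ℚᵘ.*≡* (ℤ.*-comm (ℤ.+ suc k) ℤ.1ℤ))

  unit>0 : ∀ k → 0ℚ < unit k
  unit>0 k = positive⁻¹ (unit k) {{normalize-pos 1 (suc k)}}

  unit-antimono : ∀ {j k} → j ℕ.≤ k → unit k ≤ unit j
  unit-antimono {j} {k} j≤k = toℚᵘ-cancel-≤ $
    ℚᵘ.≤-respˡ-≃ (ℚᵘ.≃-sym (toℚᵘ-fromℚᵘ (ℚᵘ.mkℚᵘ ℤ.1ℤ k))) $
    ℚᵘ.≤-respʳ-≃ (ℚᵘ.≃-sym (toℚᵘ-fromℚᵘ (ℚᵘ.mkℚᵘ ℤ.1ℤ j))) $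
    ℚᵘ.*≤* (ℤ.*-monoˡ-≤-nonNeg ℤ.1ℤ (ℤ.+≤+ (ℕ.s≤s j≤k)))

  archimedean : ∀ δ → 0ℚ < δ → ∃[ k ] unit k ≤ δ
  archimedean δ@(mkℚ (ℤ.+ zero)  d _) (*<* (ℤ.+<+ ()))
  archimedean δ@(mkℚ ℤ.-[1+ n ]  d _) (*<* ())
  archimedean δ@(mkℚ ℤ.+[1+ n ]  d _) _ = d , (toℚᵘ-cancel-≤ $
    ℚᵘ.≤-respˡ-≃ (ℚᵘ.≃-sym (toℚᵘ-fromℚᵘ (ℚᵘ.mkℚᵘ ℤ.1ℤ d))) $
    ℚᵘ.*≤* (ℤ.*-monoʳ-≤-nonNeg (ℤ.+ suc d) {ℤ.1ℤ} {ℤ.+[1+ n ]} (ℤ.+≤+ (ℕ.s≤s ℕ.z≤n))))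

  *-pos : ∀ {p q} → 0ℚ < p → 0ℚ < q → 0ℚ < p * q
  *-pos {p} {q} 0<p 0<q = subst (_< p * q) (*-zeroʳ p) (*-monoʳ-<-pos p {{positive 0<p}} 0<q)

  *-monoʳ : ∀ {p q} r → 0ℚ ≤ r → p ≤ q → p * r ≤ q * r
  *-monoʳ r 0≤r = *-monoʳ-≤-nonNeg r {{nonNegative 0≤r}}

  *-monoˡ : ∀ {p q} r → 0ℚ ≤ r → p ≤ q → r * p ≤ r * q
  *-monoˡ r 0≤r = *-monoˡ-≤-nonNeg r {{nonNegative 0≤r}}

  *-mono : ∀ {p q r s} → 0ℚ ≤ p → 0ℚ ≤ s → p ≤ q → r ≤ s → p * r ≤ q * s
  *-mono {p} {q} {r} {s} 0≤p 0≤s p≤q r≤s = ≤-trans (*-monoˡ p 0≤p r≤s) (*-monoʳ s 0≤s p≤q)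

  1/-pos : ∀ {q} → 0ℚ < q → ∃[ r ] (0ℚ < r × q * r ≡ 1ℚ)
  1/-pos {q} 0<q = (1/ q) {{>-nonZero 0<q}}
    , positive⁻¹ _ {{1/pos⇒pos q {{positive 0<q}}}}
    , *-inverseʳ q {{>-nonZero 0<q}}

  1/-antimono : ∀ {p q r} → (0<p : 0ℚ < p) → p ≤ q → q * r ≡ 1ℚ →
    r ≤ (1/ p) {{>-nonZero 0<p}}
  1/-antimono {p} {q} {r} 0<p p≤q qr≡1 = *-cancelˡ-≤-pos p {{positive 0<p}} $ begin
    p * r                              ≤⟨ *-monoʳ r 0≤r p≤q ⟩
    q * r                              ≡⟨ qr≡1 ⟩
    1ℚ                                 ≡⟨ *-inverseʳ p {{>-nonZero 0<p}} ⟨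
    p * (1/ p) {{>-nonZero 0<p}}       ∎
    where
    0<q : 0ℚ < q
    0<q = <-≤-trans 0<p p≤q
    0≤r : 0ℚ ≤ r
    0≤r = *-cancelˡ-≤-pos q {{positive 0<q}}
            (subst₂ _≤_ (sym (*-zeroʳ q)) (sym qr≡1) (<⇒≤ (positive⁻¹ 1ℚ)))

  half : ∀ {δ} → 0ℚ < δ → 0ℚ < δ * ½
  half 0<δ = *-pos 0<δ (positive⁻¹ ½)

  half+half : ∀ δ → δ * ½ + δ * ½ ≡ δ
  half+half δ = trans (sym (*-distribˡ-+ δ ½ ½)) (*-identityʳ δ)

  p≤∣p∣ : ∀ p → p ≤ ∣ p ∣
  p≤∣p∣ p with ∣p∣≡p∨∣p∣≡-p p
  ... | inj₁ eq = ≤-reflexive (sym eq)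
  ... | inj₂ eq = ≤-trans p≤0 (0≤∣p∣ p)
    where
    p≤0 : p ≤ 0ℚ
    p≤0 = subst (_≤ 0ℚ) (solve 1 (λ x → :- (:- x) := x) refl p)
            (neg-antimono-≤ (subst (0ℚ ≤_) eq (0≤∣p∣ p)))

  ∣p-q∣≡∣q-p∣ : ∀ p q → ∣ p - q ∣ ≡ ∣ q - p ∣
  ∣p-q∣≡∣q-p∣ p q = trans (cong ∣_∣ (solve 2 (λ x y → x :- y := :- (y :- x)) refl p q)) (∣-p∣≡∣p∣ (q - p))

  ∣-∣≤⇒≤+ : ∀ p q {δ} → ∣ p - q ∣ ≤ δ → p ≤ q + δ
  ∣-∣≤⇒≤+ p q {δ} h = begin
    p              ≡⟨ solve 2 (λ x y → x := y :+ (x :- y)) refl p q ⟩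
    q + (p - q)    ≤⟨ +-monoʳ-≤ q (≤-trans (p≤∣p∣ (p - q)) h) ⟩
    q + δ          ∎

  ≤+⇒-≤ : ∀ p q {δ} → p ≤ q + δ → p - q ≤ δ
  ≤+⇒-≤ p q {δ} h = begin
    p - q          ≤⟨ +-monoˡ-≤ (- q) h ⟩
    q + δ - q      ≡⟨ solve 2 (λ y d → y :+ d :- y := d) refl q δ ⟩
    δ              ∎

  ≤+⇒∣-∣≤ : ∀ p q {δ} → p ≤ q + δ → q ≤ p + δ → ∣ p - q ∣ ≤ δ
  ≤+⇒∣-∣≤ p q {δ} h₁ h₂ with ∣p∣≡p∨∣p∣≡-p (p - q)
  ... | inj₁ eq = ≤-trans (≤-reflexive eq) (≤+⇒-≤ p q h₁)
  ... | inj₂ eq = ≤-trans (≤-reflexive (trans eq (solve 2 (λ x y → :- (x :- y) := y :- x) refl p q)))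
                          (≤+⇒-≤ q p h₂)

  ∣-∣-+ : ∀ p q r s → ∣ (p + q) - (r + s) ∣ ≤ ∣ p - r ∣ + ∣ q - s ∣
  ∣-∣-+ p q r s = begin
    ∣ (p + q) - (r + s) ∣    ≡⟨ cong ∣_∣ (solve 4 (λ p q r s → p :+ q :- (r :+ s) := p :- r :+ (q :- s)) refl p q r s) ⟩
    ∣ (p - r) + (q - s) ∣    ≤⟨ ∣p+q∣≤∣p∣+∣q∣ (p - r) (q - s) ⟩
    ∣ p - r ∣ + ∣ q - s ∣    ∎

  ∣-∣-* : ∀ p q r s → ∣ p * q - r * s ∣ ≤ ∣ p ∣ * ∣ q - s ∣ + ∣ p - r ∣ * ∣ s ∣
  ∣-∣-* p q r s = begin
    ∣ p * q - r * s ∣                            ≡⟨ cong ∣_∣ (solve 4 (λ p q r s → p :* q :- r :* s := p :* (q :- s) :+ (p :- r) :* s) refl p q r s) ⟩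
    ∣ p * (q - s) + (p - r) * s ∣                ≤⟨ ∣p+q∣≤∣p∣+∣q∣ (p * (q - s)) ((p - r) * s) ⟩
    ∣ p * (q - s) ∣ + ∣ (p - r) * s ∣            ≡⟨ cong₂ _+_ (∣p*q∣≡∣p∣*∣q∣ p (q - s)) (∣p*q∣≡∣p∣*∣q∣ (p - r) s) ⟩
    ∣ p ∣ * ∣ q - s ∣ + ∣ p - r ∣ * ∣ s ∣        ∎

  ∣-∣-*-≤ : ∀ p q r s {η B B⁻¹ D D⁻¹} → 0ℚ < η → 0ℚ < D → 0ℚ < B⁻¹ → B * B⁻¹ ≡ 1ℚ → D * D⁻¹ ≡ 1ℚ →
    ∣ p ∣ ≤ B → ∣ s ∣ ≤ D → ∣ p - r ∣ ≤ η * D⁻¹ → ∣ q - s ∣ ≤ η * B⁻¹ →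
    ∣ p * q - r * s ∣ ≤ η + η
  ∣-∣-*-≤ p q r s {η} {B} {B⁻¹} {D} {D⁻¹} 0<η 0<D 0<B⁻¹ BB⁻¹≡1 DD⁻¹≡1 p≤B s≤D p≈r q≈s = begin
    ∣ p * q - r * s ∣                        ≤⟨ ∣-∣-* p q r s ⟩
    ∣ p ∣ * ∣ q - s ∣ + ∣ p - r ∣ * ∣ s ∣    ≤⟨ +-mono-≤ (*-mono (0≤∣p∣ p) (<⇒≤ (*-pos 0<η 0<B⁻¹)) p≤B q≈s)
                                                         (*-mono (0≤∣p∣ (p - r)) (<⇒≤ 0<D) p≈r s≤D) ⟩
    B * (η * B⁻¹) + η * D⁻¹ * D              ≡⟨ solve 5 (λ b b' d d' h → b :* (h :* b') :+ h :* d' :* d := h :* (b :* b') :+ h :* (d :* d'))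
                                                  refl B B⁻¹ D D⁻¹ η ⟩
    η * (B * B⁻¹) + η * (D * D⁻¹)            ≡⟨ cong₂ (λ u v → η * u + η * v) BB⁻¹≡1 DD⁻¹≡1 ⟩
    η * 1ℚ + η * 1ℚ                          ≡⟨ cong₂ _+_ (*-identityʳ η) (*-identityʳ η) ⟩
    η + η                                    ∎

  ∣p∣≤∣q∣+∣p-q∣ : ∀ p q → ∣ p ∣ ≤ ∣ q ∣ + ∣ p - q ∣
  ∣p∣≤∣q∣+∣p-q∣ p q = begin
    ∣ p ∣                  ≡⟨ cong ∣_∣ (solve 2 (λ x y → x := y :+ (x :- y)) refl p q) ⟩
    ∣ q + (p - q) ∣        ≤⟨ ∣p+q∣≤∣p∣+∣q∣ q (p - q) ⟩
    ∣ q ∣ + ∣ p - q ∣      ∎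

  ∣∣p∣-∣q∣∣≤∣p-q∣ : ∀ p q → ∣ ∣ p ∣ - ∣ q ∣ ∣ ≤ ∣ p - q ∣
  ∣∣p∣-∣q∣∣≤∣p-q∣ p q = ≤+⇒∣-∣≤ ∣ p ∣ ∣ q ∣ (∣p∣≤∣q∣+∣p-q∣ p q)
    (subst (λ e → ∣ q ∣ ≤ ∣ p ∣ + e) (∣p-q∣≡∣q-p∣ q p) (∣p∣≤∣q∣+∣p-q∣ q p))

  ∣1/p-1/q∣ : ∀ {p q r s δ} → 0ℚ < δ → δ ≤ p → δ ≤ q → p * r ≡ 1ℚ → q * s ≡ 1ℚ →
              ∀ {η} → ∣ p - q ∣ ≤ η * (δ * δ) → ∣ r - s ∣ ≤ η
  ∣1/p-1/q∣ {p} {q} {r} {s} {δ} 0<δ δ≤p δ≤q pr≡1 qs≡1 {η} h =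
    *-cancelʳ-≤-pos (δ * δ) {{positive (*-pos 0<δ 0<δ)}} $ begin
      ∣ r - s ∣ * (δ * δ)        ≤⟨ *-monoˡ ∣ r - s ∣ (0≤∣p∣ (r - s)) (*-mono 0≤δ 0≤q δ≤p δ≤q) ⟩
      ∣ r - s ∣ * (p * q)        ≡⟨ cong (∣ r - s ∣ *_) (0≤p⇒∣p∣≡p 0≤pq) ⟨
      ∣ r - s ∣ * ∣ p * q ∣      ≡⟨ ∣p*q∣≡∣p∣*∣q∣ (r - s) (p * q) ⟨
      ∣ (r - s) * (p * q) ∣      ≡⟨ cong ∣_∣ (solve 4 (λ p q r s → (r :- s) :* (p :* q) := (p :* r) :* q :- (q :* s) :* p) refl p q r s) ⟩
      ∣ p * r * q - q * s * p ∣  ≡⟨ cong₂ (λ x y → ∣ x * q - y * p ∣) pr≡1 qs≡1 ⟩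
      ∣ 1ℚ * q - 1ℚ * p ∣        ≡⟨ cong₂ (λ x y → ∣ x - y ∣) (*-identityˡ q) (*-identityˡ p) ⟩
      ∣ q - p ∣                  ≡⟨ ∣p-q∣≡∣q-p∣ q p ⟩
      ∣ p - q ∣                  ≤⟨ h ⟩
      η * (δ * δ)                ∎
    where
    0≤δ : 0ℚ ≤ δ
    0≤δ = <⇒≤ 0<δ
    0≤q : 0ℚ ≤ q
    0≤q = ≤-trans 0≤δ δ≤q
    0≤pq : 0ℚ ≤ p * q
    0≤pq = <⇒≤ (*-pos (<-≤-trans 0<δ δ≤p) (<-≤-trans 0<δ δ≤q))

  num : ℚ → ℕ
  num q = ℤ.∣ ↥ q ∣

  q*↧q≡↥q : ∀ q → q * fromℕ (↧ₙ q) ≡ fromℤ (↥ q)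
  q*↧q≡↥q q@(mkℚ n d _) = begin-equality
    q * fromℕ (suc d)                        ≡⟨ cong (_* fromℕ (suc d)) (trans (sym (fromℚᵘ-toℚᵘ q)) (i/n≡i*unit n d)) ⟩
    fromℤ n * unit d * fromℕ (suc d)         ≡⟨ solve 3 (λ a b c → a :* b :* c := a :* (c :* b)) refl (fromℤ n) (unit d) (fromℕ (suc d)) ⟩
    fromℤ n * (fromℕ (suc d) * unit d)       ≡⟨ cong (fromℤ n *_) (n/n≡1 d) ⟩
    fromℤ n * 1ℚ                             ≡⟨ *-identityʳ _ ⟩
    fromℤ n                                  ∎

  ↥q≡num : ∀ q → 0ℚ < q → ℤ.+ (num q) ≡ ↥ q
  ↥q≡num (mkℚ (ℤ.+ n)      d _) _          = refl
  ↥q≡num (mkℚ ℤ.-[1+ n ]   d _) (*<* ())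

  num≥1 : ∀ q → 0ℚ < q → 1 ℕ.≤ num q
  num≥1 (mkℚ (ℤ.+ zero)   d _) (*<* (ℤ.+<+ ()))
  num≥1 (mkℚ ℤ.+[1+ n ]   d _) _          = ℕ.s≤s ℕ.z≤n
  num≥1 (mkℚ ℤ.-[1+ n ]   d _) (*<* ())

  q*↧q≡num : ∀ q → 0ℚ < q → q * fromℕ (↧ₙ q) ≡ fromℕ (num q)
  q*↧q≡num q 0<q = trans (q*↧q≡↥q q) (cong fromℤ (sym (↥q≡num q 0<q)))

  cross-multiply : ∀ p q N → 0ℚ < p → 0ℚ < q → p * fromℕ N ≤ q * fromℕ (suc N) →
    num p ℕ.* ↧ₙ q ℕ.* N ℕ.≤ num q ℕ.* ↧ₙ p ℕ.* suc N
  cross-multiply p q N 0<p 0<q h = fromℕ-cancel $ begin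
    fromℕ (num p ℕ.* ↧ₙ q ℕ.* N)              ≡⟨ fromℕ-*₃ (num p) (↧ₙ q) N ⟩
    fromℕ (num p) * fromℕ (↧ₙ q) * fromℕ N    ≡⟨ cong (λ x → x * fromℕ (↧ₙ q) * fromℕ N) (q*↧q≡num p 0<p) ⟨
    p * dp * dq * fromℕ N                     ≡⟨ solve 4 (λ p a b n → p :* a :* b :* n := p :* n :* (a :* b)) refl p dp dq (fromℕ N) ⟩
    p * fromℕ N * (dp * dq)                   ≤⟨ *-monoʳ (dp * dq) 0≤dpdq h ⟩
    q * fromℕ (suc N) * (dp * dq)             ≡⟨ solve 4 (λ q a b n → q :* n :* (a :* b) := q :* b :* a :* n) refl q dp dq (fromℕ (suc N)) ⟩
    q * dq * dp * fromℕ (suc N)               ≡⟨ cong (λ x → x * fromℕ (↧ₙ p) * fromℕ (suc N)) (q*↧q≡num q 0<q) ⟩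
    fromℕ (num q) * dp * fromℕ (suc N)        ≡⟨ fromℕ-*₃ (num q) (↧ₙ p) (suc N) ⟨
    fromℕ (num q ℕ.* ↧ₙ p ℕ.* suc N)          ∎
    where
    dp = fromℕ (↧ₙ p)
    dq = fromℕ (↧ₙ q)
    0≤dpdq : 0ℚ ≤ dp * dq
    0≤dpdq = subst (0ℚ ≤_) (fromℕ-* (↧ₙ p) (↧ₙ q)) (fromℕ-mono {0} {↧ₙ p ℕ.* ↧ₙ q} ℕ.z≤n)

  -- For q = a / b > 0 and K = k + 1 this is (⌊log₂ a ^ K⌋ - ⌊log₂ b ^ K⌋) / K,
  -- which differs from log₂ q by less than 1/K.
  log₂-approx : ℕ → ℚ → ℚ
  log₂-approx k q = (ℤ.+ ⌊log₂ num q ℕ.^ suc k ⌋ ℤ.- ℤ.+ ⌊log₂ ↧ₙ q ℕ.^ suc k ⌋) / suc k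

  log₂-approx-≤ : ∀ k j m {p q} → 0ℚ < p → 0ℚ < q →
    p * fromℕ (4 ℕ.^ suc m) ≤ q * fromℕ (suc (4 ℕ.^ suc m)) →
    log₂-approx k p ≤ log₂-approx j q + (unit k + unit j + unit m)
  log₂-approx-≤ k j m {p} {q} 0<p 0<q h = begin
    log₂-approx k p
      ≡⟨ expand α β k ⟩
    (A - B) * κ
      ≡⟨ one₂ ((A - B) * κ) ⟩
    (A - B) * κ * (J * ι * (M * μ))
      ≡⟨ solve 8 (λ A B D κ J ι M μ → (A :- B) :* κ :* (J :* ι :* (M :* μ)) :=
           A :* (J :* M) :* (κ :* ι :* μ) :- B :* (J :* M) :* (κ :* ι :* μ)) refl A B D κ J ι M μ ⟩
    A * (J * M) * t - B * (J * M) * t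
      ≡⟨ solve 7 (λ A B D J K M t → A :* (J :* M) :* t :- B :* (J :* M) :* t :=
           (A :* (J :* M) :+ D :* (K :* M)) :* t :+ (:- (B :* (J :* M) :* t) :- D :* (K :* M) :* t)) refl A B D J K M t ⟩
    (A * (J * M) + D * (K * M)) * t + (- (B * (J * M) * t) - D * (K * M) * t)
      ≤⟨ +-monoˡ-≤ _ (*-monoʳ t 0≤t main) ⟩
    (C * (K * M) + B * (J * M) + (K * M + J * M + K * J)) * t + (- (B * (J * M) * t) - D * (K * M) * t)
      ≡⟨ solve 10 (λ B C D K J M κ ι μ t →
           (C :* (K :* M) :+ B :* (J :* M) :+ (K :* M :+ J :* M :+ K :* J)) :* t :+ (:- (B :* (J :* M) :* t) :- D :* (K :* M) :* t) :=
           (C :- D) :* (K :* M :* t) :+ (J :* M :* t :+ K :* M :* t :+ K :* J :* t)) refl B C D K J M κ ι μ t ⟩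
    (C - D) * (K * M * t) + (J * M * t + K * M * t + K * J * t)
      ≡⟨ cong₂ _+_ (cong ((C - D) *_) KM) (cong₂ _+_ (cong₂ _+_ JM KM) KJ) ⟩
    (C - D) * ι + (κ + ι + μ)
      ≡⟨ cong (_+ (κ + ι + μ)) (expand γ δ j) ⟨
    log₂-approx j q + (κ + ι + μ)
      ∎
    where
    α = ⌊log₂ num p ℕ.^ suc k ⌋
    β = ⌊log₂ ↧ₙ p ℕ.^ suc k ⌋
    γ = ⌊log₂ num q ℕ.^ suc j ⌋
    δ = ⌊log₂ ↧ₙ q ℕ.^ suc j ⌋
    A = fromℕ α
    B = fromℕ β
    C = fromℕ γ
    D = fromℕ δ
    K = fromℕ (suc k)
    J = fromℕ (suc j)
    M = fromℕ (suc m)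
    κ = unit k
    ι = unit j
    μ = unit m
    t = κ * ι * μ
    0≤t : 0ℚ ≤ t
    0≤t = <⇒≤ (*-pos (*-pos (unit>0 k) (unit>0 j)) (unit>0 m))
    expand : ∀ a b n → (ℤ.+ a ℤ.- ℤ.+ b) / suc n ≡ (fromℕ a - fromℕ b) * unit n
    expand a b n = trans (i/n≡i*unit (ℤ.+ a ℤ.- ℤ.+ b) n) (cong (_* unit n)
      (trans (solve 2 (λ x y → x := x :+ y :- y) refl (fromℤ (ℤ.+ a ℤ.- ℤ.+ b)) (fromℕ b))
             (cong (_- fromℕ b) (trans (sym (fromℤ-+ (ℤ.+ a ℤ.- ℤ.+ b) (ℤ.+ b)))
               (cong fromℤ (trans (ℤ.+-assoc (ℤ.+ a) (ℤ.- (ℤ.+ b)) (ℤ.+ b))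
                 (trans (cong (ℤ._+_ (ℤ.+ a)) (ℤ.+-inverseˡ (ℤ.+ b))) (ℤ.+-identityʳ (ℤ.+ a)))))))))
    one₂ : ∀ x → x ≡ x * (J * ι * (M * μ))
    one₂ x = sym (trans (cong₂ (λ a b → x * (a * b)) (n/n≡1 j) (n/n≡1 m)) (*-identityʳ x))
    cancel : ∀ {a b} c → a ≡ 1ℚ → b ≡ 1ℚ → a * b * c ≡ c
    cancel c refl refl = *-identityˡ c
    KM : K * M * t ≡ ι
    KM = trans (solve 5 (λ K M κ ι μ → K :* M :* (κ :* ι :* μ) := K :* κ :* (M :* μ) :* ι) refl K M κ ι μ)
               (cancel ι (n/n≡1 k) (n/n≡1 m))
    JM : J * M * t ≡ κ
    JM = trans (solve 5 (λ J M κ ι μ → J :* M :* (κ :* ι :* μ) := J :* ι :* (M :* μ) :* κ) refl J M κ ι μ)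
               (cancel κ (n/n≡1 j) (n/n≡1 m))
    KJ : K * J * t ≡ μ
    KJ = trans (solve 5 (λ K J κ ι μ → K :* J :* (κ :* ι :* μ) := K :* κ :* (J :* ι) :* μ) refl K J κ ι μ)
               (cancel μ (n/n≡1 k) (n/n≡1 j))
    term : ∀ a b c → fromℕ (a ℕ.* (b ℕ.* c)) ≡ fromℕ a * (fromℕ b * fromℕ c)
    term a b c = trans (fromℕ-* a (b ℕ.* c)) (cong (fromℕ a *_) (fromℕ-* b c))
    k' = suc k
    j' = suc j
    m' = suc m
    main : A * (J * M) + D * (K * M) ≤ C * (K * M) + B * (J * M) + (K * M + J * M + K * J)
    main = subst₂ _≤_
      (trans (fromℕ-+ (α ℕ.* (j' ℕ.* m')) (δ ℕ.* (k' ℕ.* m')))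
             (cong₂ _+_ (term α j' m') (term δ k' m')))
      (trans (fromℕ-+ (γ ℕ.* (k' ℕ.* m') ℕ.+ β ℕ.* (j' ℕ.* m')) (k' ℕ.* m' ℕ.+ j' ℕ.* m' ℕ.+ k' ℕ.* j'))
             (cong₂ _+_
               (trans (fromℕ-+ (γ ℕ.* (k' ℕ.* m')) (β ℕ.* (j' ℕ.* m')))
                      (cong₂ _+_ (term γ k' m') (term β j' m')))
               (trans (fromℕ-+ (k' ℕ.* m' ℕ.+ j' ℕ.* m') (k' ℕ.* j'))
                      (cong₂ _+_ (trans (fromℕ-+ (k' ℕ.* m') (j' ℕ.* m'))
                                        (cong₂ _+_ (fromℕ-* k' m') (fromℕ-* j' m')))
                                 (fromℕ-* k' j')))))
      (fromℕ-mono (ℕ-Lemmas.⌊log₂⌋-compare (num p) (↧ₙ p) (num q) (↧ₙ q) k' j' m' (4 ℕ.^ m')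
        (num≥1 p 0<p) (ℕ.s≤s ℕ.z≤n) (num≥1 q 0<q) (ℕ.s≤s ℕ.z≤n) {{ℕ.m^n≢0 4 m'}}
        (ℕ-Lemmas.[1+4^M]^M≤2*[4^M]^M m')
        (cross-multiply p q (4 ℕ.^ m') 0<p 0<q h)))

  ⅓ : ℚ
  ⅓ = ℤ.+ 1 / 3

  thirds : ∀ η {p q r} → p ≤ η * ⅓ → q ≤ η * ⅓ → r ≤ η * ⅓ → p + q + r ≤ η
  thirds η {p} {q} {r} p≤ q≤ r≤ = begin
    p + q + r                        ≤⟨ +-mono-≤ (+-mono-≤ p≤ q≤) r≤ ⟩
    η * ⅓ + η * ⅓ + η * ⅓            ≡⟨ cong (_+ η * ⅓) (*-distribˡ-+ η ⅓ ⅓) ⟨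
    η * (⅓ + ⅓) + η * ⅓              ≡⟨ *-distribˡ-+ η (⅓ + ⅓) ⅓ ⟨
    η * 1ℚ                           ≡⟨ *-identityʳ η ⟩
    η                                ∎

  0<4^ : ∀ k → 0ℚ < fromℕ (4 ℕ.^ k)
  0<4^ k = <-≤-trans (positive⁻¹ 1ℚ) (fromℕ-mono {1} (ℕ.m^n>0 4 k))

  ratio : ∀ F p q {δ r} → fromℕ F * r ≡ 1ℚ → δ ≤ q → ∣ p - q ∣ ≤ δ * r →
    p * fromℕ F ≤ q * fromℕ (suc F)
  ratio F p q {δ} {r} Fr≡1 δ≤q h = begin
    p * φ                   ≤⟨ *-monoʳ φ (fromℕ-mono {0} {F} ℕ.z≤n) (∣-∣≤⇒≤+ p q h) ⟩
    (q + δ * r) * φ         ≡⟨ solve 4 (λ q d r f → (q :+ d :* r) :* f := d :* (f :* r) :+ q :* f) refl q δ r φ ⟩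
    δ * (φ * r) + q * φ     ≡⟨ cong (λ u → δ * u + q * φ) Fr≡1 ⟩
    δ * 1ℚ + q * φ          ≡⟨ cong (_+ q * φ) (*-identityʳ δ) ⟩
    δ + q * φ               ≤⟨ +-monoˡ-≤ (q * φ) δ≤q ⟩
    q + q * φ               ≡⟨ cong (_+ q * φ) (*-identityʳ q) ⟨
    q * 1ℚ + q * φ          ≡⟨ *-distribˡ-+ q 1ℚ φ ⟨
    q * (1ℚ + φ)            ≡⟨ cong (q *_) (fromℕ-+ 1 F) ⟨
    q * fromℕ (suc F)       ∎
    where φ = fromℕ F

-- Real numbers are Cauchy sequences of rationals; their equality is _≃_, not _≡_.

IsCauchy : (ℕ → ℚ) → Set
IsCauchy s = ∀ δ → 0ℚ ℚ.< δ → ∃[ N ] (∀ m n → N ℕ.≤ m → N ℕ.≤ n → ℚ.∣ s m ℚ.- s n ∣ ℚ.≤ δ)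

record ℝ : Set where
  constructor real
  field
    seq    : ℕ → ℚ
    cauchy : IsCauchy seq

open ℝ public

module ℝ-Lemmas where
  open import Data.Rational.Base
  open import Data.Rational.Properties
  open ℚ-Lemmas
  open ≤-Reasoning

  const-cauchy : ∀ q → IsCauchy (λ _ → q)
  const-cauchy q δ 0<δ = 0 , λ _ _ _ _ →
    ≤-trans (≤-reflexive (cong ∣_∣ (+-inverseʳ q))) (<⇒≤ 0<δ)

  bound : (x : ℝ) → ∃[ B ] (0ℚ < B × ∃[ N ] (∀ n → N ℕ.≤ n → ∣ seq x n ∣ ≤ B))
  bound x with cauchy x 1ℚ (positive⁻¹ 1ℚ)
  ... | N , close = ∣ seq x N ∣ + 1ℚ
    , <-≤-trans (positive⁻¹ 1ℚ) (subst (_≤ ∣ seq x N ∣ + 1ℚ) (+-identityˡ 1ℚ) (+-monoˡ-≤ 1ℚ (0≤∣p∣ (seq x N))))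
    , N , λ n N≤n → ≤-trans (∣p∣≤∣q∣+∣p-q∣ (seq x n) (seq x N))
                            (+-monoʳ-≤ ∣ seq x N ∣ (close n N N≤n ℕ.≤-refl))

  +-cauchy : ∀ x y → IsCauchy (λ n → seq x n + seq y n)
  +-cauchy x y δ 0<δ with cauchy x (δ * ½) (half 0<δ) | cauchy y (δ * ½) (half 0<δ)
  ... | N₁ , c₁ | N₂ , c₂ = N₁ ℕ.⊔ N₂ , λ m n N≤m N≤n → begin
    ∣ (seq x m + seq y m) - (seq x n + seq y n) ∣
      ≤⟨ ∣-∣-+ (seq x m) (seq y m) (seq x n) (seq y n) ⟩
    ∣ seq x m - seq x n ∣ + ∣ seq y m - seq y n ∣
      ≤⟨ +-mono-≤ (c₁ m n (ℕ.m⊔n≤o⇒m≤o N₁ N₂ N≤m) (ℕ.m⊔n≤o⇒m≤o N₁ N₂ N≤n))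
                  (c₂ m n (ℕ.m⊔n≤o⇒n≤o N₁ N₂ N≤m) (ℕ.m⊔n≤o⇒n≤o N₁ N₂ N≤n)) ⟩
    δ * ½ + δ * ½
      ≡⟨ half+half δ ⟩
    δ ∎

  neg-cauchy : ∀ x → IsCauchy (λ n → - seq x n)
  neg-cauchy x δ 0<δ with cauchy x δ 0<δ
  ... | N , c = N , λ m n N≤m N≤n → begin
    ∣ - seq x m - - seq x n ∣    ≡⟨ cong ∣_∣ (neg-distrib-+ (seq x m) (- seq x n)) ⟨
    ∣ - (seq x m - seq x n) ∣    ≡⟨ ∣-p∣≡∣p∣ (seq x m - seq x n) ⟩
    ∣ seq x m - seq x n ∣        ≤⟨ c m n N≤m N≤n ⟩
    δ                            ∎

  ∣-∣-cauchy : ∀ x → IsCauchy (λ n → ∣ seq x n ∣)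
  ∣-∣-cauchy x δ 0<δ with cauchy x δ 0<δ
  ... | N , c = N , λ m n N≤m N≤n →
    ≤-trans (∣∣p∣-∣q∣∣≤∣p-q∣ (seq x m) (seq x n)) (c m n N≤m N≤n)

  *-cauchy : ∀ x y → IsCauchy (λ n → seq x n * seq y n)
  *-cauchy x y δ 0<δ =
    let B , 0<B , N₁ , b₁      = bound x
        D , 0<D , N₂ , b₂      = bound y
        B⁻¹ , 0<B⁻¹ , BB⁻¹≡1   = 1/-pos 0<B
        D⁻¹ , 0<D⁻¹ , DD⁻¹≡1   = 1/-pos 0<D
        N₃ , c₁                = cauchy x (δ * ½ * D⁻¹) (*-pos (half 0<δ) 0<D⁻¹)
        N₄ , c₂                = cauchy y (δ * ½ * B⁻¹) (*-pos (half 0<δ) 0<B⁻¹)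
    in (N₁ ℕ.⊔ N₂) ℕ.⊔ (N₃ ℕ.⊔ N₄) , λ m n N≤m N≤n →
      let N₁₂≤m = ℕ.m⊔n≤o⇒m≤o (N₁ ℕ.⊔ N₂) (N₃ ℕ.⊔ N₄) N≤m
          N₁₂≤n = ℕ.m⊔n≤o⇒m≤o (N₁ ℕ.⊔ N₂) (N₃ ℕ.⊔ N₄) N≤n
          N₃₄≤m = ℕ.m⊔n≤o⇒n≤o (N₁ ℕ.⊔ N₂) (N₃ ℕ.⊔ N₄) N≤m
          N₃₄≤n = ℕ.m⊔n≤o⇒n≤o (N₁ ℕ.⊔ N₂) (N₃ ℕ.⊔ N₄) N≤n
      in ∣-∣-*-≤ (seq x m) (seq y m) (seq x n) (seq y n) (half 0<δ) 0<D 0<B⁻¹ BB⁻¹≡1 DD⁻¹≡1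
           (b₁ m (ℕ.m⊔n≤o⇒m≤o N₁ N₂ N₁₂≤m))
           (b₂ n (ℕ.m⊔n≤o⇒n≤o N₁ N₂ N₁₂≤n))
           (c₁ m n (ℕ.m⊔n≤o⇒m≤o N₃ N₄ N₃₄≤m) (ℕ.m⊔n≤o⇒m≤o N₃ N₄ N₃₄≤n))
           (c₂ m n (ℕ.m⊔n≤o⇒n≤o N₃ N₄ N₃₄≤m) (ℕ.m⊔n≤o⇒n≤o N₃ N₄ N₃₄≤n))
         ⟨≡⟩ half+half δ
    where
    _⟨≡⟩_ : ∀ {p q r : ℚ} → p ≤ q → q ≡ r → p ≤ r
    p≤q ⟨≡⟩ q≡r = ≤-trans p≤q (≤-reflexive q≡r)

  0+δ≤q⇒δ≤q : ∀ δ q → 0ℚ + δ ≤ q → δ ≤ q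
  0+δ≤q⇒δ≤q δ q = subst (_≤ q) (+-identityˡ δ)

  δ≤q⇒0+δ≤q : ∀ δ q → δ ≤ q → 0ℚ + δ ≤ q
  δ≤q⇒0+δ≤q δ q = subst (_≤ q) (sym (+-identityˡ δ))

  1/-cauchy : ∀ x {δ N} → 0ℚ < δ → (r : ℕ → ℚ) →
    (∀ n → δ ≤ seq x (N ℕ.+ n) × seq x (N ℕ.+ n) * r n ≡ 1ℚ) → IsCauchy r
  1/-cauchy x {δ} {N} 0<δ r spec η 0<η with cauchy x (η * (δ * δ)) (*-pos 0<η (*-pos 0<δ 0<δ))
  ... | N′ , c = N′ , λ m n N′≤m N′≤n →
    ∣1/p-1/q∣ 0<δ (proj₁ (spec m)) (proj₁ (spec n)) (proj₂ (spec m)) (proj₂ (spec n))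
      (c (N ℕ.+ m) (N ℕ.+ n) (ℕ.≤-trans N′≤m (ℕ.m≤n+m m N)) (ℕ.≤-trans N′≤n (ℕ.m≤n+m n N)))

  log₂-cauchy : ∀ x {δ N} → 0ℚ < δ → (∀ n → N ℕ.≤ n → δ ≤ seq x n) →
    IsCauchy (λ n → log₂-approx n (seq x n))
  log₂-cauchy x {δ} {N} 0<δ δ≤x η 0<η =
    let k , k-small       = archimedean (η * ⅓) (*-pos 0<η (positive⁻¹ ⅓))
        r , 0<r , Fr≡1    = 1/-pos (0<4^ (suc k))
        N′ , c            = cauchy x (δ * r) (*-pos 0<δ 0<r)
        within : ∀ m n → N ℕ.⊔ N′ ℕ.⊔ k ℕ.≤ m → N ℕ.⊔ N′ ℕ.⊔ k ℕ.≤ n →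
                 log₂-approx m (seq x m) ≤ log₂-approx n (seq x n) + η
        within m n M≤m M≤n =
          let δ≤xₘ = δ≤x m (ℕ.m⊔n≤o⇒m≤o N N′ (ℕ.m⊔n≤o⇒m≤o (N ℕ.⊔ N′) k M≤m))
              δ≤xₙ = δ≤x n (ℕ.m⊔n≤o⇒m≤o N N′ (ℕ.m⊔n≤o⇒m≤o (N ℕ.⊔ N′) k M≤n))
              close = c m n (ℕ.m⊔n≤o⇒n≤o N N′ (ℕ.m⊔n≤o⇒m≤o (N ℕ.⊔ N′) k M≤m))
                            (ℕ.m⊔n≤o⇒n≤o N N′ (ℕ.m⊔n≤o⇒m≤o (N ℕ.⊔ N′) k M≤n))
          in ≤-trans
               (log₂-approx-≤ m n k (<-≤-trans 0<δ δ≤xₘ) (<-≤-trans 0<δ δ≤xₙ)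
                 (ratio (4 ℕ.^ suc k) (seq x m) (seq x n) Fr≡1 δ≤xₙ close))
               (+-monoʳ-≤ (log₂-approx n (seq x n))
                 (thirds η (≤-trans (unit-antimono (ℕ.m⊔n≤o⇒n≤o (N ℕ.⊔ N′) k M≤m)) k-small)
                           (≤-trans (unit-antimono (ℕ.m⊔n≤o⇒n≤o (N ℕ.⊔ N′) k M≤n)) k-small)
                           k-small))
    in N ℕ.⊔ N′ ℕ.⊔ k , λ m n M≤m M≤n →
         ≤+⇒∣-∣≤ (log₂-approx m (seq x m)) (log₂-approx n (seq x n))
           (within m n M≤m M≤n) (within n m M≤n M≤m)

infix 4 _≃_ _≤_ _<_

_≃_ _≤_ _<_ : ℝ → ℝ → Set
x ≃ y = ∀ δ → 0ℚ ℚ.< δ → ∃[ N ] (∀ n → N ℕ.≤ n → ℚ.∣ seq x n ℚ.- seq y n ∣ ℚ.≤ δ)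
x ≤ y = ∀ δ → 0ℚ ℚ.< δ → ∃[ N ] (∀ n → N ℕ.≤ n → seq x n ℚ.≤ seq y n ℚ.+ δ)
x < y = ∃[ δ ] (0ℚ ℚ.< δ × ∃[ N ] (∀ n → N ℕ.≤ n → seq x n ℚ.+ δ ℚ.≤ seq y n))

fromℚ : ℚ → ℝ
fromℚ q = real (λ _ → q) (ℝ-Lemmas.const-cauchy q)

fromℤ : ℤ → ℝ
fromℤ i = fromℚ (i ℚ./ 1)

fromℕ : ℕ → ℝ
fromℕ n = fromℤ (ℤ.+ n)

0ℝ 1ℝ : ℝ
0ℝ = fromℕ 0
1ℝ = fromℕ 1

infixl 6 _+_ _-_
infixl 7 _*_ _/_
infixr 8 _^_
infix  8 -_

_+_ _*_ : ℝ → ℝ → ℝ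
x + y = real (λ n → seq x n ℚ.+ seq y n) (ℝ-Lemmas.+-cauchy x y)
x * y = real (λ n → seq x n ℚ.* seq y n) (ℝ-Lemmas.*-cauchy x y)

-_ ∣_∣ : ℝ → ℝ
-_ x  = real (λ n → ℚ.- seq x n) (ℝ-Lemmas.neg-cauchy x)
∣ x ∣ = real (λ n → ℚ.∣ seq x n ∣) (ℝ-Lemmas.∣-∣-cauchy x)

_-_ : ℝ → ℝ → ℝ
x - y = x + (- y)

_^_ : ℝ → ℕ → ℝ
x ^ zero  = 1ℝ
x ^ suc n = x * x ^ n

ℝ⁺ : Set
ℝ⁺ = ∃[ x ] 0ℝ < x

fromℕ⁺ : (n : ℕ) → .{{NonZero n}} → ℝ⁺
fromℕ⁺ n@(suc m) = fromℕ n , 1ℚ , ℚ.positive⁻¹ 1ℚ , 0 , λ _ _ →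
  ℝ-Lemmas.δ≤q⇒0+δ≤q 1ℚ (ℚ-Lemmas.fromℕ n) (ℚ-Lemmas.fromℕ-mono {1} {n} (ℕ.s≤s ℕ.z≤n))

-- The sequence of x is bounded away from 0 only from index N on, so the
-- reciprocal starts there.
_⁻¹ : ℝ⁺ → ℝ
(x , δ , 0<δ , N , δ≤x) ⁻¹ =
  real r (ℝ-Lemmas.1/-cauchy x {δ} {N} 0<δ r λ n →
    δ≤ n , ℚ.*-inverseʳ (seq x (N ℕ.+ n)) {{nonZero n}})
  where
  δ≤ : ∀ n → δ ℚ.≤ seq x (N ℕ.+ n)
  δ≤ n = ℝ-Lemmas.0+δ≤q⇒δ≤q δ (seq x (N ℕ.+ n)) (δ≤x (N ℕ.+ n) (ℕ.m≤m+n N n))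
  nonZero : ∀ n → ℚ.NonZero (seq x (N ℕ.+ n))
  nonZero n = ℚ.>-nonZero (ℚ.<-≤-trans 0<δ (δ≤ n))
  r : ℕ → ℚ
  r n = (ℚ.1/ seq x (N ℕ.+ n)) {{nonZero n}}

*-positive : ∀ x y → 0ℝ < x → 0ℝ < y → 0ℝ < x * y
*-positive x y (δ , 0<δ , N , δ≤x) (η , 0<η , M , η≤y) =
  δ ℚ.* η , ℚ-Lemmas.*-pos 0<δ 0<η , N ℕ.⊔ M , λ n N⊔M≤n →
    let δ≤xₙ = ℝ-Lemmas.0+δ≤q⇒δ≤q δ (seq x n) (δ≤x n (ℕ.m⊔n≤o⇒m≤o N M N⊔M≤n))
        η≤yₙ = ℝ-Lemmas.0+δ≤q⇒δ≤q η (seq y n) (η≤y n (ℕ.m⊔n≤o⇒n≤o N M N⊔M≤n))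
    in ℝ-Lemmas.δ≤q⇒0+δ≤q (δ ℚ.* η) (seq x n ℚ.* seq y n)
         (ℚ-Lemmas.*-mono {δ} {seq x n} {η} {seq y n}
           (ℚ.<⇒≤ 0<δ) (ℚ.≤-trans (ℚ.<⇒≤ 0<η) η≤yₙ) δ≤xₙ η≤yₙ)

⁻¹-positive : (x : ℝ⁺) → 0ℝ < x ⁻¹
⁻¹-positive x⁺@(x , δ , 0<δ , N , δ≤x) =
  let B , 0<B , M , x≤B      = ℝ-Lemmas.bound x
      B⁻¹ , 0<B⁻¹ , BB⁻¹≡1   = ℚ-Lemmas.1/-pos 0<B
  in B⁻¹ , 0<B⁻¹ , M , λ n M≤n →
    let q    = seq x (N ℕ.+ n)
        0<q  = ℚ.<-≤-trans 0<δ (ℝ-Lemmas.0+δ≤q⇒δ≤q δ q (δ≤x (N ℕ.+ n) (ℕ.m≤m+n N n)))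
        q≤B  = ℚ.≤-trans (ℚ-Lemmas.p≤∣p∣ q) (x≤B (N ℕ.+ n) (ℕ.≤-trans M≤n (ℕ.m≤n+m n N)))
    in ℝ-Lemmas.δ≤q⇒0+δ≤q B⁻¹ (seq (x⁺ ⁻¹) n) (ℚ-Lemmas.1/-antimono 0<q q≤B BB⁻¹≡1)

_/_ : ℝ⁺ → ℝ⁺ → ℝ⁺
x / y = proj₁ x * y ⁻¹ , *-positive (proj₁ x) (y ⁻¹) (proj₂ x) (⁻¹-positive y)

-- Defined for every positive real, and independent of the proof of
-- positivity: the n-th term is within 1/(n+1) of the logarithm of the n-th
-- term of the argument.
log₂ : ℝ⁺ → ℝ
log₂ (x , δ , 0<δ , N , δ≤x) = real (λ n → ℚ-Lemmas.log₂-approx n (seq x n))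
  (ℝ-Lemmas.log₂-cauchy x {δ} {N} 0<δ λ n N≤n → ℝ-Lemmas.0+δ≤q⇒δ≤q δ (seq x n) (δ≤x n N≤n))

-- Elements of 𝕋 = ℝ / ℤ are given by arbitrary real representatives, compared
-- with _≈𝕋_.
infix 4 _≈𝕋_

_≈𝕋_ : ℝ → ℝ → Set
z ≈𝕋 w = ∃[ k ] z ≃ w + fromℤ k

-- The graph of z ↦ ∣ z mod 1 ∣ = ∣ ι z ∣, with r = ι z. Constructively ι is not
-- a function on ℝ, as it jumps at the half-integers.
IsAbsMod1 : ℝ → ℝ → Set
IsAbsMod1 z a = ∃[ r ] (r ≈𝕋 z × fromℚ -½ ≤ r × r < fromℚ ½ × a ≃ ∣ r ∣)

Cube : ℕ → Set
Cube n = Vec Bool n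

BooleanFunction : ℕ → Set
BooleanFunction n = Cube n → Bool

-- The graph of F ↦ ‖ F mod 1 ‖∞: the norm is a maximum, so it is attained.
IsNormMod1 : ∀ {n} → (Cube n → ℝ) → ℝ → Set
IsNormMod1 F M =
  (∀ x → ∃[ a ] (IsAbsMod1 (F x) a × a ≤ M)) × (∃[ x ] IsAbsMod1 (F x) M)

subsets : ∀ n → List (Subset n)
subsets zero    = Vec.[] ∷ []
subsets (suc n) = map (outside Vec.∷_) (subsets n) ++ map (inside Vec.∷_) (subsets n)

monomial : ∀ {n} → Subset n → Cube n → ℝ
monomial {n} S x =
  foldr (λ i y → (if lookup x i then 1ℝ else 0ℝ) * y) 1ℝ (filter (_∈? S) (allFin n))

polynomial : ∀ {n} → ℕ → (Subset n → ℝ) → Cube n → ℝ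
polynomial {n} d P x =
  foldr (λ S y → P S * monomial S x + y) 0ℝ (filter (λ S → Subset.∣ S ∣ ℕ.≤? d) (subsets n))

IsTorusPolynomial : ∀ {n} → ℕ → (Cube n → ℝ) → Set
IsTorusPolynomial {n} d F =
  Σ[ P ∈ (Subset n → ℝ) ] (∀ x → F x ≈𝕋 polynomial d P x)

Approximates : ∀ {n} → ℝ → (Cube n → ℝ) → BooleanFunction n → Set
Approximates ε F f =
  ∃[ M ] (IsNormMod1 (λ x → F x - fromℚ (if f x then ½ else 0ℚ)) M × M ≤ ε)

HasApproximation : ∀ {n} → ℝ → ℕ → BooleanFunction n → Set
HasApproximation {n} ε d f =
  Σ[ F ∈ (Cube n → ℝ) ] (IsTorusPolynomial d F × Approximates ε F f)

-- The graph of the toroidal ε-approximation degree.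
IsToroidalDegree : ∀ {n} → ℝ → BooleanFunction n → ℕ → Set
IsToroidalDegree ε f d =
  HasApproximation ε d f × (∀ e → HasApproximation ε e f → d ℕ.≤ e)

data Gate (m : ℕ) (W : Set) : Set where
  AND OR MOD : List W → Gate m W
  NOT        : W → Gate m W

-- Acyclic circuits with n inputs and s gates: each gate reads input
-- variables and previously introduced gates. Index zero denotes the most
-- recently introduced gate. A gate may read the same wire repeatedly.
data Gates (m n : ℕ) : ℕ → Set where
  ∅   : Gates m n 0
  _▷_ : ∀ {s} → Gates m n s → Gate m (Fin n ⊎ Fin s) → Gates m n (suc s)

record Circuit (m n : ℕ) : Set where
  field
    size   : ℕ
    gates  : Gates m n size
    output : Fin n ⊎ Fin size

open Circuit public

module _ {m : ℕ} where

  evalGate : {W : Set} → (W → Bool) → Gate m W → Bool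
  evalGate v (AND ws) = all v ws
  evalGate v (OR ws)  = any v ws
  evalGate v (NOT w)  = not (v w)
  evalGate v (MOD ws) = not ⌊ m ∣? sum (map (λ w → if v w then 1 else 0) ws) ⌋

  evalGates : ∀ {n s} → Cube n → Gates m n s → Vec Bool s
  evalGates x ∅        = Vec.[]
  evalGates x (gs ▷ g) = evalGate [ lookup x , lookup vs ]′ g Vec.∷ vs
    where vs = evalGates x gs

  eval : ∀ {n} → Circuit m n → Cube n → Bool
  eval C x = [ lookup x , lookup (evalGates x (gates C)) ]′ (output C)

  gateDepth : {W : Set} → (W → ℕ) → Gate m W → ℕ
  gateDepth d (AND ws) = suc (foldr ℕ._⊔_ 0 (map d ws))
  gateDepth d (OR ws)  = suc (foldr ℕ._⊔_ 0 (map d ws))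
  gateDepth d (MOD ws) = suc (foldr ℕ._⊔_ 0 (map d ws))
  gateDepth d (NOT w)  = suc (d w)

  gateDepths : ∀ {n s} → Gates m n s → Vec ℕ s
  gateDepths ∅        = Vec.[]
  gateDepths (gs ▷ g) = gateDepth [ (λ _ → 0) , lookup ds ]′ g Vec.∷ ds
    where ds = gateDepths gs

  -- The longest path from an input to the output; gates from which the
  -- output is not reachable do not count.
  depth : ∀ {n} → Circuit m n → ℕ
  depth C = [ (λ _ → 0) , lookup (gateDepths (gates C)) ]′ (output C)

-- Horner evaluation of the polynomial with the given coefficients, constant
-- term first.
evalPoly : List ℕ → ℕ → ℕ
evalPoly cs n = foldr (λ c v → c ℕ.+ n ℕ.* v) 0 cs

BooleanFamily : Set
BooleanFamily = ∀ n → .{{NonZero n}} → BooleanFunction n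

record ACC⁰ (f : BooleanFamily) : Set where
  field
    modulus       : ℕ
    modulus≥2     : 2 ℕ.≤ modulus
    maxDepth      : ℕ
    sizeBound     : List ℕ
    circuit       : ∀ n → .{{_ : NonZero n}} → Circuit modulus n
    computes      : ∀ n .{{_ : NonZero n}} x → eval (circuit n) x ≡ f n x
    depth-bounded : ∀ n → .{{_ : NonZero n}} → depth (circuit n) ℕ.≤ maxDepth
    size-bounded  : ∀ n → .{{_ : NonZero n}} → size (circuit n) ℕ.≤ evalPoly sizeBound n

{-# OPTIONS --safe #-}

-- The functions computed by the wires of depth at most ℓ satisfy, by induction
-- on ℓ: for all Q above a logarithmic threshold, any real multiple of a product
-- of at most Q of them is within 2^-Q, modulo 1, of a cube polynomial of degree
-- polynomial in Q.  Two closure properties carry this through one layer.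
--
-- MOD_p: let b be a Boolean function congruent modulo p to a low-degree integer
-- polynomial G.  Iterating a ↦ 3a² − 2a³ turns G into G′ ≡ b modulo M = p^(2^r).
-- Rounding the coefficient c to a / M makes c b close to (a / M) b, which equals
-- (a / M) G′ modulo 1; the monomials of G′ are treated by the induction
-- hypothesis.  For w = Σ y, divisibility of w by q = p^e is congruent modulo p
-- to the binomial coefficient (w + q − 1 choose q − 1), so prime power factors
-- account for MOD_m.
--
-- AND, OR: a disjunction is a limit of averages of parities.  If the parities
-- are the coordinates of a code of relative distance 1/5, the fraction of
-- vanishing parities is 1 for the zero vector and at most 4/5 otherwise; a power
-- of it is a low-degree real polynomial in MOD_2 gates.
--
-- Finally Q is chosen proportional to log(n/ε); when ε ≥ 1/4 the constant 1/4
-- already approximates f / 2, which covers the case of log(n/ε) close to 0.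

module Submission where

open import Data.Bool.Base using (Bool; true; false; not; _∧_; _xor_; if_then_else_; _∨_)
open import Data.Bool.ListAction using (all; any; and; or)
import Data.Bool.Properties as Bool
open import Data.Empty using (⊥-elim)
open import Data.Fin.Base using (Fin; suc; zero; splitAt; join)
import Data.Fin.Properties as Fin
open import Data.Integer.Base as ℤ using (ℤ)
import Data.Integer.DivMod as ℤ
import Data.Integer.Properties as ℤ
import Data.Integer.Solver as ℤ-Solver
open import Data.List.Base using ([]; _∷_; List; foldr; map; filter; allFin; length; _++_)
open import Data.List.Membership.Propositional using () renaming (_∈_ to _∈ˡ_)
open import Data.List.Membership.Propositional.Properties using (∈-filter⁺; ∈-filter⁻; ∈-allFin; ∈-map⁺; ∈-map⁻; ∈-++⁺ˡ; ∈-++⁺ʳ)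
import Data.List.Properties as List
open import Data.List.Relation.Unary.All as All using ([]; _∷_; All)
import Data.List.Relation.Unary.All.Properties as All
open import Data.List.Relation.Unary.AllPairs using ([]; _∷_)
open import Data.List.Relation.Unary.Any using (here; there)
open import Data.List.Relation.Unary.Unique.Propositional using (Unique)
import Data.List.Relation.Unary.Unique.Propositional.Properties as Unique
open import Data.Nat.Base as ℕ using (ℕ; zero; suc; NonZero)
import Data.Nat.Coprimality as Coprimality
open import Data.Nat.Divisibility using (_∣_; _∣?_; divides; ∣-trans; m∣m*n; n∣m*n)
open import Data.Nat.Induction using (<-rec)
open import Data.Nat.ListAction using (sum)
open import Data.Nat.Logarithm using (⌊log₂_⌋; ⌊log₂⌋-mono-≤; ⌊log₂[2^n]⌋≡n)
open import Data.Nat.Primality using (Prime; euclidsLemma; prime⇒nonZero; prime⇒nonTrivial)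
open import Data.Nat.Primality.Factorisation using (factorise)
import Data.Nat.Properties as ℕ
open import Data.Product.Base using (∃-syntax; _×_; _,_; Σ-syntax; proj₂; proj₁)
open import Data.Rational.Base as ℚ using (ℚ; ½)
import Data.Rational.Properties as ℚ
import Data.Rational.Solver as ℚ-Solver
open import Data.Sum.Base using (inj₁; inj₂; _⊎_; [_,_]′; map₂)
open import Data.Unit.Base using (tt)
open import Data.Vec.Base as Vec using (Vec; []; _∷_; lookup)
import Data.Vec.Properties as Vec
import Defs as ℝ
open import Defs using (module ℕ-Lemmas; module ℚ-Lemmas; Cube; subsets; Gate; AND; OR; MOD; NOT; evalGate; gateDepth; Gates; _▷_; evalGates; gateDepths; Circuit; size; gates; output; eval; depth; module ℝ-Lemmas; ℝ; seq; ℝ⁺; fromℕ⁺; log₂; 0ℝ; 1ℝ; BooleanFunction; IsAbsMod1; IsTorusPolynomial; Approximates; HasApproximation; polynomial; monomial; fromℚ; cauchy; evalPoly)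
open import Function.Base using (_∘_; id)
open import Relation.Binary.PropositionalEquality
open import Relation.Nullary
open import Relation.Nullary.Decidable using (toWitness; ⌊_⌋)

-- Coefficients are never bounded: rounding `c` to `a / M` makes them arbitrarily large, so the
-- induction has to cover every multiple of a product, and only the numbers of factors and of terms
-- are controlled. The two closure properties cope with this differently. A residue is replaced by a
-- polynomial that is exact modulo `M`, so the surplus is an integer and vanishes. A real average is
-- exact modulo nothing; there the coefficient is reduced to its fractional part, which the
-- integrality of the Boolean product allows, and the error of the average is not magnified. Random
-- parities would be right only with high probability at each point, whereas the norm is a maximum
-- over the cube. Averaging over all coordinates of a code gives an estimate valid at every point.
-- Every constructed coefficient is rational; only ε is real. A comparison of ε with 1/4 is not
-- decidable, so the case split is on a natural number t with 2^-(2+t) ≤ ε and 2^t ε ≤ n, found by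
-- comparing rationals. For t = 0 a constant suffices; for t ≥ 1 the logarithm is at least t ≥ 1 and
-- absorbs additive constants.

-- Binomial coefficients modulo a prime, and coprime prime power factors

module PrimePowerDivisibility where
  open import Data.Nat.Base
  open import Data.Nat.Properties
  open import Data.Nat.Divisibility
  open import Data.Nat.Coprimality using (Coprime; coprime-divisor)
  open import Data.Nat.Combinatorics using (_C_; nCn≡1; nCk≡nC[n∸k]; k>n⇒nCk≡0; nCk+nC[k+1]≡[n+1]C[k+1])
  open import Data.Nat.Solver using (module +-*-Solver)
  open import Data.Nat.ListAction using (product)
  open +-*-Solver using (solve; _:=_; _:+_; _:*_; con)

  nC0≡1 : ∀ n → n C 0 ≡ 1
  nC0≡1 n = trans (nCk≡nC[n∸k] {n = n} z≤n) (nCn≡1 n)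

  0C[1+k]≡0 : ∀ k → 0 C suc k ≡ 0
  0C[1+k]≡0 k = k>n⇒nCk≡0 {0} {suc k} z<s

  pascal : ∀ n k → suc n C suc k ≡ n C k + n C suc k
  pascal n k = sym (nCk+nC[k+1]≡[n+1]C[k+1] n k)

  absorption : ∀ n k → suc k * (suc n C suc k) ≡ suc n * (n C k)
  absorption zero zero = refl
  absorption zero (suc k) = begin
    (2 + k) * (1 C (2 + k))                        ≡⟨ cong ((2 + k) *_) (pascal 0 (suc k)) ⟩
    (2 + k) * (0 C suc k + 0 C (2 + k))            ≡⟨ cong₂ (λ a b → (2 + k) * (a + b)) (0C[1+k]≡0 k) (0C[1+k]≡0 (suc k)) ⟩
    (2 + k) * 0                                    ≡⟨ *-zeroʳ (2 + k) ⟩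
    0                                              ≡⟨ cong (1 *_) (0C[1+k]≡0 k) ⟨
    1 * (0 C suc k)                                ∎
    where open ≡-Reasoning
  absorption (suc n) zero = begin
    1 * ((2 + n) C 1)                              ≡⟨ cong (1 *_) (pascal (suc n) 0) ⟩
    1 * (suc n C 0 + suc n C 1)                    ≡⟨ *-distribˡ-+ 1 (suc n C 0) (suc n C 1) ⟩
    1 * (suc n C 0) + 1 * (suc n C 1)              ≡⟨ cong₂ (λ a b → 1 * a + b) (nC0≡1 (suc n)) (trans (absorption n 0) (cong (suc n *_) (nC0≡1 n))) ⟩
    1 + suc n * 1                                  ≡⟨⟩
    (2 + n) * 1                                    ≡⟨ cong ((2 + n) *_) (nC0≡1 (suc n)) ⟨
    (2 + n) * (suc n C 0)                          ∎
    where open ≡-Reasoning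
  absorption (suc n) (suc k) = begin
    (2 + k) * ((2 + n) C (2 + k))
      ≡⟨ cong ((2 + k) *_) (pascal (suc n) (suc k)) ⟩
    (2 + k) * (suc n C suc k + suc n C (2 + k))
      ≡⟨ solve 3 (λ k a b → (con 2 :+ k) :* (a :+ b) := a :+ (con 1 :+ k) :* a :+ (con 2 :+ k) :* b) refl k (suc n C suc k) (suc n C (2 + k)) ⟩
    suc n C suc k + suc k * (suc n C suc k) + (2 + k) * (suc n C (2 + k))
      ≡⟨ cong₂ (λ a b → suc n C suc k + a + b) (absorption n k) (absorption n (suc k)) ⟩
    suc n C suc k + suc n * (n C k) + suc n * (n C suc k)
      ≡⟨ solve 4 (λ c m a b → c :+ m :* a :+ m :* b := c :+ m :* (a :+ b)) refl (suc n C suc k) (suc n) (n C k) (n C suc k) ⟩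
    suc n C suc k + suc n * (n C k + n C suc k)
      ≡⟨ cong (λ c → suc n C suc k + suc n * c) (pascal n k) ⟨
    (2 + n) * (suc n C suc k)
      ∎
    where open ≡-Reasoning

  -- Euclid's lemma places one factor `p` in `i`; it cancels from both sides, and the exponent drops
  -- by one.
  p^e∣i*c⇒p^e∣i : ∀ {p} → Prime p → ∀ e i c → ¬ p ∣ c → p ^ e ∣ i * c → p ^ e ∣ i
  p^e∣i*c⇒p^e∣i pp zero i c _ _ = 1∣ i
  p^e∣i*c⇒p^e∣i {p} pp (suc e) i c p∤c d with euclidsLemma i c pp (∣-trans (m∣m*n (p ^ e)) d)
  ... | inj₂ p∣c = ⊥-elim (p∤c p∣c)
  ... | inj₁ (divides-refl j) = subst (p * p ^ e ∣_) (*-comm p j) (*-monoʳ-∣ p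
    (p^e∣i*c⇒p^e∣i pp e j c p∤c (*-cancelˡ-∣ p {{prime⇒nonZero pp}}
      (subst (p * p ^ e ∣_) (solve 3 (λ j p c → j :* p :* c := p :* (j :* c)) refl j p c) d))))

  module PrimePower {p : ℕ} (pp : Prime p) (e r : ℕ) (q≡1+r : p ^ e ≡ suc r) where

    -- By absorption `q = p ^ e` divides `(i + 1) * C(q, i + 1)`. If the binomial coefficient were
    -- prime to `p`, then `q` would divide the smaller positive number `i + 1`.
    p∣qCi : ∀ i → suc i < suc r → p ∣ suc r C suc i
    p∣qCi i i<q with p ∣? (suc r C suc i)
    ... | yes d = d
    ... | no p∤ = ⊥-elim (<⇒≱ i<q (∣⇒≤ (subst (_∣ suc i) q≡1+r (p^e∣i*c⇒p^e∣i pp e (suc i) (suc r C suc i) p∤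
      (subst₂ _∣_ (sym q≡1+r) (sym (absorption r i)) (m∣m*n (r C i)))))))

    -- This is `(1 + X)^q ≡ 1 + X^q` modulo `p`, read off at exponents below `q`. The vanishing
    -- inner entries of row `q` start an induction along Pascal's rule.
    C-periodic : ∀ a k → k < suc r → ∃[ j ] (a + suc r) C k ≡ a C k + p * j
    C-periodic a zero _ = 0 , trans (nC0≡1 (a + suc r)) (sym (trans (cong₂ _+_ (nC0≡1 a) (*-zeroʳ p)) refl))
    C-periodic zero (suc k) k<q with p∣qCi k k<q
    ... | divides j eq = j , trans eq (trans (*-comm j p) (sym (cong (_+ p * j) (0C[1+k]≡0 k))))
    C-periodic (suc a) (suc k) k<q with C-periodic a k (<-trans (n<1+n k) k<q) | C-periodic a (suc k) k<q
    ... | i , eqi | j , eqj = i + j , (begin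
      suc (a + suc r) C suc k                          ≡⟨ pascal (a + suc r) k ⟩
      (a + suc r) C k + (a + suc r) C suc k            ≡⟨ cong₂ _+_ eqi eqj ⟩
      a C k + p * i + (a C suc k + p * j)              ≡⟨ solve 5 (λ x y p i j → x :+ p :* i :+ (y :+ p :* j) := x :+ y :+ p :* (i :+ j)) refl (a C k) (a C suc k) p i j ⟩
      a C k + a C suc k + p * (i + j)                  ≡⟨ cong (_+ p * (i + j)) (pascal a k) ⟨
      suc a C suc k + p * (i + j)                      ∎)
      where open ≡-Reasoning

    -- Periodicity removes the multiples of `q` and leaves `C(r, r) = 1`; the lower index
    -- `r = q - 1` is the largest for which periodicity is available.
    q∣w⇒C≡1 : ∀ w → suc r ∣ w → ∃[ j ] (w + r) C r ≡ 1 + p * j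
    q∣w⇒C≡1 _ (divides-refl u) = go u
      where
      go : ∀ u → ∃[ j ] (u * suc r + r) C r ≡ 1 + p * j
      go zero = 0 , trans (nCn≡1 r) (cong (1 +_) (sym (*-zeroʳ p)))
      go (suc u) with C-periodic (u * suc r + r) r ≤-refl | go u
      ... | i , eqi | j , eqj = i + j , (begin
        (suc u * suc r + r) C r                ≡⟨ cong (_C r) (solve 2 (λ q r → con 1 :+ r :+ q :+ r := q :+ r :+ (con 1 :+ r)) refl (u * suc r) r) ⟩
        (u * suc r + r + suc r) C r            ≡⟨ eqi ⟩
        (u * suc r + r) C r + p * i            ≡⟨ cong (_+ p * i) eqj ⟩
        1 + p * j + p * i                      ≡⟨ solve 3 (λ p i j → con 1 :+ p :* j :+ p :* i := con 1 :+ p :* (i :+ j)) refl p i j ⟩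
        1 + p * (i + j)                        ∎)
        where open ≡-Reasoning

    -- Absorption gives `q ∣ (w + q) * C(w + r, r)`; a binomial coefficient prime to `p` would force
    -- `q ∣ w + q`.
    q∤w⇒p∣C : ∀ w → ¬ suc r ∣ w → p ∣ (w + r) C r
    q∤w⇒p∣C w q∤w with p ∣? ((w + r) C r)
    ... | yes d = d
    ... | no p∤ = ⊥-elim (q∤w (∣m+n∣m⇒∣n (subst (suc r ∣_) (trans (sym (+-suc w r)) (+-comm w (suc r)))
      (subst (_∣ suc (w + r)) q≡1+r (p^e∣i*c⇒p^e∣i pp e (suc (w + r)) ((w + r) C r) p∤
        (subst₂ _∣_ (sym q≡1+r) (absorption (w + r) r) (m∣m*n (suc (w + r) C suc r)))))) ∣-refl))

  -- Coprimality is stored at each step so that divisibility by the product splits into a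
  -- conjunction over the prime powers.
  data PrimePowers : ℕ → Set where
    one  : PrimePowers 1
    cons : ∀ {p} → Prime p → ∀ e {m} → Coprime (p ^ e) m → PrimePowers m → PrimePowers (p ^ e * m)

  -- For a common divisor `d` write `p ^ e = c′ * d`. As `d` divides `m`, it is prime to `p`, so
  -- `p ^ e` divides `c′`; cancelling `c′` leaves `d ∣ 1`.
  coprime-^ : ∀ {p m} → Prime p → ¬ p ∣ m → ∀ e → Coprime (p ^ e) m
  coprime-^ {p} {m} pp p∤m e {d} (d∣p^e , divides c m≡c*d) = ∣1⇒≡1 (p^e∣d⇒ (p^e∣i*c⇒p^e∣i pp e c′ d p∤d
      (subst (p ^ e ∣_) p^e≡c′*d ∣-refl)))
    where
    c′ = quotient d∣p^e
    p^e≡c′*d : p ^ e ≡ c′ * d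
    p^e≡c′*d = _∣_.equality d∣p^e
    p∤d : ¬ p ∣ d
    p∤d p∣d = p∤m (subst (p ∣_) (sym m≡c*d) (∣-trans p∣d (n∣m*n c)))
    p^e∣d⇒ : p ^ e ∣ c′ → d ∣ 1
    p^e∣d⇒ h = *-cancelˡ-∣ c′ {{m*n≢0⇒m≢0 c′ {{subst NonZero p^e≡c′*d (m^n≢0 p e {{prime⇒nonZero pp}})}}}}
                 (subst₂ _∣_ p^e≡c′*d (sym (*-identityʳ c′)) h)

  split-off : ∀ {p} → Prime p → ∀ m → .{{NonZero m}} → ∃[ e ] ∃[ m′ ] (m ≡ p ^ e * m′ × ¬ p ∣ m′)
  split-off {p} pp = <-rec (λ m → .{{NonZero m}} → ∃[ e ] ∃[ m′ ] (m ≡ p ^ e * m′ × ¬ p ∣ m′)) go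
    where
    go : ∀ m → (∀ {k} → k < m → .{{NonZero k}} → ∃[ e ] ∃[ m′ ] (k ≡ p ^ e * m′ × ¬ p ∣ m′)) →
         .{{NonZero m}} → ∃[ e ] ∃[ m′ ] (m ≡ p ^ e * m′ × ¬ p ∣ m′)
    go m rec with p ∣? m
    ... | no p∤m = 0 , m , sym (*-identityˡ m) , p∤m
    ... | yes p∣m@(divides k m≡k*p) with rec (quotient-< p∣m {{prime⇒nonTrivial pp}}) {{k≢0}}
      where k≢0 = m*n≢0⇒m≢0 k {{subst NonZero m≡k*p it}}
              where it = >-nonZero (>-nonZero⁻¹ m)
    ... | e , m′ , k≡ , p∤m′ = suc e , m′ , trans m≡k*p (trans (cong (_* p) k≡)
          (solve 3 (λ a b p → a :* b :* p := p :* a :* b) refl (p ^ e) m′ p)) , p∤m′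

  primePowers : ∀ m → .{{NonZero m}} → PrimePowers m
  primePowers = <-rec (λ m → .{{NonZero m}} → PrimePowers m) go
    where
    go : ∀ m → (∀ {k} → k < m → .{{NonZero k}} → PrimePowers k) → .{{NonZero m}} → PrimePowers m
    go m rec with factorise m
    ... | record { factors = []    ; isFactorisation = m≡ } = subst PrimePowers (sym m≡) one
    ... | record { factors = p ∷ ps ; isFactorisation = m≡ ; factorsPrime = pp ∷ _ } with split-off pp m
    ...   | zero , m′ , m≡m′ , p∤m′ = ⊥-elim (p∤m′ (subst (p ∣_) (trans (sym m≡) (trans m≡m′ (*-identityˡ m′))) (m∣m*n (product ps))))
    ...   | suc e , m′ , m≡p*m′ , p∤m′ = subst PrimePowers (sym m≡p*m′)
              (cons pp (suc e) (coprime-^ pp p∤m′ (suc e)) (rec m′<m {{m′≢0}}))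
      where
      m′≢0 : NonZero m′
      m′≢0 = m*n≢0⇒n≢0 (p ^ suc e) {{subst NonZero m≡p*m′ (>-nonZero (>-nonZero⁻¹ m))}}
      m′<m : m′ < m
      m′<m = subst (m′ <_) (sym m≡p*m′) (subst (_< p ^ suc e * m′) (*-identityˡ m′)
        (*-monoˡ-< m′ {{m′≢0}} (≤-trans (nonTrivial⇒n>1 p {{prime⇒nonTrivial pp}})
          (subst (_≤ p ^ suc e) (*-identityʳ p) (*-monoʳ-≤ p (m^n>0 p {{prime⇒nonZero pp}} e))))))

  coprime-∣* : ∀ {a b w} → Coprime a b → a ∣ w → b ∣ w → a * b ∣ w
  coprime-∣* {a} {b} cop (divides-refl k) b∣w =
    subst (a * b ∣_) (*-comm a k) (*-monoʳ-∣ a (coprime-divisor (Coprimality.sym cop) (subst (b ∣_) (*-comm k a) b∣w)))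

open PrimePowerDivisibility

-- A binary linear code of constant relative distance, found greedily

module LinearCode where
  open import Data.Nat.Base
  open import Data.Nat.Properties
  open import Data.Nat.Solver using (module +-*-Solver)
  open +-*-Solver using (solve; _:=_; _:+_; _:*_; con)
  open ≤-Reasoning

  private variable t : ℕ

  _·_ : Vec Bool t → Vec Bool t → Bool
  []       · []       = false
  (a ∷ as) · (y ∷ ys) = (a ∧ y) xor (as · ys)

  nonzero : Vec Bool t → Bool
  nonzero []           = false
  nonzero (true ∷ _)   = true
  nonzero (false ∷ ys) = nonzero ys

  ∑ : ∀ t → (Vec Bool t → ℕ) → ℕ
  ∑ zero    ω = ω []
  ∑ (suc t) ω = ∑ t (ω ∘ (false ∷_)) + ∑ t (ω ∘ (true ∷_))

  ∑-cong : ∀ t {ω υ : Vec Bool t → ℕ} → (∀ y → ω y ≡ υ y) → ∑ t ω ≡ ∑ t υ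
  ∑-cong zero    h = h []
  ∑-cong (suc t) h = cong₂ _+_ (∑-cong t (h ∘ (false ∷_))) (∑-cong t (h ∘ (true ∷_)))

  ∑-+ : ∀ t (ω υ : Vec Bool t → ℕ) → ∑ t (λ y → ω y + υ y) ≡ ∑ t ω + ∑ t υ
  ∑-+ zero    ω υ = refl
  ∑-+ (suc t) ω υ = trans
    (cong₂ _+_ (∑-+ t (ω ∘ (false ∷_)) (υ ∘ (false ∷_))) (∑-+ t (ω ∘ (true ∷_)) (υ ∘ (true ∷_))))
    (solve 4 (λ a b c d → a :+ b :+ (c :+ d) := a :+ c :+ (b :+ d)) refl
      (∑ t (ω ∘ (false ∷_))) (∑ t (υ ∘ (false ∷_))) (∑ t (ω ∘ (true ∷_))) (∑ t (υ ∘ (true ∷_))))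

  ∑-mono : ∀ t {ω υ : Vec Bool t → ℕ} → (∀ y → ω y ≤ υ y) → ∑ t ω ≤ ∑ t υ
  ∑-mono zero    h = h []
  ∑-mono (suc t) h = +-mono-≤ (∑-mono t (h ∘ (false ∷_))) (∑-mono t (h ∘ (true ∷_)))

  ω≤∑ω : ∀ t (ω : Vec Bool t → ℕ) y → ω y ≤ ∑ t ω
  ω≤∑ω zero    ω []          = ≤-refl
  ω≤∑ω (suc t) ω (false ∷ y) = ≤-trans (ω≤∑ω t _ y) (m≤m+n _ _)
  ω≤∑ω (suc t) ω (true ∷ y)  = ≤-trans (ω≤∑ω t _ y) (m≤n+m _ _)

  ∑1≡2^ : ∀ t → ∑ t (λ _ → 1) ≡ 2 ^ t
  ∑1≡2^ zero    = refl
  ∑1≡2^ (suc t) = trans (cong₂ _+_ (∑1≡2^ t) (∑1≡2^ t)) (cong (2 ^ t +_) (sym (+-identityʳ (2 ^ t))))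

  infixl 9 _⟨_⟩
  _⟨_⟩ : ℕ → Bool → ℕ
  n ⟨ b ⟩ = if b then n else 0

  ⟨⟩-split : ∀ n b → n ⟨ b ⟩ + n ⟨ not b ⟩ ≡ n
  ⟨⟩-split n true  = +-identityʳ n
  ⟨⟩-split n false = refl

  missed : (Vec Bool t → ℕ) → Vec Bool t → Vec Bool t → ℕ
  missed ω a y = (ω y) ⟨ nonzero y ∧ not (a · y) ⟩

  -- The tail of a is chosen for the vectors with head 0; for those with head 1
  -- the two values of the head of a have complementary sets of missed vectors.
  choose : ∀ t (ω : Vec Bool t → ℕ) → ∃[ a ] 2 * ∑ t (missed ω a) ≤ ∑ t ω
  choose zero    ω = [] , z≤n
  choose (suc t) ω with choose t (ω ∘ (false ∷_))
  ... | a , h = pick (≤-total A B)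
    where
    υ = ω ∘ (true ∷_)
    A = ∑ t (λ y → (υ y) ⟨ not (a · y) ⟩)
    B = ∑ t (λ y → (υ y) ⟨ a · y ⟩)
    A+B : A + B ≡ ∑ t υ
    A+B = trans (+-comm A B) (trans (sym (∑-+ t _ _)) (∑-cong t (λ y → ⟨⟩-split (υ y) (a · y))))
    half : ∀ {X Y} → X ≤ Y → X + Y ≡ ∑ t υ → 2 * X ≤ ∑ t υ
    half {X} {Y} X≤Y eq = begin
      2 * X     ≡⟨ cong (X +_) (+-identityʳ X) ⟩
      X + X     ≤⟨ +-monoʳ-≤ X X≤Y ⟩
      X + Y     ≡⟨ eq ⟩
      ∑ t υ     ∎
    finish : ∀ b X → ∑ t (missed ω (b ∷ a) ∘ (true ∷_)) ≡ X → 2 * X ≤ ∑ t υ →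
             ∃[ a ] 2 * ∑ (suc t) (missed ω a) ≤ ∑ (suc t) ω
    finish b X eq X≤ = b ∷ a , (begin
      2 * (∑ t (missed ω (b ∷ a) ∘ (false ∷_)) + ∑ t (missed ω (b ∷ a) ∘ (true ∷_)))
        ≡⟨ cong₂ (λ u v → 2 * (u + v)) (∑-cong t (λ y → cong (λ c → (ω (false ∷ y)) ⟨ nonzero y ∧ not c ⟩) (∧false b (a · y)))) eq ⟩
      2 * (∑ t (missed (ω ∘ (false ∷_)) a) + X)
        ≡⟨ *-distribˡ-+ 2 (∑ t (missed (ω ∘ (false ∷_)) a)) X ⟩
      2 * ∑ t (missed (ω ∘ (false ∷_)) a) + 2 * X
        ≤⟨ +-mono-≤ h X≤ ⟩
      ∑ (suc t) ω ∎)
      where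
      ∧false : ∀ b c → (b ∧ false) xor c ≡ c
      ∧false true  c = refl
      ∧false false c = refl
    pick : A ≤ B ⊎ B ≤ A → ∃[ a ] 2 * ∑ (suc t) (missed ω a) ≤ ∑ (suc t) ω
    pick (inj₁ A≤B) = finish false A refl (half A≤B A+B)
    pick (inj₂ B≤A) = finish true B (∑-cong t (λ y → cong ((υ y) ⟨_⟩) (not-not (a · y))))
                        (half B≤A (trans (+-comm B A) A+B))
      where
      not-not : ∀ b → not (not b) ≡ b
      not-not true  = refl
      not-not false = refl

  misses : ∀ {r} → Vec (Vec Bool t) r → Vec Bool t → ℕ
  misses []       y = 0
  misses (a ∷ as) y = 1 ⟨ not (a · y) ⟩ + misses as y

  -- An exponential moment of the number of missed functionals. A bound on its sum over all vectors
  -- bounds every single vector, so the greedy choice derandomises a union bound.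
  potential : ∀ {r} → Vec (Vec Bool t) r → Vec Bool t → ℕ
  potential as y = (2 ^ misses as y) ⟨ nonzero y ⟩

  -- A nonzero vector missed by the new functional doubles its weight, the others keep theirs. As
  -- `choose` misses at most half of the total, each step multiplies the sum by at most 3/2.
  greedy : ∀ t r → Σ[ as ∈ Vec (Vec Bool t) r ] 2 ^ r * ∑ t (potential as) ≤ 3 ^ r * 2 ^ t
  greedy t zero = [] , +-monoˡ-≤ 0 (≤-trans (∑-mono t (λ y → ≤1 (nonzero y))) (≤-reflexive (∑1≡2^ t)))
    where
    ≤1 : ∀ b → 1 ⟨ b ⟩ ≤ 1
    ≤1 true  = ≤-refl
    ≤1 false = z≤n
  greedy t (suc r) with greedy t r
  ... | as , h with choose t (potential as)
  ... | a , g = a ∷ as , (begin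
    2 * 2 ^ r * ∑ t (potential (a ∷ as))
      ≡⟨ cong (2 * 2 ^ r *_) (trans (∑-cong t step) (∑-+ t (potential as) (missed (potential as) a))) ⟩
    2 * 2 ^ r * (Φ + ∑ t (missed (potential as) a))
      ≡⟨ solve 3 (λ x y z → con 2 :* x :* (y :+ z) := x :* (con 2 :* y :+ con 2 :* z)) refl (2 ^ r) Φ (∑ t (missed (potential as) a)) ⟩
    2 ^ r * (2 * Φ + 2 * ∑ t (missed (potential as) a))
      ≤⟨ *-monoʳ-≤ (2 ^ r) (+-monoʳ-≤ (2 * Φ) g) ⟩
    2 ^ r * (2 * Φ + Φ)
      ≡⟨ solve 2 (λ x y → x :* (con 2 :* y :+ y) := con 3 :* (x :* y)) refl (2 ^ r) Φ ⟩
    3 * (2 ^ r * Φ)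
      ≤⟨ *-monoʳ-≤ 3 h ⟩
    3 * (3 ^ r * 2 ^ t)
      ≡⟨ *-assoc 3 (3 ^ r) (2 ^ t) ⟨
    3 * 3 ^ r * 2 ^ t ∎)
    where
    Φ = ∑ t (potential as)
    step : ∀ y → potential (a ∷ as) y ≡ potential as y + missed (potential as) a y
    step y with nonzero y | a · y
    ... | false | _     = refl
    ... | true  | true  = sym (+-identityʳ _)
    ... | true  | false = cong (2 ^ misses as y +_) (+-identityʳ _)

  weight : ∀ t (as : Vec (Vec Bool t) (5 * suc t)) → 2 ^ (5 * suc t) * ∑ t (potential as) ≤ 3 ^ (5 * suc t) * 2 ^ t →
    ∀ y → nonzero y ≡ true → misses as y ≤ 4 * suc t
  weight t as h y y≢0 = begin
    misses as y   ≤⟨ +-cancelˡ-≤ (5 * u) _ _ (ℕ-Lemmas.^-cancelʳ-≤ exponents) ⟩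
    3 * u + t     ≤⟨ +-monoʳ-≤ (3 * u) (n≤1+n t) ⟩
    3 * u + u     ≡⟨ +-comm (3 * u) u ⟩
    4 * u         ∎
    where
    u = suc t
    exponents : 2 ^ (5 * u + misses as y) ≤ 2 ^ (5 * u + (3 * u + t))
    exponents = begin
      2 ^ (5 * u + misses as y)         ≡⟨ ^-distribˡ-+-* 2 (5 * u) (misses as y) ⟩
      2 ^ (5 * u) * 2 ^ misses as y     ≤⟨ *-monoʳ-≤ (2 ^ (5 * u)) (≤-trans (≤-reflexive (cong ((2 ^ misses as y) ⟨_⟩) (sym y≢0))) (ω≤∑ω t (potential as) y)) ⟩
      2 ^ (5 * u) * ∑ t (potential as)  ≤⟨ h ⟩
      3 ^ (5 * u) * 2 ^ t               ≡⟨ cong (_* 2 ^ t) (sym (^-*-assoc 3 5 u)) ⟩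
      -- `3 ^ 5 = 243 ≤ 256 = 2 ^ 8` is the source of the parameters 5 and 4: of the `8 * u` in the
      -- exponent, `5 * u` cancels, and `3 * u + t ≤ 4 * u` misses remain.
      (3 ^ 5) ^ u * 2 ^ t               ≤⟨ *-monoˡ-≤ (2 ^ t) (^-monoˡ-≤ u (m≤m+n 243 13)) ⟩
      (2 ^ 8) ^ u * 2 ^ t               ≡⟨ cong (_* 2 ^ t) (^-*-assoc 2 8 u) ⟩
      2 ^ (8 * u) * 2 ^ t               ≡⟨ ^-distribˡ-+-* 2 (8 * u) t ⟨
      2 ^ (8 * u + t)                   ≡⟨ cong (2 ^_) (solve 2 (λ u t → con 8 :* u :+ t := con 5 :* u :+ (con 3 :* u :+ t)) refl u t) ⟩
      2 ^ (5 * u + (3 * u + t))         ∎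

  -- A linear code over 𝔽₂ of length 5 (t + 1), given by its coordinate
  -- functionals, in which every nonzero codeword has relative weight at least 1/5.
  code : ∀ t → Σ[ as ∈ Vec (Vec Bool t) (5 * suc t) ] (∀ y → nonzero y ≡ true → misses as y ≤ 4 * suc t)
  code t = let as , h = greedy t (5 * suc t) in as , weight t as h

open LinearCode using (_·_; nonzero; misses; code; _⟨_⟩)

-- Rational polynomials on the cube and distance modulo 1

module CubePolynomials where
  open import Data.Rational.Base
  open import Data.Rational.Properties
  open import Data.Fin.Subset as Subset using (Subset; inside; outside; _∪_; ⁅_⁆; _∈_)
  open import Data.Fin.Subset.Properties as Subset using (_∈?_; x∈p∪q⁻; x∈p∪q⁺; x∈⁅y⁆⇒x≡y; x∈⁅x⁆; ∉⊥)
  open ℚ-Solver.+-*-Solver using (solve; _:=_; _:+_; _:*_; :-_; _:-_; con)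
  open ℚ-Lemmas
  open ≤-Reasoning

  ⟦_⟧ : Bool → ℚ
  ⟦ b ⟧ = if b then 1ℚ else 0ℚ

  ⟦∧⟧ : ∀ a b → ⟦ a ∧ b ⟧ ≡ ⟦ a ⟧ * ⟦ b ⟧
  ⟦∧⟧ true  b = sym (*-identityˡ ⟦ b ⟧)
  ⟦∧⟧ false b = sym (*-zeroˡ ⟦ b ⟧)

  0≤1 : 0ℚ ≤ 1ℚ
  0≤1 = <⇒≤ (positive⁻¹ 1ℚ)

  0≤⟦⟧ : ∀ b → 0ℚ ≤ ⟦ b ⟧
  0≤⟦⟧ true  = 0≤1
  0≤⟦⟧ false = ≤-refl

  ⟦⟧≤1 : ∀ b → ⟦ b ⟧ ≤ 1ℚ
  ⟦⟧≤1 true  = ≤-refl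
  ⟦⟧≤1 false = 0≤1

  ∣⟦⟧∣≤1 : ∀ b → ∣ ⟦ b ⟧ ∣ ≤ 1ℚ
  ∣⟦⟧∣≤1 b = ≤-trans (≤-reflexive (0≤p⇒∣p∣≡p (0≤⟦⟧ b))) (⟦⟧≤1 b)

  fromℤ-neg : ∀ i → fromℤ (ℤ.- i) ≡ - fromℤ i
  fromℤ-neg i = begin-equality
    fromℤ (ℤ.- i)                              ≡⟨ solve 2 (λ x y → x := x :+ y :- y) refl (fromℤ (ℤ.- i)) (fromℤ i) ⟩
    fromℤ (ℤ.- i) + fromℤ i - fromℤ i          ≡⟨ cong (_- fromℤ i) (fromℤ-+ (ℤ.- i) i) ⟨
    fromℤ (ℤ.- i ℤ.+ i) - fromℤ i              ≡⟨ cong (λ j → fromℤ j - fromℤ i) (ℤ.+-inverseˡ i) ⟩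
    0ℚ - fromℤ i                               ≡⟨ +-identityˡ (- fromℤ i) ⟩
    - fromℤ i                                  ∎

  fromℤ-- : ∀ i j → fromℤ (i ℤ.- j) ≡ fromℤ i - fromℤ j
  fromℤ-- i j = trans (fromℤ-+ i (ℤ.- j)) (cong (fromℤ i +_) (fromℤ-neg j))

  infix 9 2⁻_
  2⁻_ : ℕ → ℚ
  2⁻ zero  = 1ℚ
  2⁻ suc k = ½ * 2⁻ k

  0<2⁻ : ∀ k → 0ℚ < 2⁻ k
  0<2⁻ zero    = positive⁻¹ 1ℚ
  0<2⁻ (suc k) = *-pos (positive⁻¹ ½) (0<2⁻ k)

  2⁻-+ : ∀ j k → 2⁻ (j ℕ.+ k) ≡ 2⁻ j * 2⁻ k
  2⁻-+ zero    k = sym (*-identityˡ (2⁻ k))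
  2⁻-+ (suc j) k = trans (cong (½ *_) (2⁻-+ j k)) (sym (*-assoc ½ (2⁻ j) (2⁻ k)))

  2⁻[1+k]+2⁻[1+k] : ∀ k → 2⁻ suc k + 2⁻ suc k ≡ 2⁻ k
  2⁻[1+k]+2⁻[1+k] k = trans (sym (*-distribʳ-+ (2⁻ k) ½ ½)) (*-identityˡ (2⁻ k))

  2⁻≤1 : ∀ k → 2⁻ k ≤ 1ℚ
  2⁻≤1 zero    = ≤-refl
  2⁻≤1 (suc k) = begin
    ½ * 2⁻ k               ≡⟨ +-identityʳ (½ * 2⁻ k) ⟨
    ½ * 2⁻ k + 0ℚ          ≤⟨ +-monoʳ-≤ (½ * 2⁻ k) (<⇒≤ (0<2⁻ (suc k))) ⟩
    ½ * 2⁻ k + ½ * 2⁻ k    ≡⟨ 2⁻[1+k]+2⁻[1+k] k ⟩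
    2⁻ k                   ≤⟨ 2⁻≤1 k ⟩
    1ℚ                     ∎

  2⁻-antimono : ∀ {j k} → j ℕ.≤ k → 2⁻ k ≤ 2⁻ j
  2⁻-antimono {j} {k} j≤k = begin
    2⁻ k                     ≡⟨ cong 2⁻_ (ℕ.m+[n∸m]≡n j≤k) ⟨
    2⁻ (j ℕ.+ (k ℕ.∸ j))     ≡⟨ 2⁻-+ j (k ℕ.∸ j) ⟩
    2⁻ j * 2⁻ (k ℕ.∸ j)      ≤⟨ *-monoˡ (2⁻ j) (<⇒≤ (0<2⁻ j)) (2⁻≤1 (k ℕ.∸ j)) ⟩
    2⁻ j * 1ℚ                ≡⟨ *-identityʳ (2⁻ j) ⟩
    2⁻ j                     ∎

  2^*2⁻≡1 : ∀ k → fromℕ (2 ℕ.^ k) * 2⁻ k ≡ 1ℚ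
  2^*2⁻≡1 zero    = refl
  2^*2⁻≡1 (suc k) = begin-equality
    fromℕ (2 ℕ.* 2 ℕ.^ k) * (½ * 2⁻ k)          ≡⟨ cong (_* (½ * 2⁻ k)) (fromℕ-* 2 (2 ℕ.^ k)) ⟩
    fromℕ 2 * fromℕ (2 ℕ.^ k) * (½ * 2⁻ k)      ≡⟨ solve 4 (λ a b c d → a :* b :* (c :* d) := (a :* c) :* (b :* d)) refl (fromℕ 2) (fromℕ (2 ℕ.^ k)) ½ (2⁻ k) ⟩
    1ℚ * (fromℕ (2 ℕ.^ k) * 2⁻ k)               ≡⟨ trans (*-identityˡ _) (2^*2⁻≡1 k) ⟩
    1ℚ                                          ∎

  0≤fromℕ : ∀ n → 0ℚ ≤ fromℕ n
  0≤fromℕ n = fromℕ-mono {0} {n} ℕ.z≤n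

  fromℕ*2⁻≤ : ∀ {T} i j → T ℕ.≤ 2 ℕ.^ i → fromℕ T * 2⁻ (i ℕ.+ j) ≤ 2⁻ j
  fromℕ*2⁻≤ {T} i j T≤ = begin
    fromℕ T * 2⁻ (i ℕ.+ j)                 ≡⟨ cong (fromℕ T *_) (2⁻-+ i j) ⟩
    fromℕ T * (2⁻ i * 2⁻ j)                ≤⟨ *-monoʳ (2⁻ i * 2⁻ j) (<⇒≤ (*-pos (0<2⁻ i) (0<2⁻ j))) (fromℕ-mono T≤) ⟩
    fromℕ (2 ℕ.^ i) * (2⁻ i * 2⁻ j)        ≡⟨ *-assoc (fromℕ (2 ℕ.^ i)) (2⁻ i) (2⁻ j) ⟨
    fromℕ (2 ℕ.^ i) * 2⁻ i * 2⁻ j          ≡⟨ trans (cong (_* 2⁻ j) (2^*2⁻≡1 i)) (*-identityˡ (2⁻ j)) ⟩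
    2⁻ j                                   ∎

  integer-part : ∀ p → ∃[ a ] (0ℚ ≤ p - fromℤ a × p - fromℤ a ≤ 1ℚ)
  integer-part p = a , lower , upper
    where
    n = ↥ p
    d = ↧ₙ p
    a = n ℤ./ℕ d
    D = fromℕ d
    0<D : Positive D
    0<D = positive (<-≤-trans (positive⁻¹ 1ℚ) (fromℕ-mono {1} (ℕ.>-nonZero⁻¹ d)))
    eq : ∀ x → (p - fromℤ x) * D ≡ fromℤ (n ℤ.- x ℤ.* ℤ.+ d)
    eq x = begin-equality
      (p - fromℤ x) * D               ≡⟨ solve 3 (λ p x d → (p :- x) :* d := p :* d :- x :* d) refl p (fromℤ x) D ⟩
      p * D - fromℤ x * D             ≡⟨ cong₂ _-_ (q*↧q≡↥q p) (sym (fromℤ-* x (ℤ.+ d))) ⟩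
      fromℤ n - fromℤ (x ℤ.* ℤ.+ d)   ≡⟨ fromℤ-- n (x ℤ.* ℤ.+ d) ⟨
      fromℤ (n ℤ.- x ℤ.* ℤ.+ d)       ∎
    r≡ : n ℤ.- a ℤ.* ℤ.+ d ≡ ℤ.+ (n ℤ.%ℕ d)
    r≡ = trans (cong (ℤ._- a ℤ.* ℤ.+ d) (ℤ.a≡a%ℕn+[a/ℕn]*n n d))
               (trans (ℤ.+-assoc (ℤ.+ (n ℤ.%ℕ d)) (a ℤ.* ℤ.+ d) (ℤ.- (a ℤ.* ℤ.+ d)))
                 (trans (cong (ℤ._+_ (ℤ.+ (n ℤ.%ℕ d))) (ℤ.+-inverseʳ (a ℤ.* ℤ.+ d))) (ℤ.+-identityʳ (ℤ.+ (n ℤ.%ℕ d)))))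
    lower : 0ℚ ≤ p - fromℤ a
    lower = *-cancelʳ-≤-pos D {{0<D}} (subst₂ _≤_ (sym (*-zeroˡ D)) (sym (trans (eq a) (cong fromℤ r≡))) (0≤fromℕ (n ℤ.%ℕ d)))
    upper : p - fromℤ a ≤ 1ℚ
    upper = *-cancelʳ-≤-pos D {{0<D}} (subst₂ _≤_ (sym (trans (eq a) (cong fromℤ r≡))) (sym (*-identityˡ D)) (fromℕ-mono (ℕ.<⇒≤ (ℤ.n%ℕd<d n d))))

  -- Distance in ℝ / ℤ with the integer shift kept as data; subtracting it later yields the
  -- representative in `[-1/2, 1/2)` that the statement asks for.
  record Near (δ p q : ℚ) : Set where
    constructor near
    field
      winding  : ℤ
      distance : ∣ p - q - fromℤ winding ∣ ≤ δ

  Near-≡ : ∀ {δ p q} → 0ℚ ≤ δ → ∀ z → p ≡ q + fromℤ z → Near δ p q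
  Near-≡ {δ} {p} {q} 0≤δ z eq = near z (begin
    ∣ p - q - fromℤ z ∣              ≡⟨ cong (λ p → ∣ p - q - fromℤ z ∣) eq ⟩
    ∣ q + fromℤ z - q - fromℤ z ∣    ≡⟨ cong ∣_∣ (solve 2 (λ q z → q :+ z :- q :- z := con 0ℚ) refl q (fromℤ z)) ⟩
    0ℚ                               ≤⟨ 0≤δ ⟩
    δ                                ∎)

  Near-refl : ∀ {δ p} → 0ℚ ≤ δ → Near δ p p
  Near-refl {p = p} 0≤δ = Near-≡ 0≤δ (ℤ.+ 0) (sym (+-identityʳ p))

  Near-weaken : ∀ {δ η p q} → δ ≤ η → Near δ p q → Near η p q
  Near-weaken δ≤η (near z h) = near z (≤-trans h δ≤η)

  Near-close : ∀ {δ p q} → ∣ p - q ∣ ≤ δ → Near δ p q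
  Near-close {δ} {p} {q} h = near (ℤ.+ 0) (≤-trans (≤-reflexive (cong ∣_∣ (+-identityʳ (p - q)))) h)

  Near-trans : ∀ {δ η p q r} → Near δ p q → Near η q r → Near (δ + η) p r
  Near-trans {δ} {η} {p} {q} {r} (near y g) (near z h) = near (y ℤ.+ z) (begin
    ∣ p - r - fromℤ (y ℤ.+ z) ∣                      ≡⟨ cong (λ w → ∣ p - r - w ∣) (fromℤ-+ y z) ⟩
    ∣ p - r - (fromℤ y + fromℤ z) ∣                  ≡⟨ cong ∣_∣ (solve 5 (λ p q r y z → p :- r :- (y :+ z) := (p :- q :- y) :+ (q :- r :- z)) refl p q r (fromℤ y) (fromℤ z)) ⟩
    ∣ (p - q - fromℤ y) + (q - r - fromℤ z) ∣        ≤⟨ ∣p+q∣≤∣p∣+∣q∣ (p - q - fromℤ y) (q - r - fromℤ z) ⟩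
    ∣ p - q - fromℤ y ∣ + ∣ q - r - fromℤ z ∣        ≤⟨ +-mono-≤ g h ⟩
    δ + η                                            ∎)

  Near-+ : ∀ {δ η p q r s} → Near δ p q → Near η r s → Near (δ + η) (p + r) (q + s)
  Near-+ {δ} {η} {p} {q} {r} {s} (near y g) (near z h) = near (y ℤ.+ z) (begin
    ∣ p + r - (q + s) - fromℤ (y ℤ.+ z) ∣            ≡⟨ cong (λ w → ∣ p + r - (q + s) - w ∣) (fromℤ-+ y z) ⟩
    ∣ p + r - (q + s) - (fromℤ y + fromℤ z) ∣        ≡⟨ cong ∣_∣ (solve 6 (λ p q r s y z → p :+ r :- (q :+ s) :- (y :+ z) := (p :- q :- y) :+ (r :- s :- z)) refl p q r s (fromℤ y) (fromℤ z)) ⟩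
    ∣ (p - q - fromℤ y) + (r - s - fromℤ z) ∣        ≤⟨ ∣p+q∣≤∣p∣+∣q∣ (p - q - fromℤ y) (r - s - fromℤ z) ⟩
    ∣ p - q - fromℤ y ∣ + ∣ r - s - fromℤ z ∣        ≤⟨ +-mono-≤ g h ⟩
    δ + η                                            ∎)

  module _ {n : ℕ} where

    -- Rational mirror of `monomial`: the construction takes place over ℚ and is carried over to
    -- real coefficients by `seq-polynomial`.
    monomialℚ : Subset n → Cube n → ℚ
    monomialℚ S x = foldr (λ i y → ⟦ lookup x i ⟧ * y) 1ℚ (filter (_∈? S) (allFin n))

    subsets≤ : ℕ → List (Subset n)
    subsets≤ d = filter (λ S → Subset.∣ S ∣ ℕ.≤? d) (subsets n)

    polynomialℚ : ℕ → (Subset n → ℚ) → Cube n → ℚ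
    polynomialℚ d c x = foldr (λ S y → c S * monomialℚ S x + y) 0ℚ (subsets≤ d)

    IsPoly : ℕ → (Cube n → ℚ) → Set
    IsPoly d P = Σ[ c ∈ (Subset n → ℚ) ] (∀ x → P x ≡ polynomialℚ d c x)

    IsPoly-+ : ∀ {d P Q} → IsPoly d P → IsPoly d Q → IsPoly d (λ x → P x + Q x)
    IsPoly-+ {d} (a , P≡) (b , Q≡) = (λ S → a S + b S) , λ x →
      trans (cong₂ _+_ (P≡ x) (Q≡ x)) (add x (subsets≤ d))
      where
      add : ∀ x L → foldr (λ S y → a S * monomialℚ S x + y) 0ℚ L + foldr (λ S y → b S * monomialℚ S x + y) 0ℚ L ≡
                    foldr (λ S y → (a S + b S) * monomialℚ S x + y) 0ℚ L
      add x []      = +-identityˡ 0ℚ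
      add x (S ∷ L) = trans
        (solve 5 (λ a b m u v → a :* m :+ u :+ (b :* m :+ v) := (a :+ b) :* m :+ (u :+ v)) refl (a S) (b S) (monomialℚ S x) _ _)
        (cong ((a S + b S) * monomialℚ S x +_) (add x L))

    IsPoly-0 : ∀ {d} → IsPoly d (λ _ → 0ℚ)
    IsPoly-0 {d} = (λ _ → 0ℚ) , λ x → sym (go x (subsets≤ d))
      where
      go : ∀ x L → foldr (λ S y → 0ℚ * monomialℚ S x + y) 0ℚ L ≡ 0ℚ
      go x []      = refl
      go x (S ∷ L) = trans (cong₂ _+_ (*-zeroˡ (monomialℚ S x)) (go x L)) (+-identityˡ 0ℚ)

  ∈-subsets : ∀ n (S : Subset n) → S ∈ˡ subsets n
  ∈-subsets zero    []            = here refl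
  ∈-subsets (suc n) (outside ∷ S) = ∈-++⁺ˡ (∈-map⁺ (outside ∷_) (∈-subsets n S))
  ∈-subsets (suc n) (inside ∷ S)  = ∈-++⁺ʳ (map (outside ∷_) (subsets n)) (∈-map⁺ (inside ∷_) (∈-subsets n S))

  subsets-unique : ∀ n → Unique (subsets n)
  subsets-unique zero    = [] ∷ []
  subsets-unique (suc n) = Unique.++⁺
    (Unique.map⁺ Vec.∷-injectiveʳ (subsets-unique n)) (Unique.map⁺ Vec.∷-injectiveʳ (subsets-unique n))
    λ (p , q) → disjoint (∈-map⁻ (outside ∷_) p) (∈-map⁻ (inside ∷_) q)
    where
    disjoint : ∀ {v} → ∃[ S ] (S ∈ˡ subsets n × v ≡ outside ∷ S) → ¬ (∃[ S ] (S ∈ˡ subsets n × v ≡ inside ∷ S))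
    disjoint (_ , _ , refl) (_ , _ , ())

  module _ {n : ℕ} where

    _≟ₛ_ : (S T : Subset n) → Dec (S ≡ T)
    _≟ₛ_ = Vec.≡-dec Bool._≟_

    -- The coefficients are concentrated at `S`. Completeness and uniqueness of the list of subsets
    -- ensure that the fold meets `S` exactly once.
    IsPoly-monomial : ∀ {d} c (S : Subset n) → Subset.∣ S ∣ ℕ.≤ d → IsPoly d (λ x → c * monomialℚ S x)
    IsPoly-monomial {d} c S ∣S∣≤d = δ , λ x →
      sym (present x (subsets≤ d) (Unique.filter⁺ (λ S → Subset.∣ S ∣ ℕ.≤? d) (subsets-unique n))
        (∈-filter⁺ (λ S → Subset.∣ S ∣ ℕ.≤? d) (∈-subsets n S) ∣S∣≤d))
      where
      δ : Subset n → ℚ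
      δ T with S ≟ₛ T
      ... | yes _ = c
      ... | no  _ = 0ℚ
      δ-no : ∀ {T} → S ≢ T → δ T ≡ 0ℚ
      δ-no {T} S≢T with S ≟ₛ T
      ... | yes S≡T = ⊥-elim (S≢T S≡T)
      ... | no  _ = refl
      δ-yes : δ S ≡ c
      δ-yes with S ≟ₛ S
      ... | yes _ = refl
      ... | no  S≢S = ⊥-elim (S≢S refl)
      value : Cube n → List (Subset n) → ℚ
      value x = foldr (λ T y → δ T * monomialℚ T x + y) 0ℚ
      absent : ∀ x L → All (S ≢_) L → value x L ≡ 0ℚ
      absent x []      []         = refl
      absent x (T ∷ L) (S≢T ∷ S∉) = trans (cong₂ (λ u v → u * monomialℚ T x + v) (δ-no S≢T) (absent x L S∉))
        (trans (+-identityʳ _) (*-zeroˡ (monomialℚ T x)))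
      present : ∀ x L → Unique L → S ∈ˡ L → value x L ≡ c * monomialℚ S x
      present x (T ∷ L) (S∉ ∷ _) (here refl) = trans (cong₂ (λ u v → u * monomialℚ S x + v) δ-yes (absent x L S∉)) (+-identityʳ _)
      present x (T ∷ L) (T∉ ∷ u) (there S∈L) = trans (cong₂ (λ u v → u * monomialℚ T x + v) (δ-no λ { refl → All.lookup T∉ S∈L refl }) (present x L u S∈L))
        (trans (cong (_+ c * monomialℚ S x) (*-zeroˡ (monomialℚ T x))) (+-identityˡ _))

    monomialℚ-true : ∀ (S : Subset n) x → (∀ {i} → i ∈ S → lookup x i ≡ true) → monomialℚ S x ≡ 1ℚ
    monomialℚ-true S x h = go (filter (_∈? S) (allFin n)) (λ i∈ → h (proj₂ (∈-filter⁻ (_∈? S) {xs = allFin n} i∈)))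
      where
      go : ∀ L → (∀ {i} → i ∈ˡ L → lookup x i ≡ true) → foldr (λ i y → ⟦ lookup x i ⟧ * y) 1ℚ L ≡ 1ℚ
      go []      _ = refl
      go (i ∷ L) h = cong₂ (λ b y → ⟦ b ⟧ * y) (h (here refl)) (go L (h ∘ there))

    monomialℚ-false : ∀ (S : Subset n) x i → i ∈ S → lookup x i ≡ false → monomialℚ S x ≡ 0ℚ
    monomialℚ-false S x i i∈S xi = go (filter (_∈? S) (allFin n)) (∈-filter⁺ (_∈? S) (∈-allFin i) i∈S)
      where
      go : ∀ L → i ∈ˡ L → foldr (λ i y → ⟦ lookup x i ⟧ * y) 1ℚ L ≡ 0ℚ
      go (j ∷ L) (here refl) = trans (cong (λ b → ⟦ b ⟧ * foldr (λ i y → ⟦ lookup x i ⟧ * y) 1ℚ L) xi) (*-zeroˡ (foldr (λ i y → ⟦ lookup x i ⟧ * y) 1ℚ L))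
      go (j ∷ L) (there i∈)  = trans (cong (⟦ lookup x j ⟧ *_) (go L i∈)) (*-zeroʳ ⟦ lookup x j ⟧)

    support : List (Fin n) → Subset n
    support []      = Subset.⊥
    support (i ∷ τ) = ⁅ i ⁆ ∪ support τ

    ∣p∪q∣≤∣p∣+∣q∣ : ∀ {m} (p q : Subset m) → Subset.∣ p ∪ q ∣ ℕ.≤ Subset.∣ p ∣ ℕ.+ Subset.∣ q ∣
    ∣p∪q∣≤∣p∣+∣q∣ []            []            = ℕ.z≤n
    ∣p∪q∣≤∣p∣+∣q∣ (outside ∷ p) (outside ∷ q) = ∣p∪q∣≤∣p∣+∣q∣ p q
    ∣p∪q∣≤∣p∣+∣q∣ (outside ∷ p) (inside ∷ q)  = ℕ.≤-trans (ℕ.s≤s (∣p∪q∣≤∣p∣+∣q∣ p q)) (ℕ.≤-reflexive (sym (ℕ.+-suc _ _)))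
    ∣p∪q∣≤∣p∣+∣q∣ (inside ∷ p)  (outside ∷ q) = ℕ.s≤s (∣p∪q∣≤∣p∣+∣q∣ p q)
    ∣p∪q∣≤∣p∣+∣q∣ (inside ∷ p)  (inside ∷ q)  = ℕ.s≤s (ℕ.≤-trans (∣p∪q∣≤∣p∣+∣q∣ p q) (ℕ.+-monoʳ-≤ Subset.∣ p ∣ (ℕ.n≤1+n _)))

    ∣support∣≤length : ∀ τ → Subset.∣ support τ ∣ ℕ.≤ length τ
    ∣support∣≤length []      = ℕ.≤-reflexive (Subset.∣⊥∣≡0 n)
    ∣support∣≤length (i ∷ τ) = ℕ.≤-trans (∣p∪q∣≤∣p∣+∣q∣ ⁅ i ⁆ (support τ))
      (ℕ.+-mono-≤ (ℕ.≤-reflexive (Subset.∣⁅x⁆∣≡1 i)) (∣support∣≤length τ))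

    -- Restores multilinearity: a variable repeated in `τ` enters the support once, which does not
    -- change the product because Boolean values are idempotent.
    monomialℚ-support : ∀ τ x → monomialℚ (support τ) x ≡ ⟦ all (lookup x) τ ⟧
    monomialℚ-support τ x with scan τ
      where
      scan : ∀ τ → (all (lookup x) τ ≡ true × (∀ {i} → i ∈ support τ → lookup x i ≡ true)) ⊎
                   (all (lookup x) τ ≡ false × ∃[ i ] (i ∈ support τ × lookup x i ≡ false))
      scan [] = inj₁ (refl , λ i∈ → ⊥-elim (∉⊥ i∈))
      scan (i ∷ τ) with lookup x i in xi
      ... | false = inj₂ (refl , i , x∈p∪q⁺ (inj₁ (x∈⁅x⁆ i)) , xi)
      ... | true with scan τ
      ...   | inj₁ (eq , h) = inj₁ (eq , λ j∈ → [ (λ j∈i → trans (cong (lookup x) (x∈⁅y⁆⇒x≡y i j∈i)) xi) , h ]′ (x∈p∪q⁻ ⁅ i ⁆ (support τ) j∈))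
      ...   | inj₂ (eq , j , j∈ , xj) = inj₂ (eq , j , x∈p∪q⁺ (inj₂ j∈) , xj)
    ... | inj₁ (eq , h)           = trans (monomialℚ-true (support τ) x h) (cong ⟦_⟧ (sym eq))
    ... | inj₂ (eq , i , i∈ , xi) = trans (monomialℚ-false (support τ) x i i∈ xi) (cong ⟦_⟧ (sym eq))

    IsPoly-≗ : ∀ {d P Q} → (∀ x → Q x ≡ P x) → IsPoly {n} d P → IsPoly d Q
    IsPoly-≗ Q≡P (c , P≡) = c , λ x → trans (Q≡P x) (P≡ x)

    IsPoly-product : ∀ {d} c (τ : List (Fin n)) → length τ ℕ.≤ d → IsPoly d (λ x → c * ⟦ all (lookup x) τ ⟧)
    IsPoly-product c τ τ≤d = IsPoly-≗ (λ x → cong (c *_) (sym (monomialℚ-support τ x)))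
      (IsPoly-monomial c (support τ) (ℕ.≤-trans (∣support∣≤length τ) τ≤d))

open CubePolynomials

-- Linear combinations of products, and classes whose products are approximable

module Combinations where
  open import Data.Rational.Base
  open import Data.Rational.Properties
  open ℚ-Solver.+-*-Solver using (solve; _:=_; _:+_; _:*_; con)
  open ℚ-Lemmas
  open ≤-Reasoning

  module _ {n : ℕ} where

    Approximable : ℕ → ℚ → (Cube n → ℚ) → Set
    Approximable d δ F = Σ[ P ∈ (Cube n → ℚ) ] (IsPoly d P × (∀ x → Near δ (P x) (F x)))

    Class : Set₁
    Class = (Cube n → Bool) → Set

    product : List (Cube n → Bool) → Cube n → Bool
    product τ x = all (λ h → h x) τ

    product-++ : ∀ τ σ x → product (τ ++ σ) x ≡ product τ x ∧ product σ x
    product-++ []      σ x = refl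
    product-++ (h ∷ τ) σ x = trans (cong (h x ∧_) (product-++ τ σ x)) (sym (Bool.∧-assoc (h x) (product τ x) (product σ x)))

    ⟦product-++⟧ : ∀ τ σ x → ⟦ product (τ ++ σ) x ⟧ ≡ ⟦ product τ x ⟧ * ⟦ product σ x ⟧
    ⟦product-++⟧ τ σ x = trans (cong ⟦_⟧ (product-++ τ σ x)) (⟦∧⟧ (product τ x) (product σ x))

    -- `E` bounds the factors of each term and `T` the number of terms; the coefficients `c` are
    -- arbitrary.
    data Comb (𝓒 : Class) (E : ℕ) : ℕ → (Cube n → ℚ) → Set where
      nil  : ∀ {T G} → (∀ x → G x ≡ 0ℚ) → Comb 𝓒 E T G
      cons : ∀ {T F G} c τ → length τ ℕ.≤ E → All 𝓒 τ → Comb 𝓒 E T F →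
             (∀ x → G x ≡ c * ⟦ product τ x ⟧ + F x) → Comb 𝓒 E (suc T) G

    module _ {𝓒 : Class} where

      Comb-≗ : ∀ {E T F G} → (∀ x → G x ≡ F x) → Comb 𝓒 E T F → Comb 𝓒 E T G
      Comb-≗ G≡F (nil h)                = nil λ x → trans (G≡F x) (h x)
      Comb-≗ G≡F (cons c τ τ≤ τ∈ C h)   = cons c τ τ≤ τ∈ C λ x → trans (G≡F x) (h x)

      Comb-mono : ∀ {E E′ T T′ F} → E ℕ.≤ E′ → T ℕ.≤ T′ → Comb 𝓒 E T F → Comb 𝓒 E′ T′ F
      Comb-mono E≤ T≤         (nil h)              = nil h
      Comb-mono E≤ (ℕ.s≤s T≤) (cons c τ τ≤ τ∈ C h) = cons c τ (ℕ.≤-trans τ≤ E≤) τ∈ (Comb-mono E≤ T≤ C) h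

      Comb-+ : ∀ {E T T′ F G} → Comb 𝓒 E T F → Comb 𝓒 E T′ G → Comb 𝓒 E (T ℕ.+ T′) (λ x → F x + G x)
      Comb-+ {T = T} {T′} {G = G} (nil h) D = Comb-≗ (λ x → trans (cong (_+ G x) (h x)) (+-identityˡ (G x)))
        (Comb-mono ℕ.≤-refl (ℕ.m≤n+m T′ T) D)
      Comb-+ {G = G} (cons {F = F} c τ τ≤ τ∈ C h) D = cons c τ τ≤ τ∈ (Comb-+ C D) λ x →
        trans (cong (_+ G x) (h x)) (+-assoc (c * ⟦ product τ x ⟧) (F x) (G x))

      Comb-term : ∀ {E} c τ → length τ ℕ.≤ E → All 𝓒 τ → Comb 𝓒 E 1 (λ x → c * ⟦ product τ x ⟧)
      Comb-term c τ τ≤ τ∈ = cons c τ τ≤ τ∈ (nil {T = 0} {G = λ _ → 0ℚ} λ _ → refl) λ x → sym (+-identityʳ (c * ⟦ product τ x ⟧))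

      Comb-*-term : ∀ {E E′ T F} c τ → length τ ℕ.≤ E′ → All 𝓒 τ → Comb 𝓒 E T F →
                    Comb 𝓒 (E′ ℕ.+ E) T (λ x → c * ⟦ product τ x ⟧ * F x)
      Comb-*-term c τ τ≤ τ∈ (nil h) = nil λ x → trans (cong (c * ⟦ product τ x ⟧ *_) (h x)) (*-zeroʳ (c * ⟦ product τ x ⟧))
      Comb-*-term {F = F} c τ τ≤ τ∈ (cons {F = G} b σ σ≤ σ∈ C h) =
        cons (c * b) (τ ++ σ) (ℕ.≤-trans (ℕ.≤-reflexive (List.length-++ τ)) (ℕ.+-mono-≤ τ≤ σ≤)) (All.++⁺ τ∈ σ∈)
          (Comb-*-term c τ τ≤ τ∈ C) λ x → begin-equality
            c * ⟦ product τ x ⟧ * F x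
              ≡⟨ cong (c * ⟦ product τ x ⟧ *_) (h x) ⟩
            c * ⟦ product τ x ⟧ * (b * ⟦ product σ x ⟧ + G x)
              ≡⟨ solve 5 (λ c t b s g → c :* t :* (b :* s :+ g) := c :* b :* (t :* s) :+ c :* t :* g) refl c ⟦ product τ x ⟧ b ⟦ product σ x ⟧ (G x) ⟩
            c * b * (⟦ product τ x ⟧ * ⟦ product σ x ⟧) + c * ⟦ product τ x ⟧ * G x
              ≡⟨ cong (λ u → c * b * u + c * ⟦ product τ x ⟧ * G x) (⟦product-++⟧ τ σ x) ⟨
            c * b * ⟦ product (τ ++ σ) x ⟧ + c * ⟦ product τ x ⟧ * G x ∎

      Comb-* : ∀ {E E′ T T′ F G} → Comb 𝓒 E T F → Comb 𝓒 E′ T′ G → Comb 𝓒 (E ℕ.+ E′) (T ℕ.* T′) (λ x → F x * G x)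
      Comb-* {G = G} (nil h) D = nil λ x → trans (cong (_* G x) (h x)) (*-zeroˡ (G x))
      Comb-* {G = G} (cons {F = F} c τ τ≤ τ∈ C h) D =
        Comb-≗ (λ x → trans (cong (_* G x) (h x)) (*-distribʳ-+ (G x) (c * ⟦ product τ x ⟧) (F x)))
          (Comb-+ (Comb-*-term c τ τ≤ τ∈ D) (Comb-* C D))

      Comb-⊆ : ∀ {𝓓 : Class} {E T F} → (∀ {h} → 𝓒 h → 𝓓 h) → Comb 𝓒 E T F → Comb 𝓓 E T F
      Comb-⊆ sub (nil h)              = nil h
      Comb-⊆ sub (cons c τ τ≤ τ∈ C h) = cons c τ τ≤ (All.map sub τ∈) (Comb-⊆ sub C) h

      Comb-scale : ∀ {E T F} c → Comb 𝓒 E T F → Comb 𝓒 E T (λ x → c * F x)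
      Comb-scale {F = F} c C = Comb-≗ (λ x → cong (_* F x) (sym (*-identityʳ c))) (Comb-*-term c [] ℕ.z≤n [] C)

    -- A single parameter bounds the number of factors and the precision, so that
    -- a closure step amounts to replacing Q by a fixed power of Q.
    record Good (𝓒 : Class) (Q₀ a : ℕ) : Set where
      constructor good
      field
        approximate : ∀ Q → Q₀ ℕ.≤ Q → ∀ τ → length τ ℕ.≤ Q → All 𝓒 τ → ∀ c →
          Approximable (Q ℕ.^ a) (2⁻ Q) (λ x → c * ⟦ product τ x ⟧)

    open Good

    Good-⊆ : ∀ {𝓒 𝓓 Q₀ a} → (∀ {h} → 𝓓 h → 𝓒 h) → Good 𝓒 Q₀ a → Good 𝓓 Q₀ a
    Good-⊆ sub g = good λ Q Q₀≤Q τ τ≤Q τ∈ → approximate g Q Q₀≤Q τ τ≤Q (All.map sub τ∈)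

    Good-Comb : ∀ {𝓒 Q₀ a} → Good 𝓒 Q₀ a → ∀ Q → Q₀ ℕ.≤ Q → ∀ {T F} → Comb 𝓒 Q T F →
                Approximable (Q ℕ.^ a) (fromℕ T * 2⁻ Q) F
    Good-Comb g Q Q₀≤Q {T} (nil h) = (λ _ → 0ℚ) , IsPoly-0 , λ x →
      subst (Near _ 0ℚ) (sym (h x)) (Near-refl (subst (_≤ fromℕ T * 2⁻ Q) (*-zeroˡ (2⁻ Q)) (*-monoʳ (2⁻ Q) (<⇒≤ (0<2⁻ Q)) (0≤fromℕ T))))
    Good-Comb g Q Q₀≤Q {suc T} (cons c τ τ≤ τ∈ C h) with approximate g Q Q₀≤Q τ τ≤ τ∈ c | Good-Comb g Q Q₀≤Q C
    ... | P , P-poly , P-near | R , R-poly , R-near = (λ x → P x + R x) , IsPoly-+ P-poly R-poly , λ x →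
      subst₂ (λ δ → Near δ (P x + R x)) eq (sym (h x)) (Near-+ (P-near x) (R-near x))
      where
      eq : 2⁻ Q + fromℕ T * 2⁻ Q ≡ fromℕ (suc T) * 2⁻ Q
      eq = trans (solve 2 (λ t q → q :+ t :* q := (con 1ℚ :+ t) :* q) refl (fromℕ T) (2⁻ Q)) (cong (_* 2⁻ Q) (sym (fromℕ-+ 1 T)))

    Approximable-near : ∀ {d δ η F G} → (∀ x → Near η (F x) (G x)) → Approximable d δ F → Approximable d (δ + η) G
    Approximable-near F≈G (P , P-poly , P-near) = P , P-poly , λ x → Near-trans (P-near x) (F≈G x)

    Approximable-weaken : ∀ {d δ η F} → δ ≤ η → Approximable d δ F → Approximable d η F
    Approximable-weaken δ≤η (P , P-poly , P-near) = P , P-poly , λ x → Near-weaken δ≤η (P-near x)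

    -- The class is used with parameter `Q ^ b`. Its `T ≤ 2 ^ t` terms lose `2⁻ (Q ^ b)` each,
    -- together at most `2⁻ suc Q`, half of the allowed error; the other half pays for passing from
    -- `F` to `G`. The degree is `(Q ^ b) ^ a`.
    Good-via-Comb : ∀ {𝓒 Q₀ a} → Good 𝓒 Q₀ a → ∀ Q b t → Q₀ ℕ.≤ Q → 1 ℕ.≤ Q → 1 ℕ.≤ b →
      ∀ {T F G} → Comb 𝓒 (Q ℕ.^ b) T F → T ℕ.≤ 2 ℕ.^ t → t ℕ.+ suc Q ℕ.≤ Q ℕ.^ b →
      (∀ x → Near (2⁻ suc Q) (F x) (G x)) → Approximable (Q ℕ.^ (b ℕ.* a)) (2⁻ Q) G
    Good-via-Comb {a = a} g Q b t Q₀≤Q 1≤Q 1≤b {T} C T≤ t≤ F≈G =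
      subst₂ (λ d δ → Approximable d δ _) (ℕ.^-*-assoc Q b a) (2⁻[1+k]+2⁻[1+k] Q)
        (Approximable-near F≈G (Approximable-weaken error (Good-Comb g (Q ℕ.^ b) Q₀≤Q^b C)))
      where
      Q₀≤Q^b = ℕ.≤-trans Q₀≤Q (ℕ.≤-trans (ℕ.≤-reflexive (sym (ℕ.^-identityʳ Q))) (ℕ.^-monoʳ-≤ Q {{ℕ.>-nonZero 1≤Q}} 1≤b))
      error : fromℕ T * 2⁻ (Q ℕ.^ b) ≤ 2⁻ suc Q
      error = ≤-trans (*-monoˡ (fromℕ T) (0≤fromℕ T) (2⁻-antimono t≤)) (fromℕ*2⁻≤ t (suc Q) T≤)

open Combinations

-- Integer polynomials in Boolean functions, and congruences

module IntegerForms where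
  open import Data.Rational.Base
  open import Data.Rational.Properties
  open ℚ-Solver.+-*-Solver using (solve; _:=_; _:*_; con)
  open ℚ-Lemmas

  open ℤ-Solver.+-*-Solver using () renaming
    (solve to solveℤ; _:=_ to _≔_; _:+_ to _⊕_; _:*_ to _⊗_; _:-_ to _⊖_; :-_ to ⊝_; con to conℤ)
  ⟦_⟧ℤ : Bool → ℤ
  ⟦ b ⟧ℤ = if b then ℤ.1ℤ else ℤ.0ℤ

  fromℤ⟦⟧ : ∀ b → fromℤ ⟦ b ⟧ℤ ≡ ⟦ b ⟧
  fromℤ⟦⟧ true  = refl
  fromℤ⟦⟧ false = refl

  ⟦∧⟧ℤ : ∀ a b → ⟦ a ∧ b ⟧ℤ ≡ ⟦ a ⟧ℤ ℤ.* ⟦ b ⟧ℤ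
  ⟦∧⟧ℤ true  b = sym (ℤ.*-identityˡ ⟦ b ⟧ℤ)
  ⟦∧⟧ℤ false b = refl

  sumℤ : ∀ {N} → (Fin N → ℤ) → ℤ
  sumℤ {zero}  f = ℤ.0ℤ
  sumℤ {suc N} f = f zero ℤ.+ sumℤ (f ∘ suc)

  sumℤ-cong : ∀ {N} {f g : Fin N → ℤ} → (∀ i → f i ≡ g i) → sumℤ f ≡ sumℤ g
  sumℤ-cong {zero}  h = refl
  sumℤ-cong {suc N} h = cong₂ ℤ._+_ (h zero) (sumℤ-cong (h ∘ suc))

  sumℤ-0 : ∀ {N} {f : Fin N → ℤ} → (∀ i → f i ≡ ℤ.0ℤ) → sumℤ f ≡ ℤ.0ℤ
  sumℤ-0 {zero}  h = refl
  sumℤ-0 {suc N} h = cong₂ ℤ._+_ (h zero) (sumℤ-0 (h ∘ suc))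

  sumℤ-+ : ∀ {N} (f g : Fin N → ℤ) → sumℤ f ℤ.+ sumℤ g ≡ sumℤ (λ i → f i ℤ.+ g i)
  sumℤ-+ {zero}  f g = refl
  sumℤ-+ {suc N} f g = trans
    (solveℤ 4 (λ a b c d → a ⊕ b ⊕ (c ⊕ d) ≔ a ⊕ c ⊕ (b ⊕ d)) refl (f zero) (sumℤ (f ∘ suc)) (g zero) (sumℤ (g ∘ suc)))
    (cong (ℤ._+_ (f zero ℤ.+ g zero)) (sumℤ-+ (f ∘ suc) (g ∘ suc)))

  sumℤ-* : ∀ {N} (f : Fin N → ℤ) c → sumℤ f ℤ.* c ≡ sumℤ (λ i → f i ℤ.* c)
  sumℤ-* {zero}  f c = refl
  sumℤ-* {suc N} f c = trans (ℤ.*-distribʳ-+ c (f zero) (sumℤ (f ∘ suc))) (cong (ℤ._+_ (f zero ℤ.* c)) (sumℤ-* (f ∘ suc) c))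

  Congruent : ℤ → ℤ → ℤ → Set
  Congruent M a b = ∃[ k ] a ≡ b ℤ.+ k ℤ.* M

  Congruent-+ : ∀ {M a b c d} → Congruent M a b → Congruent M c d → Congruent M (a ℤ.+ c) (b ℤ.+ d)
  Congruent-+ {M} {b = b} {d = d} (k , refl) (l , refl) = k ℤ.+ l ,
    solveℤ 5 (λ b d k l M → b ⊕ k ⊗ M ⊕ (d ⊕ l ⊗ M) ≔ b ⊕ d ⊕ (k ⊕ l) ⊗ M) refl b d k l M

  Congruent-* : ∀ {M a b c d} → Congruent M a b → Congruent M c d → Congruent M (a ℤ.* c) (b ℤ.* d)
  Congruent-* {M} {b = b} {d = d} (k , refl) (l , refl) = k ℤ.* d ℤ.+ b ℤ.* l ℤ.+ k ℤ.* M ℤ.* l ,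
    solveℤ 5 (λ b d k l M → (b ⊕ k ⊗ M) ⊗ (d ⊕ l ⊗ M) ≔ b ⊗ d ⊕ (k ⊗ d ⊕ b ⊗ l ⊕ k ⊗ M ⊗ l) ⊗ M) refl b d k l M

  -- 3a² − 2a³ agrees with the identity at 0 and 1 and has derivative 0 there.
  amplify : ℤ → ℤ
  amplify a = a ℤ.* a ℤ.* (ℤ.+ 3 ℤ.- ℤ.+ 2 ℤ.* a)

  amplify-congruent : ∀ {M a} b → Congruent M a ⟦ b ⟧ℤ → Congruent (M ℤ.* M) (amplify a) ⟦ b ⟧ℤ
  amplify-congruent {M} false (k , refl) = k ℤ.* k ℤ.* (ℤ.+ 3 ℤ.- ℤ.+ 2 ℤ.* (k ℤ.* M)) ,
    solveℤ 2 (λ k M → (conℤ ℤ.0ℤ ⊕ k ⊗ M) ⊗ (conℤ ℤ.0ℤ ⊕ k ⊗ M) ⊗ (conℤ (ℤ.+ 3) ⊖ conℤ (ℤ.+ 2) ⊗ (conℤ ℤ.0ℤ ⊕ k ⊗ M))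
      ≔ conℤ ℤ.0ℤ ⊕ k ⊗ k ⊗ (conℤ (ℤ.+ 3) ⊖ conℤ (ℤ.+ 2) ⊗ (k ⊗ M)) ⊗ (M ⊗ M)) refl k M
  amplify-congruent {M} true (k , refl) = ℤ.- (k ℤ.* k ℤ.* (ℤ.+ 3 ℤ.+ ℤ.+ 2 ℤ.* (k ℤ.* M))) ,
    solveℤ 2 (λ k M → (conℤ ℤ.1ℤ ⊕ k ⊗ M) ⊗ (conℤ ℤ.1ℤ ⊕ k ⊗ M) ⊗ (conℤ (ℤ.+ 3) ⊖ conℤ (ℤ.+ 2) ⊗ (conℤ ℤ.1ℤ ⊕ k ⊗ M))
      ≔ conℤ ℤ.1ℤ ⊕ (⊝ (k ⊗ k ⊗ (conℤ (ℤ.+ 3) ⊕ conℤ (ℤ.+ 2) ⊗ (k ⊗ M)))) ⊗ (M ⊗ M)) refl k M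

  amplify^ : ℕ → ℤ → ℤ
  amplify^ zero    a = a
  amplify^ (suc r) a = amplify (amplify^ r a)

  tower : ℕ → ℕ → ℕ
  tower p zero    = p
  tower p (suc r) = tower p r ℕ.* tower p r

  amplify^-congruent : ∀ {p a} r b → Congruent (ℤ.+ p) a ⟦ b ⟧ℤ → Congruent (ℤ.+ tower p r) (amplify^ r a) ⟦ b ⟧ℤ
  amplify^-congruent         zero    b h = h
  amplify^-congruent {p} {a} (suc r) b h = subst (λ M → Congruent M (amplify^ (suc r) a) ⟦ b ⟧ℤ)
    (sym (ℤ.pos-* (tower p r) (tower p r))) (amplify-congruent b (amplify^-congruent r b h))

  2^2^r≤tower : ∀ {p} r → 2 ℕ.≤ p → 2 ℕ.^ (2 ℕ.^ r) ℕ.≤ tower p r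
  2^2^r≤tower zero    2≤p = 2≤p
  2^2^r≤tower {p} (suc r) 2≤p = begin
    2 ℕ.^ (2 ℕ.* 2 ℕ.^ r)                    ≡⟨ cong (λ k → 2 ℕ.^ (2 ℕ.^ r ℕ.+ k)) (ℕ.+-identityʳ (2 ℕ.^ r)) ⟩
    2 ℕ.^ (2 ℕ.^ r ℕ.+ 2 ℕ.^ r)              ≡⟨ ℕ.^-distribˡ-+-* 2 (2 ℕ.^ r) (2 ℕ.^ r) ⟩
    2 ℕ.^ (2 ℕ.^ r) ℕ.* 2 ℕ.^ (2 ℕ.^ r)      ≤⟨ ℕ.*-mono-≤ (2^2^r≤tower r 2≤p) (2^2^r≤tower r 2≤p) ⟩
    tower p r ℕ.* tower p r                  ∎
    where open ℕ.≤-Reasoning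

  module _ {n N : ℕ} (H : Fin N → Cube n → Bool) where

    Member : Class
    Member h = ∃[ i ] (∀ x → h x ≡ H i x)

    -- Horner form in noncommuting variables. In contrast to `Comb`, addition merges equal words, so
    -- a form of degree `E` expands to at most `(N + 1) ^ E` monomials, however many sums and
    -- products have built it.
    data Form : ℕ → (Cube n → ℤ) → Set where
      const : ∀ {E G} c → (∀ x → G x ≡ c) → Form E G
      step  : ∀ {E G} c (F : Fin N → Cube n → ℤ) → (∀ i → Form E (F i)) →
              (∀ x → G x ≡ c ℤ.+ sumℤ (λ i → ⟦ H i x ⟧ℤ ℤ.* F i x)) → Form (suc E) G

  module _ {n N : ℕ} {H : Fin N → Cube n → Bool} where

    Form-≗ : ∀ {E F G} → (∀ x → G x ≡ F x) → Form H E F → Form H E G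
    Form-≗ G≡F (const c h)    = const c λ x → trans (G≡F x) (h x)
    Form-≗ G≡F (step c F f h) = step c F f λ x → trans (G≡F x) (h x)

    Form-mono : ∀ {E E′ G} → E ℕ.≤ E′ → Form H E G → Form H E′ G
    Form-mono E≤         (const c h)    = const c h
    Form-mono (ℕ.s≤s E≤) (step c F f h) = step c F (λ i → Form-mono E≤ (f i)) h

    Form-scale : ∀ {E G} a → Form H E G → Form H E (λ x → G x ℤ.* a)
    Form-scale a (const c h)    = const (c ℤ.* a) λ x → cong (ℤ._* a) (h x)
    Form-scale a (step c F f h) = step (c ℤ.* a) (λ i x → F i x ℤ.* a) (λ i → Form-scale a (f i)) λ x →
      trans (cong (ℤ._* a) (h x)) (trans (ℤ.*-distribʳ-+ a c (sumℤ (λ i → ⟦ H i x ⟧ℤ ℤ.* F i x)))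
        (cong (ℤ._+_ (c ℤ.* a)) (trans (sumℤ-* (λ i → ⟦ H i x ⟧ℤ ℤ.* F i x) a)
          (sumℤ-cong λ i → ℤ.*-assoc ⟦ H i x ⟧ℤ (F i x) a))))

    Form-+ : ∀ {E F G} → Form H E F → Form H E G → Form H E (λ x → F x ℤ.+ G x)
    Form-+ (const c h) (const d g) = const (c ℤ.+ d) λ x → cong₂ ℤ._+_ (h x) (g x)
    Form-+ {F = A} {G = B} (const c h) (step d G g k) = step (c ℤ.+ d) G g λ x →
      trans (cong₂ ℤ._+_ (h x) (k x)) (sym (ℤ.+-assoc c d (sumℤ (λ i → ⟦ H i x ⟧ℤ ℤ.* G i x))))
    Form-+ (step c F f h) (const d g) = step (c ℤ.+ d) F f λ x →
      trans (cong₂ ℤ._+_ (h x) (g x)) (solveℤ 3 (λ c s d → c ⊕ s ⊕ d ≔ c ⊕ d ⊕ s) refl c (sumℤ (λ i → ⟦ H i x ⟧ℤ ℤ.* F i x)) d)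
    Form-+ (step c F f h) (step d G g k) = step (c ℤ.+ d) (λ i x → F i x ℤ.+ G i x) (λ i → Form-+ (f i) (g i)) λ x →
      trans (cong₂ ℤ._+_ (h x) (k x)) (trans
        (solveℤ 4 (λ c s d t → c ⊕ s ⊕ (d ⊕ t) ≔ c ⊕ d ⊕ (s ⊕ t)) refl c (sumℤ (λ i → ⟦ H i x ⟧ℤ ℤ.* F i x)) d (sumℤ (λ i → ⟦ H i x ⟧ℤ ℤ.* G i x)))
        (cong (ℤ._+_ (c ℤ.+ d)) (trans (sumℤ-+ (λ i → ⟦ H i x ⟧ℤ ℤ.* F i x) (λ i → ⟦ H i x ⟧ℤ ℤ.* G i x))
          (sumℤ-cong λ i → sym (ℤ.*-distribˡ-+ ⟦ H i x ⟧ℤ (F i x) (G i x))))))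

    -- The left factor is opened one variable at a time: `(c + Σ Hᵢ Fᵢ) G = G c + Σ Hᵢ (Fᵢ G)`.
    Form-* : ∀ {E E′ F G} → Form H E F → Form H E′ G → Form H (E ℕ.+ E′) (λ x → F x ℤ.* G x)
    Form-* {E} {E′} {G = G} (const c h) g = Form-≗ (λ x → trans (cong (ℤ._* G x) (h x)) (ℤ.*-comm c (G x)))
      (Form-mono (ℕ.m≤n+m E′ E) (Form-scale c g))
    Form-* {suc E} {E′} {G = G} (step c F f h) g =
      Form-≗ (λ x → trans (cong (ℤ._* G x) (h x)) (eq x))
        (Form-+ (Form-mono (ℕ.m≤n+m E′ (suc E)) (Form-scale c g))
                (step ℤ.0ℤ (λ i x → F i x ℤ.* G x) (λ i → Form-* (f i) g) λ x → refl))
      where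
      eq : ∀ x → (c ℤ.+ sumℤ (λ i → ⟦ H i x ⟧ℤ ℤ.* F i x)) ℤ.* G x ≡
                 G x ℤ.* c ℤ.+ (ℤ.0ℤ ℤ.+ sumℤ (λ i → ⟦ H i x ⟧ℤ ℤ.* (F i x ℤ.* G x)))
      eq x = trans (solveℤ 3 (λ c s g → (c ⊕ s) ⊗ g ≔ g ⊗ c ⊕ (conℤ ℤ.0ℤ ⊕ s ⊗ g)) refl c (sumℤ (λ i → ⟦ H i x ⟧ℤ ℤ.* F i x)) (G x))
        (cong (λ s → G x ℤ.* c ℤ.+ (ℤ.0ℤ ℤ.+ s)) (trans (sumℤ-* (λ i → ⟦ H i x ⟧ℤ ℤ.* F i x) (G x))
          (sumℤ-cong λ i → ℤ.*-assoc ⟦ H i x ⟧ℤ (F i x) (G x))))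

    Form-member : ∀ {h} → Member H h → Form H 1 (λ x → ⟦ h x ⟧ℤ)
    Form-member (i , h≡) = step ℤ.0ℤ (λ j _ → δ i j) (λ j → const (δ i j) λ _ → refl) λ x →
      trans (cong ⟦_⟧ℤ (h≡ x)) (sym (trans (ℤ.+-identityˡ _) (δ-sum (λ j → ⟦ H j x ⟧ℤ) i)))
      where
      δ : ∀ {N} → Fin N → Fin N → ℤ
      δ zero    zero    = ℤ.1ℤ
      δ zero    (suc _) = ℤ.0ℤ
      δ (suc _) zero    = ℤ.0ℤ
      δ (suc i) (suc j) = δ i j
      δ-sum : ∀ {N} (f : Fin N → ℤ) i → sumℤ (λ j → f j ℤ.* δ i j) ≡ f i
      δ-sum f zero    = trans (cong₂ ℤ._+_ (ℤ.*-identityʳ (f zero)) (sumℤ-0 λ j → ℤ.*-zeroʳ (f (suc j)))) (ℤ.+-identityʳ (f zero))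
      δ-sum f (suc i) = trans (cong₂ ℤ._+_ (ℤ.*-zeroʳ (f zero)) (δ-sum (f ∘ suc) i)) (ℤ.+-identityˡ (f (suc i)))

    Form-amplify : ∀ {E G} → Form H E G → Form H (3 ℕ.* E) (λ x → amplify (G x))
    Form-amplify {E} {G} g = Form-mono
      (ℕ.≤-reflexive (trans (ℕ.+-assoc E E E) (cong (λ e → E ℕ.+ (E ℕ.+ e)) (sym (ℕ.+-identityʳ E)))))
      (Form-* (Form-* g g) (Form-≗ (λ x → solveℤ 1 (λ a → conℤ (ℤ.+ 3) ⊖ conℤ (ℤ.+ 2) ⊗ a ≔ conℤ (ℤ.+ 3) ⊕ a ⊗ conℤ (ℤ.- (ℤ.+ 2))) refl (G x))
        (Form-+ (const (ℤ.+ 3) λ _ → refl) (Form-scale (ℤ.- (ℤ.+ 2)) g))))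

    Form-amplify^ : ∀ {E G} r → Form H E G → Form H (3 ℕ.^ r ℕ.* E) (λ x → amplify^ r (G x))
    Form-amplify^ {E} zero    g = Form-mono (ℕ.≤-reflexive (sym (ℕ.*-identityˡ E))) g
    Form-amplify^ {E} (suc r) g = Form-mono (ℕ.≤-reflexive (sym (ℕ.*-assoc 3 (3 ℕ.^ r) E))) (Form-amplify (Form-amplify^ r g))

    -- The number of monomials does not depend on the size of the coefficients.
    Form⇒Comb : ∀ {E G} r → Form H E G → Comb (Member H) E (suc N ℕ.^ E) (λ x → r * fromℤ (G x))
    Form⇒Comb {E} r (const c h) = Comb-mono ℕ.z≤n (ℕ.m^n>0 (suc N) E)
      (Comb-≗ (λ x → trans (cong (λ i → r * fromℤ i) (h x)) (sym (*-identityʳ (r * fromℤ c)))) (Comb-term (r * fromℤ c) [] ℕ.z≤n []))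
    Form⇒Comb {suc E} r (step c F f h) = Comb-mono ℕ.≤-refl (ℕ.+-monoˡ-≤ (N ℕ.* suc N ℕ.^ E) (ℕ.m^n>0 (suc N) E))
      (Comb-≗ (λ x → trans (cong (λ i → r * fromℤ i) (h x)) (eq x)) (Comb-+
        (Comb-term (r * fromℤ c) [] ℕ.z≤n [])
        (Comb-sum (λ i x → ⟦ H i x ⟧ℤ ℤ.* F i x) λ i → Comb-≗ (eq′ i) (Comb-*-term 1ℚ (H i ∷ []) ℕ.≤-refl ((i , λ _ → refl) ∷ []) (Form⇒Comb r (f i))))))
      where
      eq : ∀ x → r * fromℤ (c ℤ.+ sumℤ (λ i → ⟦ H i x ⟧ℤ ℤ.* F i x)) ≡
                 r * fromℤ c * 1ℚ + r * fromℤ (sumℤ (λ i → ⟦ H i x ⟧ℤ ℤ.* F i x))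
      eq x = trans (cong (r *_) (fromℤ-+ c (sumℤ (λ i → ⟦ H i x ⟧ℤ ℤ.* F i x))))
        (trans (*-distribˡ-+ r (fromℤ c) (fromℤ (sumℤ (λ i → ⟦ H i x ⟧ℤ ℤ.* F i x))))
          (cong (_+ r * fromℤ (sumℤ (λ i → ⟦ H i x ⟧ℤ ℤ.* F i x))) (sym (*-identityʳ (r * fromℤ c)))))
      eq′ : ∀ i x → r * fromℤ (⟦ H i x ⟧ℤ ℤ.* F i x) ≡ 1ℚ * ⟦ product (H i ∷ []) x ⟧ * (r * fromℤ (F i x))
      eq′ i x = trans (cong (r *_) (trans (fromℤ-* ⟦ H i x ⟧ℤ (F i x)) (cong (_* fromℤ (F i x))
          (trans (fromℤ⟦⟧ (H i x)) (cong ⟦_⟧ (sym (Bool.∧-identityʳ (H i x))))))))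
        (solve 3 (λ r h f → r :* (h :* f) := con 1ℚ :* h :* (r :* f)) refl r ⟦ product (H i ∷ []) x ⟧ (fromℤ (F i x)))
      Comb-sum : ∀ {M E T} (f : Fin M → Cube n → ℤ) → (∀ i → Comb (Member H) E T (λ x → r * fromℤ (f i x))) →
            Comb (Member H) E (M ℕ.* T) (λ x → r * fromℤ (sumℤ (λ i → f i x)))
      Comb-sum {zero}  f C = nil λ x → *-zeroʳ r
      Comb-sum {suc M} f C = Comb-≗ (λ x → trans (cong (r *_) (fromℤ-+ (f zero x) (sumℤ (λ i → f (suc i) x))))
          (*-distribˡ-+ r (fromℤ (f zero x)) (fromℤ (sumℤ (λ i → f (suc i) x)))))
        (Comb-+ (C zero) (Comb-sum (f ∘ suc) (C ∘ suc)))

    record Residue (p e : ℕ) (h : Cube n → Bool) : Set where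
      constructor residue
      field
        value     : Cube n → ℤ
        form      : Form H e value
        congruent : ∀ x → Congruent (ℤ.+ p) (value x) ⟦ h x ⟧ℤ

    Residue-mono : ∀ {p e e′ h} → e ℕ.≤ e′ → Residue p e h → Residue p e′ h
    Residue-mono e≤ (residue G f c) = residue G (Form-mono e≤ f) c

    Residue-∧ : ∀ {p e e′ g h} → Residue p e g → Residue p e′ h → Residue p (e ℕ.+ e′) (λ x → g x ∧ h x)
    Residue-∧ {p} {g = g} {h} (residue F f c) (residue G f′ c′) = residue (λ x → F x ℤ.* G x) (Form-* f f′) λ x →
      subst (Congruent (ℤ.+ p) (F x ℤ.* G x)) (sym (⟦∧⟧ℤ (g x) (h x))) (Congruent-* {ℤ.+ p} {b = ⟦ g x ⟧ℤ} {d = ⟦ h x ⟧ℤ} (c x) (c′ x))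

  infixr 6 _∪_
  _∪_ : ∀ {n} → Class {n} → Class {n} → Class {n}
  (𝓢 ∪ 𝓣) h = 𝓢 h ⊎ 𝓣 h

  module _ {n N : ℕ} {H : Fin N → Cube n → Bool} {𝓢 : Class {n}} {p e : ℕ} where

    -- All residue factors are gathered in one Boolean function `b`, so that amplification runs
    -- once, on a form of degree `length τ * e`.
    collect : ∀ τ → All (𝓢 ∪ Residue {H = H} p e) τ →
      ∃[ σ ] ∃[ b ] (length σ ℕ.≤ length τ × All 𝓢 σ × Residue {H = H} p (length τ ℕ.* e) b ×
                     (∀ x → product τ x ≡ product σ x ∧ b x))
    collect [] [] = [] , (λ _ → true) , ℕ.z≤n , [] , residue (λ _ → ℤ.1ℤ) (const ℤ.1ℤ λ _ → refl) (λ _ → ℤ.0ℤ , refl) , λ _ → refl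
    collect (h ∷ τ) (h∈ ∷ τ∈) with collect τ τ∈
    collect (h ∷ τ) (inj₁ h∈ ∷ τ∈) | σ , b , σ≤ , σ∈ , res , eq =
      h ∷ σ , b , ℕ.s≤s σ≤ , h∈ ∷ σ∈ , Residue-mono (ℕ.m≤n+m _ e) res , λ x →
        trans (cong (h x ∧_) (eq x)) (sym (Bool.∧-assoc (h x) (product σ x) (b x)))
    collect (h ∷ τ) (inj₂ h∈ ∷ τ∈) | σ , b , σ≤ , σ∈ , res , eq =
      σ , (λ x → h x ∧ b x) , ℕ.≤-trans σ≤ (ℕ.n≤1+n _) , σ∈ , Residue-∧ h∈ res , λ x → begin
        h x ∧ product τ x              ≡⟨ cong (h x ∧_) (eq x) ⟩
        h x ∧ (product σ x ∧ b x)      ≡⟨ Bool.∧-assoc (h x) (product σ x) (b x) ⟨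
        (h x ∧ product σ x) ∧ b x      ≡⟨ cong (_∧ b x) (Bool.∧-comm (h x) (product σ x)) ⟩
        (product σ x ∧ h x) ∧ b x      ≡⟨ Bool.∧-assoc (product σ x) (h x) (b x) ⟩
        product σ x ∧ (h x ∧ b x)      ∎
      where open ≡-Reasoning

open IntegerForms

-- Eliminating residues modulo a prime

module ModulusAmplification where
  open import Data.Rational.Base
  open import Data.Rational.Properties
  open ℚ-Solver.+-*-Solver using (solve; _:=_; _:+_; _:*_; :-_; _:-_; con)
  open ℚ-Lemmas

  module Powers (Q : ℕ) (4≤Q : 4 ℕ.≤ Q) where
    open ℕ.≤-Reasoning

    instance
      Q≢0 : ℕ.NonZero Q
      Q≢0 = ℕ.>-nonZero (ℕ.≤-trans (ℕ.s≤s ℕ.z≤n) 4≤Q)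

    ≤^-mono : ∀ {x} i j → i ℕ.≤ j → x ℕ.≤ Q ℕ.^ i → x ℕ.≤ Q ℕ.^ j
    ≤^-mono i j i≤j x≤ = ℕ.≤-trans x≤ (ℕ.^-monoʳ-≤ Q i≤j)

    Q≤Q^1 : Q ℕ.≤ Q ℕ.^ 1
    Q≤Q^1 = ℕ.≤-reflexive (sym (ℕ.^-identityʳ Q))

    *-≤^ : ∀ {x y} i j → x ℕ.≤ Q ℕ.^ i → y ℕ.≤ Q ℕ.^ j → x ℕ.* y ℕ.≤ Q ℕ.^ (i ℕ.+ j)
    *-≤^ {x} {y} i j x≤ y≤ = begin
      x ℕ.* y                  ≤⟨ ℕ.*-mono-≤ x≤ y≤ ⟩
      Q ℕ.^ i ℕ.* Q ℕ.^ j      ≡⟨ ℕ.^-distribˡ-+-* Q i j ⟨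
      Q ℕ.^ (i ℕ.+ j)          ∎

    +-≤^ : ∀ {x y} i → x ℕ.≤ Q ℕ.^ i → y ℕ.≤ Q ℕ.^ i → x ℕ.+ y ℕ.≤ Q ℕ.^ suc i
    +-≤^ {x} {y} i x≤ y≤ = begin
      x ℕ.+ y                        ≤⟨ ℕ.+-mono-≤ x≤ y≤ ⟩
      Q ℕ.^ i ℕ.+ Q ℕ.^ i            ≡⟨ cong (Q ℕ.^ i ℕ.+_) (ℕ.+-identityʳ (Q ℕ.^ i)) ⟨
      2 ℕ.* Q ℕ.^ i                  ≤⟨ ℕ.*-monoˡ-≤ (Q ℕ.^ i) (ℕ.≤-trans (ℕ.s≤s (ℕ.s≤s ℕ.z≤n)) 4≤Q) ⟩
      Q ℕ.* Q ℕ.^ i                  ∎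

    1+Q≤Q^2 : suc Q ℕ.≤ Q ℕ.^ 2
    1+Q≤Q^2 = +-≤^ 1 (ℕ.m^n>0 Q 1) Q≤Q^1

    2*[1+Q]≤Q^2 : 2 ℕ.* suc Q ℕ.≤ Q ℕ.^ 2
    2*[1+Q]≤Q^2 = begin
      2 ℕ.* suc Q             ≡⟨ ℕ.*-suc 2 Q ⟩
      2 ℕ.+ 2 ℕ.* Q           ≤⟨ ℕ.+-monoˡ-≤ (2 ℕ.* Q) (ℕ.≤-trans (ℕ.s≤s (ℕ.s≤s ℕ.z≤n)) (ℕ.≤-trans 4≤Q (ℕ.m≤m+n Q (Q ℕ.+ 0)))) ⟩
      2 ℕ.* Q ℕ.+ 2 ℕ.* Q     ≡⟨ ℕ.*-distribʳ-+ Q 2 2 ⟨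
      4 ℕ.* Q                 ≤⟨ ℕ.*-monoˡ-≤ Q 4≤Q ⟩
      Q ℕ.* Q                 ≡⟨ cong (Q ℕ.*_) (ℕ.*-identityʳ Q) ⟨
      Q ℕ.^ 2                 ∎

    -- With `r` close to log₂ `Q`, the modulus `p ^ (2 ^ r)` reaches `2 ^ (Q + 1)`, while `r` cubic
    -- substitutions multiply the degree by only `3 ^ r ≤ 4 ^ r`, which is polynomial in `Q`.
    squarings : ∃[ r ] (suc Q ℕ.≤ 2 ℕ.^ r × 3 ℕ.^ r ℕ.≤ Q ℕ.^ 4)
    squarings = r , ℕ.<⇒≤ (ℕ-Lemmas.n<2^1+⌊log₂n⌋ (suc Q)) , (begin
      3 ℕ.^ r                  ≤⟨ ℕ.^-monoˡ-≤ r (ℕ.n≤1+n 3) ⟩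
      4 ℕ.^ r                  ≡⟨ ℕ-Lemmas.^-distribʳ-* 2 2 r ⟩
      2 ℕ.^ r ℕ.* 2 ℕ.^ r      ≤⟨ *-≤^ 2 2 2^r≤Q^2 2^r≤Q^2 ⟩
      Q ℕ.^ 4                  ∎)
      where
      r = suc ⌊log₂ suc Q ⌋
      2^r≤Q^2 : 2 ℕ.^ r ℕ.≤ Q ℕ.^ 2
      2^r≤Q^2 = ℕ.≤-trans (ℕ.*-monoʳ-≤ 2 (ℕ-Lemmas.2^⌊log₂n⌋≤n (suc Q) (ℕ.s≤s ℕ.z≤n))) 2*[1+Q]≤Q^2

  1/-≤2⁻ : ∀ {M k u} → 2 ℕ.^ k ℕ.≤ M → 0ℚ ≤ u → fromℕ M * u ≡ 1ℚ → u ≤ 2⁻ k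
  1/-≤2⁻ {M} {k} {u} 2^k≤M 0≤u Mu≡1 = begin
    u                                   ≡⟨ *-identityʳ u ⟨
    u * 1ℚ                              ≡⟨ cong (u *_) (2^*2⁻≡1 k) ⟨
    u * (fromℕ (2 ℕ.^ k) * 2⁻ k)        ≡⟨ *-assoc u (fromℕ (2 ℕ.^ k)) (2⁻ k) ⟨
    u * fromℕ (2 ℕ.^ k) * 2⁻ k          ≤⟨ *-monoʳ (2⁻ k) (<⇒≤ (0<2⁻ k)) (*-monoˡ u 0≤u (fromℕ-mono 2^k≤M)) ⟩
    u * fromℕ M * 2⁻ k                  ≡⟨ cong (_* 2⁻ k) (trans (*-comm u (fromℕ M)) Mu≡1) ⟩
    1ℚ * 2⁻ k                           ≡⟨ *-identityˡ (2⁻ k) ⟩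
    2⁻ k                                ∎
    where open ≤-Reasoning

  -- With c rounded to a / M, the product can be replaced by the amplified
  -- polynomial, since a / M times a multiple of M is an integer.
  round-near : ∀ c a u M s b {g} {δ} → u * M ≡ 1ℚ → 0ℚ ≤ u → u ≤ δ →
    0ℚ ≤ c * M - fromℤ a → c * M - fromℤ a ≤ 1ℚ → ∃[ k ] fromℤ g ≡ ⟦ b ⟧ + fromℤ k * M →
    Near δ (1ℚ * ⟦ s ⟧ * (fromℤ a * u * fromℤ g)) (c * ⟦ s ∧ b ⟧)
  round-near c a u M s b {g} {δ} uM≡1 0≤u u≤δ 0≤f f≤1 (k , g≡) = near (⟦ s ⟧ℤ ℤ.* (a ℤ.* k)) (begin
    ∣ 1ℚ * ⟦ s ⟧ * (fromℤ a * u * fromℤ g) - c * ⟦ s ∧ b ⟧ - fromℤ (⟦ s ⟧ℤ ℤ.* (a ℤ.* k)) ∣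
      ≡⟨ cong ∣_∣ eq ⟩
    ∣ - (f * u * ⟦ s ∧ b ⟧) ∣
      ≡⟨ ∣-p∣≡∣p∣ (f * u * ⟦ s ∧ b ⟧) ⟩
    ∣ f * u * ⟦ s ∧ b ⟧ ∣
      ≡⟨ 0≤p⇒∣p∣≡p (subst (_≤ f * u * ⟦ s ∧ b ⟧) (*-zeroʳ (f * u)) (*-monoˡ (f * u) 0≤fu (0≤⟦⟧ (s ∧ b)))) ⟩
    f * u * ⟦ s ∧ b ⟧
      ≤⟨ *-monoˡ (f * u) 0≤fu (⟦⟧≤1 (s ∧ b)) ⟩
    f * u * 1ℚ
      ≡⟨ *-identityʳ (f * u) ⟩
    f * u
      ≤⟨ *-monoʳ u 0≤u f≤1 ⟩
    1ℚ * u
      ≡⟨ *-identityˡ u ⟩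
    u
      ≤⟨ u≤δ ⟩
    δ ∎)
    where
    open ≤-Reasoning
    f = c * M - fromℤ a
    0≤fu : 0ℚ ≤ f * u
    0≤fu = subst (_≤ f * u) (*-zeroˡ u) (*-monoʳ u 0≤u 0≤f)
    A = fromℤ a
    K = fromℤ k
    S = ⟦ s ⟧
    B = ⟦ b ⟧
    eq : 1ℚ * S * (A * u * fromℤ g) - c * ⟦ s ∧ b ⟧ - fromℤ (⟦ s ⟧ℤ ℤ.* (a ℤ.* k)) ≡ - (f * u * ⟦ s ∧ b ⟧)
    eq = begin-equality
      1ℚ * S * (A * u * fromℤ g) - c * ⟦ s ∧ b ⟧ - fromℤ (⟦ s ⟧ℤ ℤ.* (a ℤ.* k))
        ≡⟨ cong₂ (λ x y → 1ℚ * S * (A * u * x) - c * y - fromℤ (⟦ s ⟧ℤ ℤ.* (a ℤ.* k))) g≡ (⟦∧⟧ s b) ⟩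
      1ℚ * S * (A * u * (B + K * M)) - c * (S * B) - fromℤ (⟦ s ⟧ℤ ℤ.* (a ℤ.* k))
        ≡⟨ cong (λ x → 1ℚ * S * (A * u * (B + K * M)) - c * (S * B) - x)
             (trans (fromℤ-* ⟦ s ⟧ℤ (a ℤ.* k)) (cong₂ _*_ (fromℤ⟦⟧ s) (fromℤ-* a k))) ⟩
      1ℚ * S * (A * u * (B + K * M)) - c * (S * B) - S * (A * K)
        ≡⟨ solve 7 (λ S A u B K M c → con 1ℚ :* S :* (A :* u :* (B :+ K :* M)) :- c :* (S :* B) :- S :* (A :* K) :=
                    A :* u :* (S :* B) :- c :* (S :* B) :+ S :* A :* K :* (u :* M) :- S :* (A :* K)) refl S A u B K M c ⟩
      A * u * (S * B) - c * (S * B) + S * A * K * (u * M) - S * (A * K)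
        ≡⟨ cong (λ x → A * u * (S * B) - c * (S * B) + S * A * K * x - S * (A * K)) uM≡1 ⟩
      A * u * (S * B) - c * (S * B) + S * A * K * 1ℚ - S * (A * K)
        ≡⟨ solve 6 (λ S A u B K c → A :* u :* (S :* B) :- c :* (S :* B) :+ S :* A :* K :* con 1ℚ :- S :* (A :* K) :=
                    A :* u :* (S :* B) :- c :* con 1ℚ :* (S :* B)) refl S A u B K c ⟩
      A * u * (S * B) - c * 1ℚ * (S * B)
        ≡⟨ cong (λ x → A * u * (S * B) - c * x * (S * B)) uM≡1 ⟨
      A * u * (S * B) - c * (u * M) * (S * B)
        ≡⟨ solve 6 (λ S A u B M c → A :* u :* (S :* B) :- c :* (u :* M) :* (S :* B) := :- ((c :* M :- A) :* u :* (S :* B))) refl S A u B M c ⟩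
      - (f * u * (S * B))
        ≡⟨ cong (λ x → - (f * u * x)) (⟦∧⟧ s b) ⟨
      - (f * u * ⟦ s ∧ b ⟧) ∎

  module _ {n N : ℕ} {H : Fin N → Cube n → Bool} where

    -- Factors from `𝓢` are carried along untouched; the residues become monomials in members of
    -- `H`. The exponent 8: the amplified form has degree `E ≤ Q ^ 6` and at most `2 ^ (Q * E)`
    -- monomials, as `N + 1 ≤ 2 ^ Q`, and `Q * E + (Q + 1) ≤ Q ^ 8`.
    Good-Residue : ∀ {𝓢 : Class {n}} {p e Q₀ a} → 2 ℕ.≤ p → 4 ℕ.≤ Q₀ → e ℕ.≤ Q₀ → suc N ℕ.≤ 2 ℕ.^ Q₀ →
      Good (𝓢 ∪ Member H) Q₀ a → Good (𝓢 ∪ Residue {H = H} p e) Q₀ (8 ℕ.* a)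
    Good-Residue {𝓢} {p} {e} {Q₀} {a} 2≤p 4≤Q₀ e≤Q₀ N≤ g = good go
      where
      go : ∀ Q → Q₀ ℕ.≤ Q → ∀ τ → length τ ℕ.≤ Q → All (𝓢 ∪ Residue {H = H} p e) τ → ∀ c →
           Approximable (Q ℕ.^ (8 ℕ.* a)) (2⁻ Q) (λ x → c * ⟦ product τ x ⟧)
      go Q Q₀≤Q τ τ≤Q τ∈ c = main (Powers.squarings Q 4≤Q) (collect τ τ∈)
        where
        4≤Q = ℕ.≤-trans 4≤Q₀ Q₀≤Q
        open Powers Q 4≤Q
        main : ∃[ r ] (suc Q ℕ.≤ 2 ℕ.^ r × 3 ℕ.^ r ℕ.≤ Q ℕ.^ 4) →
               ∃[ σ ] ∃[ b ] (length σ ℕ.≤ length τ × All 𝓢 σ × Residue {H = H} p (length τ ℕ.* e) b ×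
                              (∀ x → product τ x ≡ product σ x ∧ b x)) →
               Approximable (Q ℕ.^ (8 ℕ.* a)) (2⁻ Q) (λ x → c * ⟦ product τ x ⟧)
        main (r , 1+Q≤2^r , 3^r≤Q^4) (σ , b , σ≤τ , σ∈ , residue G G-form G≡ , τ≡) =
          Good-via-Comb g Q 8 (Q ℕ.* E) Q₀≤Q (ℕ.≤-trans (ℕ.s≤s ℕ.z≤n) 4≤Q) (ℕ.s≤s ℕ.z≤n) comb T≤ t≤ close
          where
          E = 3 ℕ.^ r ℕ.* (length τ ℕ.* e)
          E≤ : E ℕ.≤ Q ℕ.^ 6
          E≤ = *-≤^ 4 2 3^r≤Q^4 (*-≤^ 1 1 (ℕ.≤-trans τ≤Q Q≤Q^1) (ℕ.≤-trans (ℕ.≤-trans e≤Q₀ Q₀≤Q) Q≤Q^1))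
          T≤ : suc N ℕ.^ E ℕ.≤ 2 ℕ.^ (Q ℕ.* E)
          T≤ = ℕ.≤-trans (ℕ.^-monoˡ-≤ E (ℕ.≤-trans N≤ (ℕ.^-monoʳ-≤ 2 Q₀≤Q))) (ℕ.≤-reflexive (ℕ.^-*-assoc 2 Q E))
          t≤ : Q ℕ.* E ℕ.+ suc Q ℕ.≤ Q ℕ.^ 8
          t≤ = +-≤^ 7 (*-≤^ 1 6 Q≤Q^1 E≤) (≤^-mono 2 7 (ℕ.s≤s (ℕ.s≤s ℕ.z≤n)) 1+Q≤Q^2)
          degree≤ : length σ ℕ.+ E ℕ.≤ Q ℕ.^ 8
          degree≤ = ≤^-mono 7 8 (ℕ.n≤1+n 7) (+-≤^ 6 (≤^-mono 1 6 (ℕ.s≤s ℕ.z≤n) (ℕ.≤-trans (ℕ.≤-trans σ≤τ τ≤Q) Q≤Q^1)) E≤)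
          2^[1+Q]≤M : 2 ℕ.^ suc Q ℕ.≤ tower p r
          2^[1+Q]≤M = ℕ.≤-trans (ℕ.^-monoʳ-≤ 2 1+Q≤2^r) (2^2^r≤tower r 2≤p)
          inv : ∃[ u ] (0ℚ < u × fromℕ (tower p r) * u ≡ 1ℚ)
          inv = 1/-pos (<-≤-trans (positive⁻¹ 1ℚ) (fromℕ-mono {1} (ℕ.≤-trans (ℕ.m^n>0 2 (suc Q)) 2^[1+Q]≤M)))
          u = proj₁ inv
          0≤u = <⇒≤ (proj₁ (proj₂ inv))
          Mu≡1 = proj₂ (proj₂ inv)
          rounding : ∃[ α ] (0ℚ ≤ c * fromℕ (tower p r) - fromℤ α × c * fromℕ (tower p r) - fromℤ α ≤ 1ℚ)
          rounding = integer-part (c * fromℕ (tower p r))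
          α = proj₁ rounding
          F : Cube n → ℚ
          F x = 1ℚ * ⟦ product σ x ⟧ * (fromℤ α * u * fromℤ (amplify^ r (G x)))
          comb : Comb (𝓢 ∪ Member H) (Q ℕ.^ 8) (suc N ℕ.^ E) F
          comb = Comb-mono degree≤ ℕ.≤-refl
            (Comb-*-term 1ℚ σ ℕ.≤-refl (All.map inj₁ σ∈) (Comb-⊆ inj₂ (Form⇒Comb (fromℤ α * u) (Form-amplify^ r G-form))))
          lift : ∀ x → ∃[ k ] fromℤ (amplify^ r (G x)) ≡ ⟦ b x ⟧ + fromℤ k * fromℕ (tower p r)
          lift x with amplify^-congruent r (b x) (G≡ x)
          ... | k , eq = k , trans (cong fromℤ eq) (trans (fromℤ-+ ⟦ b x ⟧ℤ (k ℤ.* ℤ.+ tower p r))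
                               (cong₂ _+_ (fromℤ⟦⟧ (b x)) (fromℤ-* k (ℤ.+ tower p r))))
          close : ∀ x → Near (2⁻ suc Q) (F x) (c * ⟦ product τ x ⟧)
          close x = subst (λ y → Near (2⁻ suc Q) (F x) (c * ⟦ y ⟧)) (sym (τ≡ x))
            (round-near c α u (fromℕ (tower p r)) (product σ x) (b x) {amplify^ r (G x)} (trans (*-comm u (fromℕ (tower p r))) Mu≡1) 0≤u
              (1/-≤2⁻ {k = suc Q} 2^[1+Q]≤M 0≤u Mu≡1) (proj₁ (proj₂ rounding)) (proj₂ (proj₂ rounding)) (lift x))

open ModulusAmplification

-- Replacing Boolean factors by real approximations

module Averaging where
  open import Data.Rational.Base
  open import Data.Rational.Properties
  open ℚ-Solver.+-*-Solver using (solve; _:=_; _:+_; _:*_; :-_; _:-_; con)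
  open ℚ-Lemmas
  open ≤-Reasoning

  n≤2^n : ∀ n → n ℕ.≤ 2 ℕ.^ n
  n≤2^n zero    = ℕ.z≤n
  n≤2^n (suc n) = ℕ.+-mono-≤ (ℕ.m^n>0 2 n) (ℕ.≤-trans (n≤2^n n) (ℕ.m≤m+n (2 ℕ.^ n) 0))

  module _ {n : ℕ} where

    -- Values are confined to `[0, 1]` so that the errors in a product of approximations merely add
    -- up. The number of terms is recorded through its logarithm `t`.
    record UnitComb (𝓒 : Class {n}) (E t : ℕ) (δ : ℚ) (h : Cube n → Bool) : Set where
      constructor unitComb
      field
        value : Cube n → ℚ
        0≤    : ∀ x → 0ℚ ≤ value x
        ≤1    : ∀ x → value x ≤ 1ℚ
        close : ∀ x → ∣ value x - ⟦ h x ⟧ ∣ ≤ δ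
        comb  : Comb 𝓒 E (2 ℕ.^ t) value

    Approximated : Class {n} → ℕ → ℕ → (Cube n → Bool) → Set
    Approximated 𝓒 Q₀ b h = ∀ Q → Q₀ ℕ.≤ Q → UnitComb 𝓒 (Q ℕ.^ b) (Q ℕ.^ b) (2⁻ Q) h

    UnitComb-product : ∀ {𝓒 E t δ} τ → All (UnitComb 𝓒 E t δ) τ →
      UnitComb 𝓒 (length τ ℕ.* E) (length τ ℕ.* t) (fromℕ (length τ) * δ) (product τ)
    UnitComb-product {δ = δ} [] [] = unitComb (λ _ → 1ℚ) (λ _ → 0≤1) (λ _ → ≤-refl)
      (λ _ → ≤-reflexive (sym (*-zeroˡ δ))) (Comb-term 1ℚ [] ℕ.z≤n [])
    UnitComb-product {𝓒} {E} {t} {δ} (h ∷ τ) (unitComb ρ 0≤ρ ρ≤1 ρ≈h C ∷ us) with UnitComb-product τ us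
    ... | unitComb π 0≤π π≤1 π≈τ D = unitComb (λ x → ρ x * π x)
      (λ x → subst (_≤ ρ x * π x) (*-zeroʳ (ρ x)) (*-monoˡ (ρ x) (0≤ρ x) (0≤π x)))
      (λ x → ≤-trans (*-mono (0≤ρ x) 0≤1 (ρ≤1 x) (π≤1 x)) (≤-reflexive (*-identityˡ 1ℚ)))
      close
      (Comb-mono ℕ.≤-refl (ℕ.≤-reflexive (sym (ℕ.^-distribˡ-+-* 2 t (length τ ℕ.* t)))) (Comb-* C D))
      where
      l = fromℕ (length τ)
      close : ∀ x → ∣ ρ x * π x - ⟦ h x ∧ product τ x ⟧ ∣ ≤ fromℕ (suc (length τ)) * δ
      close x = begin
        ∣ ρ x * π x - ⟦ h x ∧ product τ x ⟧ ∣
          ≡⟨ cong (λ y → ∣ ρ x * π x - y ∣) (⟦∧⟧ (h x) (product τ x)) ⟩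
        ∣ ρ x * π x - ⟦ h x ⟧ * ⟦ product τ x ⟧ ∣
          ≤⟨ ∣-∣-* (ρ x) (π x) ⟦ h x ⟧ ⟦ product τ x ⟧ ⟩
        ∣ ρ x ∣ * ∣ π x - ⟦ product τ x ⟧ ∣ + ∣ ρ x - ⟦ h x ⟧ ∣ * ∣ ⟦ product τ x ⟧ ∣
          ≤⟨ +-mono-≤
               (*-mono (0≤∣p∣ (ρ x)) (≤-trans (0≤∣p∣ (π x - ⟦ product τ x ⟧)) (π≈τ x)) (≤-trans (≤-reflexive (0≤p⇒∣p∣≡p (0≤ρ x))) (ρ≤1 x)) (π≈τ x))
               (*-mono (0≤∣p∣ (ρ x - ⟦ h x ⟧)) 0≤1 (ρ≈h x) (∣⟦⟧∣≤1 (product τ x))) ⟩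
        1ℚ * (l * δ) + δ * 1ℚ
          ≡⟨ solve 2 (λ l δ → con 1ℚ :* (l :* δ) :+ δ :* con 1ℚ := (con 1ℚ :+ l) :* δ) refl l δ ⟩
        (1ℚ + l) * δ
          ≡⟨ cong (_* δ) (fromℕ-+ 1 (length τ)) ⟨
        fromℕ (suc (length τ)) * δ ∎

    -- Only the fractional part of the coefficient matters, as the product is
    -- an integer.
    scale-near : ∀ c b {ρ δ} → 0ℚ ≤ c → c ≤ 1ℚ → ∀ z → ∣ ρ - ⟦ b ⟧ ∣ ≤ δ → Near δ (c * ρ) ((c + fromℤ z) * ⟦ b ⟧)
    scale-near c b {ρ} {δ} 0≤c c≤1 z close = near (ℤ.- (z ℤ.* ⟦ b ⟧ℤ)) (begin
      ∣ c * ρ - (c + fromℤ z) * ⟦ b ⟧ - fromℤ (ℤ.- (z ℤ.* ⟦ b ⟧ℤ)) ∣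
        ≡⟨ cong (λ w → ∣ c * ρ - (c + fromℤ z) * ⟦ b ⟧ - w ∣) (trans (fromℤ-neg (z ℤ.* ⟦ b ⟧ℤ))
             (cong -_ (trans (fromℤ-* z ⟦ b ⟧ℤ) (cong (fromℤ z *_) (fromℤ⟦⟧ b))))) ⟩
      ∣ c * ρ - (c + fromℤ z) * ⟦ b ⟧ - - (fromℤ z * ⟦ b ⟧) ∣
        ≡⟨ cong ∣_∣ (solve 4 (λ c ρ z b → c :* ρ :- (c :+ z) :* b :- :- (z :* b) := c :* (ρ :- b)) refl c ρ (fromℤ z) ⟦ b ⟧) ⟩
      ∣ c * (ρ - ⟦ b ⟧) ∣
        ≡⟨ ∣p*q∣≡∣p∣*∣q∣ c (ρ - ⟦ b ⟧) ⟩
      ∣ c ∣ * ∣ ρ - ⟦ b ⟧ ∣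
        ≤⟨ *-mono (0≤∣p∣ c) (≤-trans (0≤∣p∣ (ρ - ⟦ b ⟧)) close) (≤-trans (≤-reflexive (0≤p⇒∣p∣≡p 0≤c)) c≤1) close ⟩
      1ℚ * δ
        ≡⟨ *-identityˡ δ ⟩
      δ ∎)

    -- The factors are approximated with parameter `P = Q ^ 2`, so that `Q` errors of size `2⁻ P`
    -- total at most `2⁻ suc Q`. Both the number of factors and the logarithm of the number of terms
    -- are then at most `Q * P ^ b = Q ^ (1 + 2 * b)`; exponent `3 + 2 * b` also makes room for
    -- `Q + 1`.
    Good-Approximated : ∀ {𝓒 𝓓 : Class {n}} {Q₀ a} b → 4 ℕ.≤ Q₀ → (∀ {h} → 𝓓 h → Approximated 𝓒 Q₀ b h) →
      Good 𝓒 Q₀ a → Good 𝓓 Q₀ ((3 ℕ.+ 2 ℕ.* b) ℕ.* a)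
    Good-Approximated {𝓒} {𝓓} {Q₀} {a} b 4≤Q₀ approx g = good go
      where
      go : ∀ Q → Q₀ ℕ.≤ Q → ∀ τ → length τ ℕ.≤ Q → All 𝓓 τ → ∀ c →
           Approximable (Q ℕ.^ ((3 ℕ.+ 2 ℕ.* b) ℕ.* a)) (2⁻ Q) (λ x → c * ⟦ product τ x ⟧)
      go Q Q₀≤Q τ τ≤Q τ∈ c = main (UnitComb-product τ (All.map (λ h∈ → approx h∈ P Q₀≤P) τ∈)) (integer-part c)
        where
        4≤Q = ℕ.≤-trans 4≤Q₀ Q₀≤Q
        open Powers Q 4≤Q
        P = Q ℕ.^ 2
        Q₀≤P : Q₀ ℕ.≤ P
        Q₀≤P = ℕ.≤-trans Q₀≤Q (≤^-mono 1 2 (ℕ.s≤s ℕ.z≤n) Q≤Q^1)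
        2Q+1≤P : Q ℕ.+ suc Q ℕ.≤ P
        2Q+1≤P = ℕ.≤-trans (ℕ.+-mono-≤ (ℕ.n≤1+n Q) (ℕ.≤-reflexive (sym (ℕ.+-identityʳ (suc Q))))) 2*[1+Q]≤Q^2
        E = length τ ℕ.* P ℕ.^ b
        E≤ : E ℕ.≤ Q ℕ.^ (1 ℕ.+ 2 ℕ.* b)
        E≤ = *-≤^ 1 (2 ℕ.* b) (ℕ.≤-trans τ≤Q Q≤Q^1) (ℕ.≤-reflexive (ℕ.^-*-assoc Q 2 b))
        t≤ : E ℕ.+ suc Q ℕ.≤ Q ℕ.^ (3 ℕ.+ 2 ℕ.* b)
        t≤ = +-≤^ (2 ℕ.+ 2 ℕ.* b) (≤^-mono (1 ℕ.+ 2 ℕ.* b) (2 ℕ.+ 2 ℕ.* b) (ℕ.n≤1+n _) E≤)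
               (≤^-mono 2 (2 ℕ.+ 2 ℕ.* b) (ℕ.m≤m+n 2 (2 ℕ.* b)) 1+Q≤Q^2)
        error≤ : fromℕ (length τ) * 2⁻ P ≤ 2⁻ suc Q
        error≤ = ≤-trans (*-monoˡ (fromℕ (length τ)) (0≤fromℕ (length τ)) (2⁻-antimono 2Q+1≤P))
                   (fromℕ*2⁻≤ Q (suc Q) (ℕ.≤-trans τ≤Q (n≤2^n Q)))
        main : UnitComb 𝓒 E E (fromℕ (length τ) * 2⁻ P) (product τ) → ∃[ z ] (0ℚ ≤ c - fromℤ z × c - fromℤ z ≤ 1ℚ) →
               Approximable (Q ℕ.^ ((3 ℕ.+ 2 ℕ.* b) ℕ.* a)) (2⁻ Q) (λ x → c * ⟦ product τ x ⟧)
        main (unitComb ρ _ _ ρ≈τ C) (z , 0≤c′ , c′≤1) =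
          Good-via-Comb g Q (3 ℕ.+ 2 ℕ.* b) E Q₀≤Q (ℕ.≤-trans (ℕ.s≤s ℕ.z≤n) 4≤Q) (ℕ.s≤s ℕ.z≤n)
            (Comb-mono (≤^-mono (1 ℕ.+ 2 ℕ.* b) (3 ℕ.+ 2 ℕ.* b) (ℕ.m≤n+m _ 2) E≤) ℕ.≤-refl (Comb-scale c′ C))
            ℕ.≤-refl t≤
            λ x → subst (λ d → Near (2⁻ suc Q) (c′ * ρ x) (d * ⟦ product τ x ⟧)) (sym c≡)
              (scale-near c′ (product τ x) 0≤c′ c′≤1 z (≤-trans (ρ≈τ x) error≤))
          where
          c′ = c - fromℤ z
          c≡ : c ≡ c′ + fromℤ z
          c≡ = solve 2 (λ c z → c := c :- z :+ z) refl c (fromℤ z)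

open Averaging

-- Disjunctions as powers of an average of parities

module Disjunctions where
  open import Data.Nat.Combinatorics using (_C_)
  open import Data.Rational.Base
  open import Data.Rational.Properties
  open ℚ-Solver.+-*-Solver using (solve; _:=_; _:+_; _:*_; :-_; _:-_; con)
  open ℚ-Lemmas
  open ≤-Reasoning
  bool-ext : ∀ {b c} → (b ≡ true → c ≡ true) → (c ≡ true → b ≡ true) → b ≡ c
  bool-ext {true}  {c}     f g = sym (f refl)
  bool-ext {false} {false} f g = refl
  bool-ext {false} {true}  f g = g refl

  ⟦not⟧ : ∀ b → ⟦ not b ⟧ ≡ 1ℚ - ⟦ b ⟧
  ⟦not⟧ true  = refl
  ⟦not⟧ false = refl

  module _ {n : ℕ} {𝓒 : Class {n}} where

    UnitComb-≗ : ∀ {E t δ g h} → (∀ x → h x ≡ g x) → UnitComb 𝓒 E t δ g → UnitComb 𝓒 E t δ h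
    UnitComb-≗ {δ = δ} h≡g (unitComb ρ 0≤ρ ρ≤1 close C) = unitComb ρ 0≤ρ ρ≤1
      (λ x → subst (λ b → ∣ ρ x - ⟦ b ⟧ ∣ ≤ δ) (sym (h≡g x)) (close x)) C

    UnitComb-mono : ∀ {E E′ t t′ δ h} → E ℕ.≤ E′ → t ℕ.≤ t′ → UnitComb 𝓒 E t δ h → UnitComb 𝓒 E′ t′ δ h
    UnitComb-mono E≤ t≤ (unitComb ρ 0≤ρ ρ≤1 close C) = unitComb ρ 0≤ρ ρ≤1 close (Comb-mono E≤ (ℕ.^-monoʳ-≤ 2 t≤) C)

    UnitComb-exact : ∀ {E t δ h} τ → 0ℚ ≤ δ → length τ ℕ.≤ E → All 𝓒 τ → (∀ x → h x ≡ product τ x) → UnitComb 𝓒 E t δ h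
    UnitComb-exact {t = t} {δ} {h} τ 0≤δ τ≤E τ∈ h≡ = unitComb (λ x → ⟦ h x ⟧) (0≤⟦⟧ ∘ h) (⟦⟧≤1 ∘ h)
      (λ x → subst (_≤ δ) (sym (cong ∣_∣ (+-inverseʳ ⟦ h x ⟧))) 0≤δ)
      (Comb-mono ℕ.≤-refl (ℕ.m^n>0 2 t) (Comb-≗ (λ x → trans (cong ⟦_⟧ (h≡ x)) (sym (*-identityˡ ⟦ product τ x ⟧))) (Comb-term 1ℚ τ τ≤E τ∈)))

    UnitComb-not : ∀ {E t δ h} → UnitComb 𝓒 E t δ h → UnitComb 𝓒 E (suc t) δ (not ∘ h)
    UnitComb-not {E} {t} {δ} {h} (unitComb ρ 0≤ρ ρ≤1 close C) = unitComb (λ x → 1ℚ - ρ x)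
      (λ x → subst (_≤ 1ℚ - ρ x) (+-inverseʳ (ρ x)) (+-monoˡ-≤ (- ρ x) (ρ≤1 x)))
      (λ x → subst (1ℚ - ρ x ≤_) (+-identityʳ 1ℚ) (+-monoʳ-≤ 1ℚ (neg-antimono-≤ (0≤ρ x))))
      (λ x → subst (_≤ δ) (sym (eq x)) (close x))
      (Comb-mono ℕ.≤-refl (ℕ.+-mono-≤ (ℕ.m^n>0 2 t) (ℕ.≤-reflexive (sym (ℕ.+-identityʳ (2 ℕ.^ t)))))
        (Comb-≗ (λ x → solve 1 (λ r → con 1ℚ :- r := con 1ℚ :* con 1ℚ :+ (con (- 1ℚ)) :* r) refl (ρ x))
          (Comb-+ (Comb-term 1ℚ [] ℕ.z≤n []) (Comb-scale (- 1ℚ) C))))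
      where
      eq : ∀ x → ∣ 1ℚ - ρ x - ⟦ not (h x) ⟧ ∣ ≡ ∣ ρ x - ⟦ h x ⟧ ∣
      eq x = begin-equality
        ∣ 1ℚ - ρ x - ⟦ not (h x) ⟧ ∣       ≡⟨ cong (λ b → ∣ 1ℚ - ρ x - b ∣) (⟦not⟧ (h x)) ⟩
        ∣ 1ℚ - ρ x - (1ℚ - ⟦ h x ⟧) ∣      ≡⟨ cong ∣_∣ (solve 2 (λ r b → con 1ℚ :- r :- (con 1ℚ :- b) := b :- r) refl (ρ x) ⟦ h x ⟧) ⟩
        ∣ ⟦ h x ⟧ - ρ x ∣                  ≡⟨ ∣p-q∣≡∣q-p∣ ⟦ h x ⟧ (ρ x) ⟩
        ∣ ρ x - ⟦ h x ⟧ ∣                  ∎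

  power : ℚ → ℕ → ℚ
  power v zero    = 1ℚ
  power v (suc k) = v * power v k

  misses≤ : ∀ {t r} (as : Vec (Vec Bool t) r) y → misses as y ℕ.≤ r
  misses≤ []       y = ℕ.z≤n
  misses≤ (a ∷ as) y = ℕ.+-mono-≤ (≤1 (not (a · y))) (misses≤ as y)
    where
    ≤1 : ∀ b → 1 ⟨ b ⟩ ℕ.≤ 1
    ≤1 true  = ℕ.≤-refl
    ≤1 false = ℕ.z≤n

  misses-zero : ∀ {t r} (as : Vec (Vec Bool t) r) y → nonzero y ≡ false → misses as y ≡ r
  misses-zero []       y y≡0 = refl
  misses-zero (a ∷ as) y y≡0 = cong₂ ℕ._+_ (cong (λ b → 1 ⟨ not b ⟩) (orthogonal a y y≡0)) (misses-zero as y y≡0)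
    where
    orthogonal : ∀ {t} (a y : Vec Bool t) → nonzero y ≡ false → a · y ≡ false
    orthogonal []       []          _   = refl
    orthogonal (a ∷ as) (false ∷ y) y≡0 = trans (cong (_xor (as · y)) (Bool.∧-zeroʳ a)) (orthogonal as y y≡0)

  4/5 : ℚ
  4/5 = ℤ.+ 4 / 5

  module _ {n t : ℕ} (𝓒 : Class {n}) (ys : Vec (Cube n → Bool) t)
           (parity∈ : ∀ a → 𝓒 (λ x → not (a · Vec.map (λ h → h x) ys)))
           {R : ℕ} (as : Vec (Vec Bool t) R) (weight : ∀ y → nonzero y ≡ true → fromℕ (misses as y) ≤ 4/5 * fromℕ R)
           {u : ℚ} (0≤u : 0ℚ ≤ u) (Ru≡1 : fromℕ R * u ≡ 1ℚ) where

    private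
      y : Cube n → Vec Bool t
      y x = Vec.map (λ h → h x) ys

      w : Cube n → ℚ
      w x = fromℕ (misses as (y x)) * u

      0≤w : ∀ x → 0ℚ ≤ w x
      0≤w x = subst (_≤ w x) (*-zeroˡ u) (*-monoʳ u 0≤u (0≤fromℕ (misses as (y x))))

      w≤1 : ∀ x → w x ≤ 1ℚ
      w≤1 x = ≤-trans (*-monoʳ u 0≤u (fromℕ-mono (misses≤ as (y x)))) (≤-reflexive Ru≡1)

      w≡1 : ∀ x → nonzero (y x) ≡ false → w x ≡ 1ℚ
      w≡1 x y≡0 = trans (cong (λ k → fromℕ k * u) (misses-zero as (y x) y≡0)) Ru≡1

      w≤4/5 : ∀ x → nonzero (y x) ≡ true → w x ≤ 4/5
      w≤4/5 x y≢0 = begin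
        fromℕ (misses as (y x)) * u       ≤⟨ *-monoʳ u 0≤u (weight (y x) y≢0) ⟩
        4/5 * fromℕ R * u                 ≡⟨ *-assoc 4/5 (fromℕ R) u ⟩
        4/5 * (fromℕ R * u)               ≡⟨ trans (cong (4/5 *_) Ru≡1) (*-identityʳ 4/5) ⟩
        4/5                               ∎

      w-Comb : Comb 𝓒 1 R w
      w-Comb = go as
        where
        go : ∀ {r} (as : Vec (Vec Bool t) r) → Comb 𝓒 1 r (λ x → fromℕ (misses as (y x)) * u)
        go []       = nil λ x → *-zeroˡ u
        go (a ∷ as) = cons u ((λ x → not (a · y x)) ∷ []) ℕ.≤-refl (parity∈ a ∷ []) (go as) λ x →
          trans (cong (_* u) (fromℕ-+ (1 ⟨ not (a · y x) ⟩) (misses as (y x))))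
            (trans (*-distribʳ-+ u (fromℕ (1 ⟨ not (a · y x) ⟩)) (fromℕ (misses as (y x))))
              (cong (_+ fromℕ (misses as (y x)) * u) (trans (*-comm (fromℕ (1 ⟨ not (a · y x) ⟩)) u) (cong (u *_) (bit (not (a · y x)))))))
          where
          bit : ∀ b → fromℕ (1 ⟨ b ⟩) ≡ ⟦ b ∧ true ⟧
          bit true  = refl
          bit false = refl

      -- The fourth power, because `(4/5)^4 = 256/625` is below 1/2: each factor `v` gains one bit
      -- of precision.
      v : Cube n → ℚ
      v x = w x * w x * (w x * w x)

      v≤½ : ∀ x → nonzero (y x) ≡ true → v x ≤ ½
      v≤½ x y≢0 = ≤-trans (*-mono 0≤w² 0≤[4/5]² w²≤ w²≤) (toWitness {a? = 4/5 * 4/5 * (4/5 * 4/5) ≤? ½} tt)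
        where
        0≤4/5 : 0ℚ ≤ 4/5
        0≤4/5 = toWitness {a? = 0ℚ ≤? 4/5} tt
        0≤[4/5]² : 0ℚ ≤ 4/5 * 4/5
        0≤[4/5]² = toWitness {a? = 0ℚ ≤? 4/5 * 4/5} tt
        0≤w² : 0ℚ ≤ w x * w x
        0≤w² = subst (_≤ w x * w x) (*-zeroʳ (w x)) (*-monoˡ (w x) (0≤w x) (0≤w x))
        w²≤ : w x * w x ≤ 4/5 * 4/5
        w²≤ = *-mono (0≤w x) 0≤4/5 (w≤4/5 x y≢0) (w≤4/5 x y≢0)

      v≡1 : ∀ x → nonzero (y x) ≡ false → v x ≡ 1ℚ
      v≡1 x y≡0 = cong (λ w → w * w * (w * w)) (w≡1 x y≡0)

      unit-* : ∀ {p q} → (0ℚ ≤ p × p ≤ 1ℚ) → (0ℚ ≤ q × q ≤ 1ℚ) → (0ℚ ≤ p * q × p * q ≤ 1ℚ)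
      unit-* {p} {q} (0≤p , p≤1) (0≤q , q≤1) = subst (_≤ p * q) (*-zeroʳ p) (*-monoˡ p 0≤p 0≤q) ,
        ≤-trans (*-mono 0≤p 0≤1 p≤1 q≤1) (≤-reflexive (*-identityˡ 1ℚ))

      v-unit : ∀ x → 0ℚ ≤ v x × v x ≤ 1ℚ
      v-unit x = unit-* (unit-* (0≤w x , w≤1 x) (0≤w x , w≤1 x)) (unit-* (0≤w x , w≤1 x) (0≤w x , w≤1 x))

      power-unit : ∀ k x → 0ℚ ≤ power (v x) k × power (v x) k ≤ 1ℚ
      power-unit zero    x = 0≤1 , ≤-refl
      power-unit (suc k) x = unit-* (v-unit x) (power-unit k x)

      power≤2⁻ : ∀ k x → nonzero (y x) ≡ true → power (v x) k ≤ 2⁻ k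
      power≤2⁻ zero    x y≢0 = ≤-refl
      power≤2⁻ (suc k) x y≢0 = *-mono (proj₁ (v-unit x)) (<⇒≤ (0<2⁻ k)) (v≤½ x y≢0) (power≤2⁻ k x y≢0)

      power≡1 : ∀ k x → nonzero (y x) ≡ false → power (v x) k ≡ 1ℚ
      power≡1 zero    x y≡0 = refl
      power≡1 (suc k) x y≡0 = trans (cong₂ _*_ (v≡1 x y≡0) (power≡1 k x y≡0)) (*-identityˡ 1ℚ)

      power-Comb : ∀ k → Comb 𝓒 (k ℕ.* 4) ((R ℕ.* R ℕ.* (R ℕ.* R)) ℕ.^ k) (λ x → power (v x) k)
      power-Comb zero    = Comb-term 1ℚ [] ℕ.z≤n []
      power-Comb (suc k) = Comb-* (Comb-* (Comb-* w-Comb w-Comb) (Comb-* w-Comb w-Comb)) (power-Comb k)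

    -- The error is one-sided: at the zero vector every parity vanishes and the value is exactly 1;
    -- elsewhere it lies between 0 and `2⁻ k`.
    UnitComb-nor : ∀ {E s} k → k ℕ.* 4 ℕ.≤ E → (R ℕ.* R ℕ.* (R ℕ.* R)) ℕ.^ k ℕ.≤ 2 ℕ.^ s →
      UnitComb 𝓒 E s (2⁻ k) (λ x → not (nonzero (Vec.map (λ h → h x) ys)))
    UnitComb-nor k E≤ s≤ = unitComb (λ x → power (v x) k) (proj₁ ∘ power-unit k) (proj₂ ∘ power-unit k) close
      (Comb-mono E≤ s≤ (power-Comb k))
      where
      close-by : ∀ x b → nonzero (y x) ≡ b → ∣ power (v x) k - ⟦ not b ⟧ ∣ ≤ 2⁻ k
      close-by x true  eq = ≤-trans (≤-reflexive (trans (cong ∣_∣ (+-identityʳ (power (v x) k))) (0≤p⇒∣p∣≡p (proj₁ (power-unit k x))))) (power≤2⁻ k x eq)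
      close-by x false eq = ≤-trans (≤-reflexive (cong ∣_∣ (trans (cong (_- 1ℚ) (power≡1 k x eq)) (+-inverseʳ 1ℚ)))) (<⇒≤ (0<2⁻ k))
      close : ∀ x → ∣ power (v x) k - ⟦ not (nonzero (y x)) ⟧ ∣ ≤ 2⁻ k
      close x = close-by x (nonzero (y x)) refl

open Disjunctions

-- Gates in terms of residues of their inputs

module GateApproximation where
  open import Data.Nat.Combinatorics using (_C_)
  open import Data.Rational.Base using (ℚ; 1ℚ) renaming (_≤_ to _≤ℚ_; _*_ to _*ℚ_)
  open ℚ-Lemmas
  open ℤ-Solver.+-*-Solver using () renaming
    (solve to solveℤ; _:=_ to _≔_; _:+_ to _⊕_; _:*_ to _⊗_; con to conℤ)

  module _ {n t : ℕ} (𝓒 : Class {n}) (ys : Vec (Cube n → Bool) t)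
           (parity∈ : ∀ a → 𝓒 (λ x → not (a · Vec.map (λ h → h x) ys))) where

    -- The code has length `R = 5 * (t + 1) ≤ 2 ^ (3 + Q)`. The `Q`-th power of `v` has `4 * Q`
    -- factors in each term and `R ^ (4 * Q)` terms, and `4 * (3 + Q) * Q ≤ Q ^ 4`.
    UnitComb-nor-code : ∀ Q → 4 ℕ.≤ Q → suc t ℕ.≤ 2 ℕ.^ Q →
      UnitComb 𝓒 (Q ℕ.^ 4) (Q ℕ.^ 4) (2⁻ Q) (λ x → not (nonzero (Vec.map (λ h → h x) ys)))
    UnitComb-nor-code Q 4≤Q t≤ = go (proj₁ (code t)) refl (proj₂ (code t))
      where
      open Powers Q 4≤Q
      open ℕ.≤-Reasoning
      s = 3 ℕ.+ Q
      s≤Q^2 : s ℕ.≤ Q ℕ.^ 2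
      s≤Q^2 = begin
        3 ℕ.+ Q        ≤⟨ ℕ.+-monoˡ-≤ Q (ℕ.≤-trans (ℕ.n≤1+n 3) 4≤Q) ⟩
        Q ℕ.+ Q        ≤⟨ +-≤^ 1 Q≤Q^1 Q≤Q^1 ⟩
        Q ℕ.^ 2        ∎
      4s≤Q^3 : s ℕ.+ s ℕ.+ (s ℕ.+ s) ℕ.≤ Q ℕ.^ 3
      4s≤Q^3 = begin
        s ℕ.+ s ℕ.+ (s ℕ.+ s)                   ≡⟨ ℕ.+-assoc s s (s ℕ.+ s) ⟩
        s ℕ.+ (s ℕ.+ (s ℕ.+ s))                 ≡⟨ cong (λ z → s ℕ.+ (s ℕ.+ (s ℕ.+ z))) (ℕ.+-identityʳ s) ⟨
        4 ℕ.* s                                 ≤⟨ *-≤^ 1 2 (ℕ.≤-trans 4≤Q Q≤Q^1) s≤Q^2 ⟩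
        Q ℕ.^ 3                                 ∎
      5*≤ : 5 ℕ.* suc t ℕ.≤ 2 ℕ.^ s
      5*≤ = begin
        5 ℕ.* suc t          ≤⟨ ℕ.*-mono-≤ {5} {8} (ℕ.m≤m+n 5 3) t≤ ⟩
        2 ℕ.^ 3 ℕ.* 2 ℕ.^ Q  ≡⟨ ℕ.^-distribˡ-+-* 2 3 Q ⟨
        2 ℕ.^ s              ∎
      go : ∀ {R} (as : Vec (Vec Bool t) R) → R ≡ 5 ℕ.* suc t → (∀ y → nonzero y ≡ true → misses as y ℕ.≤ 4 ℕ.* suc t) →
           UnitComb 𝓒 (Q ℕ.^ 4) (Q ℕ.^ 4) (2⁻ Q) (λ x → not (nonzero (Vec.map (λ h → h x) ys)))
      go {R} as R≡ weight = UnitComb-nor 𝓒 ys parity∈ as weight′ (ℚ.<⇒≤ (proj₁ (proj₂ inv))) (proj₂ (proj₂ inv)) Q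
        (≤^-mono 2 4 (ℕ.m≤m+n 2 2) (*-≤^ 1 1 Q≤Q^1 (ℕ.≤-trans 4≤Q Q≤Q^1)))
        (begin
          (R ℕ.* R ℕ.* (R ℕ.* R)) ℕ.^ Q             ≤⟨ ℕ.^-monoˡ-≤ Q (ℕ.*-mono-≤ (ℕ.*-mono-≤ R≤ R≤) (ℕ.*-mono-≤ R≤ R≤)) ⟩
          (2^s ℕ.* 2^s ℕ.* (2^s ℕ.* 2^s)) ℕ.^ Q     ≡⟨ cong (λ z → (z ℕ.* z) ℕ.^ Q) (ℕ.^-distribˡ-+-* 2 s s) ⟨
          (2 ℕ.^ (s ℕ.+ s) ℕ.* 2 ℕ.^ (s ℕ.+ s)) ℕ.^ Q ≡⟨ cong (ℕ._^ Q) (ℕ.^-distribˡ-+-* 2 (s ℕ.+ s) (s ℕ.+ s)) ⟨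
          (2 ℕ.^ (s ℕ.+ s ℕ.+ (s ℕ.+ s))) ℕ.^ Q     ≡⟨ ℕ.^-*-assoc 2 (s ℕ.+ s ℕ.+ (s ℕ.+ s)) Q ⟩
          2 ℕ.^ ((s ℕ.+ s ℕ.+ (s ℕ.+ s)) ℕ.* Q)     ≤⟨ ℕ.^-monoʳ-≤ 2 (*-≤^ 3 1 4s≤Q^3 Q≤Q^1) ⟩
          2 ℕ.^ (Q ℕ.^ 4)                           ∎)
        where
        2^s = 2 ℕ.^ s
        R≤ : R ℕ.≤ 2 ℕ.^ s
        R≤ = ℕ.≤-trans (ℕ.≤-reflexive R≡) 5*≤
        1≤R : 1 ℕ.≤ R
        1≤R = subst (1 ℕ.≤_) (sym R≡) (ℕ.s≤s ℕ.z≤n)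
        inv = 1/-pos (ℚ.<-≤-trans (ℚ.positive⁻¹ 1ℚ) (fromℕ-mono {1} {R} 1≤R))
        4/5*R : fromℕ (4 ℕ.* suc t) ≡ 4/5 *ℚ fromℕ R
        4/5*R = trans (fromℕ-* 4 (suc t)) (trans (cong (_*ℚ fromℕ (suc t)) {x = fromℕ 4} {y = 4/5 *ℚ fromℕ 5} refl)
          (trans (ℚ.*-assoc 4/5 (fromℕ 5) (fromℕ (suc t))) (cong (4/5 *ℚ_) (trans (sym (fromℕ-* 5 (suc t))) (cong fromℕ (sym R≡))))))
        weight′ : ∀ y → nonzero y ≡ true → fromℕ (misses as y) ≤ℚ 4/5 *ℚ fromℕ R
        weight′ y y≢0 = ℚ.≤-trans (fromℕ-mono (weight y y≢0)) (ℚ.≤-reflexive 4/5*R)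

  ∨-true : ∀ {a b} → a ≡ true ⊎ b ≡ true → a ∨ b ≡ true
  ∨-true (inj₁ refl)           = refl
  ∨-true {a = a} (inj₂ refl)   = Bool.∨-zeroʳ a

  true-∨ : ∀ {a b} → a ∨ b ≡ true → a ≡ true ⊎ b ≡ true
  true-∨ {true}  _ = inj₁ refl
  true-∨ {false} h = inj₂ h

  ∧-true : ∀ {a b} → a ≡ true → b ≡ true → a ∧ b ≡ true
  ∧-true refl refl = refl

  true-∧ : ∀ {a b} → a ∧ b ≡ true → a ≡ true × b ≡ true
  true-∧ {true} {true} _ = refl , refl

  module _ {N : ℕ} where

    -- For AND and OR the input list is replaced by a vector over all `N` wires, which collapses
    -- repetitions and makes the code length depend on `N` alone. MOD gates count repetitions and
    -- use `total` instead.
    occurs : List (Fin N) → Fin N → Bool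
    occurs ws i = any (λ w → ⌊ w Fin.≟ i ⌋) ws

    true-any : ∀ v ws → any v ws ≡ true → ∃[ i ] (occurs ws i ≡ true × v i ≡ true)
    true-any v (w ∷ ws) h with true-∨ {v w} h
    ... | inj₁ vw = w , ∨-true (inj₁ w≟w) , vw
      where
      w≟w : ⌊ w Fin.≟ w ⌋ ≡ true
      w≟w with w Fin.≟ w
      ... | yes _   = refl
      ... | no  w≢w = ⊥-elim (w≢w refl)
    ... | inj₂ h′ with true-any v ws h′
    ...   | i , i∈ , vi = i , ∨-true {⌊ w Fin.≟ i ⌋} (inj₂ i∈) , vi

    any-true : ∀ v ws i → occurs ws i ≡ true → v i ≡ true → any v ws ≡ true
    any-true v (w ∷ ws) i i∈ vi with w Fin.≟ i
    ... | yes refl = ∨-true (inj₁ vi)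
    ... | no  _    = ∨-true {v w} (inj₂ (any-true v ws i i∈ vi))

    all≡not-any-not : ∀ (v : Fin N → Bool) ws → all v ws ≡ not (any (not ∘ v) ws)
    all≡not-any-not v []       = refl
    all≡not-any-not v (w ∷ ws) with v w
    ... | true  = all≡not-any-not v ws
    ... | false = refl

  true-nonzero : ∀ {N} (f : Fin N → Bool) → nonzero (Vec.tabulate f) ≡ true → ∃[ i ] f i ≡ true
  true-nonzero {suc N} f h with f zero in eq
  ... | true  = zero , eq
  ... | false with true-nonzero (f ∘ suc) h
  ...   | i , fi = suc i , fi

  nonzero-true : ∀ {N} (f : Fin N → Bool) i → f i ≡ true → nonzero (Vec.tabulate f) ≡ true
  nonzero-true f zero    fi with f zero
  ... | true = refl
  nonzero-true f (suc i) fi with f zero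
  ... | true  = refl
  ... | false = nonzero-true (f ∘ suc) i fi

  any≡nonzero : ∀ {N} v (ws : List (Fin N)) → any v ws ≡ nonzero (Vec.tabulate λ i → occurs ws i ∧ v i)
  any≡nonzero v ws = bool-ext
    (λ h → let i , i∈ , vi = true-any v ws h in nonzero-true _ i (∧-true i∈ vi))
    (λ h → let i , hi = true-nonzero _ h ; i∈ , vi = true-∧ {occurs ws i} hi in any-true v ws i i∈ vi)

  module _ {n N : ℕ} {H : Fin N → Cube n → Bool} where

    private
      Parity = Residue {H = H} 2 1

    Member⇒Residue : ∀ {h} p → Member H h → Residue {H = H} p 1 h
    Member⇒Residue {h} p h∈ = residue (λ x → ⟦ h x ⟧ℤ) (Form-member h∈) λ x →
      ℤ.0ℤ , sym (ℤ.+-identityʳ ⟦ h x ⟧ℤ)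

    Parity-false : Parity (λ _ → false)
    Parity-false = residue (λ _ → ℤ.0ℤ) (const ℤ.0ℤ λ _ → refl) λ _ → ℤ.0ℤ , refl

    -- `a + b = (a xor b) + 2 (a ∧ b)`: modulo 2, xor is addition, so linear functionals of the
    -- wires stay at degree 1.
    Parity-xor : ∀ {g h} → Parity g → Parity h → Parity (λ x → g x xor h x)
    Parity-xor {g} {h} (residue F f c) (residue G f′ d) = residue (λ x → F x ℤ.+ G x) (Form-+ f f′) λ x →
      let k , eq = Congruent-+ {ℤ.+ 2} {b = ⟦ g x ⟧ℤ} {d = ⟦ h x ⟧ℤ} (c x) (d x) in
      ⟦ g x ∧ h x ⟧ℤ ℤ.+ k , trans eq (trans (cong (ℤ._+ k ℤ.* ℤ.+ 2) (xor≡ (g x) (h x)))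
        (solveℤ 3 (λ a b k → a ⊕ b ⊗ conℤ (ℤ.+ 2) ⊕ k ⊗ conℤ (ℤ.+ 2) ≔ a ⊕ (b ⊕ k) ⊗ conℤ (ℤ.+ 2)) refl ⟦ g x xor h x ⟧ℤ ⟦ g x ∧ h x ⟧ℤ k))
      where
      xor≡ : ∀ a b → ⟦ a ⟧ℤ ℤ.+ ⟦ b ⟧ℤ ≡ ⟦ a xor b ⟧ℤ ℤ.+ ⟦ a ∧ b ⟧ℤ ℤ.* ℤ.+ 2
      xor≡ true  true  = refl
      xor≡ true  false = refl
      xor≡ false true  = refl
      xor≡ false false = refl

    Parity-not : ∀ {h} → Parity h → Parity (λ x → not (h x))
    Parity-not = Parity-xor {λ _ → true} (residue (λ _ → ℤ.1ℤ) (const ℤ.1ℤ λ _ → refl) λ _ → ℤ.0ℤ , refl)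

    Parity-guard : ∀ {h} b → Parity h → Parity (λ x → b ∧ h x)
    Parity-guard true  h∈ = h∈
    Parity-guard false h∈ = Parity-false

    Parity-dot : ∀ {t} (a : Vec Bool t) (ys : Vec (Cube n → Bool) t) → (∀ i → Parity (Vec.lookup ys i)) →
      Parity (λ x → a · Vec.map (λ h → h x) ys)
    Parity-dot []      []       _  = Parity-false
    Parity-dot (a ∷ as) (y ∷ ys) y∈ = Parity-xor (Parity-guard a (y∈ zero)) (Parity-dot as ys (y∈ ∘ suc))

    total : List (Fin N) → Cube n → ℕ
    total ws x = sum (map (λ w → if H w x then 1 else 0) ws)

    -- Pascal's rule at the leading wire: its value multiplies a binomial coefficient with smaller
    -- lower index. The degree is therefore bounded by `k`, regardless of the length of `ws`.
    Form-C : ∀ ws r k → Form H k (λ x → ℤ.+ ((total ws x ℕ.+ r) C k))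
    Form-C []       r k       = const (ℤ.+ (r C k)) λ _ → refl
    Form-C (w ∷ ws) r zero    = const ℤ.1ℤ λ x → cong ℤ.+_ (nC0≡1 (total (w ∷ ws) x ℕ.+ r))
    Form-C (w ∷ ws) r (suc k) = Form-≗ eq (Form-+ (Form-C ws r (suc k)) (Form-* (Form-member (w , λ _ → refl)) (Form-C ws r k)))
      where
      eq : ∀ x → ℤ.+ ((total (w ∷ ws) x ℕ.+ r) C suc k) ≡
                 ℤ.+ ((total ws x ℕ.+ r) C suc k) ℤ.+ ⟦ H w x ⟧ℤ ℤ.* ℤ.+ ((total ws x ℕ.+ r) C k)
      eq x with H w x
      ... | true  = trans (cong ℤ.+_ (trans (pascal (total ws x ℕ.+ r) k) (ℕ.+-comm ((total ws x ℕ.+ r) C k) _)))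
                      (trans (ℤ.pos-+ ((total ws x ℕ.+ r) C suc k) ((total ws x ℕ.+ r) C k)) (cong (ℤ._+_ (ℤ.+ ((total ws x ℕ.+ r) C suc k))) (sym (ℤ.*-identityˡ (ℤ.+ ((total ws x ℕ.+ r) C k))))))
      ... | false = sym (ℤ.+-identityʳ (ℤ.+ ((total ws x ℕ.+ r) C suc k)))

    Residue-∣ : ∀ {p} (pp : Prime p) e ws → Residue {H = H} p (p ℕ.^ e) (λ x → ⌊ p ℕ.^ e ∣? total ws x ⌋)
    Residue-∣ {p} pp e ws with p ℕ.^ e in q≡ | ℕ.m^n>0 p {{prime⇒nonZero pp}} e
    ... | suc r | _ = residue (λ x → ℤ.+ ((total ws x ℕ.+ r) C r)) (Form-mono (ℕ.n≤1+n r) (Form-C ws r r)) cong-x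
      where
      open PrimePower pp e r q≡
      cong-x : ∀ x → Congruent (ℤ.+ p) (ℤ.+ ((total ws x ℕ.+ r) C r)) ⟦ ⌊ suc r ∣? total ws x ⌋ ⟧ℤ
      cong-x x with suc r ∣? total ws x
      ... | yes q∣ = let j , eq = q∣w⇒C≡1 (total ws x) q∣ in
        ℤ.+ j , trans (cong ℤ.+_ eq) (trans (ℤ.pos-+ 1 (p ℕ.* j)) (cong (ℤ._+_ ℤ.1ℤ) (trans (cong ℤ.+_ (ℕ.*-comm p j)) (ℤ.pos-* j p))))
      ... | no q∤ with q∤w⇒p∣C (total ws x) q∤
      ...   | divides j eq = ℤ.+ j , trans (cong ℤ.+_ eq) (trans (ℤ.pos-* j p) (sym (ℤ.+-identityˡ (ℤ.+ j ℤ.* ℤ.+ p))))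

    -- Primes are stacked because amplification works modulo powers of a single prime. Eliminating
    -- the top one leads back to the class below it, at the cost of a factor 8 in the exponent.
    Residues : ℕ → List ℕ → Class
    Residues e []       = Member H
    Residues e (p ∷ ps) = Residues e ps ∪ Residue {H = H} p e

    Residues-∈ : ∀ {e p ps h} → p ∈ˡ ps → Residue {H = H} p e h → Residues e ps h
    Residues-∈ (here refl) r = inj₂ r
    Residues-∈ (there p∈)  r = inj₁ (Residues-∈ p∈ r)

    Residues-Member : ∀ {e} ps {h} → Member H h → Residues e ps h
    Residues-Member []       h∈ = h∈
    Residues-Member (p ∷ ps) h∈ = inj₁ (Residues-Member ps h∈)

    Good-Residues : ∀ {e Q₀ a} ps → All (2 ℕ.≤_) ps → 4 ℕ.≤ Q₀ → e ℕ.≤ Q₀ → suc N ℕ.≤ 2 ℕ.^ Q₀ →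
      Good (Member H) Q₀ a → Good (Residues e ps) Q₀ (8 ℕ.^ length ps ℕ.* a)
    Good-Residues {a = a} [] [] 4≤ e≤ N≤ g = subst (Good (Member H) _) (sym (ℕ.+-identityʳ a)) g
    Good-Residues {a = a} (p ∷ ps) (2≤p ∷ 2≤ps) 4≤ e≤ N≤ g = subst (Good (Residues _ (p ∷ ps)) _) (sym (ℕ.*-assoc 8 (8 ℕ.^ length ps) a))
      (Good-Residue 2≤p 4≤ e≤ N≤ (Good-⊆ [ id , Residues-Member ps ]′ (Good-Residues ps 2≤ps 4≤ e≤ N≤ g)))

  primes : ∀ {m} → PrimePowers m → List ℕ
  primes one               = []
  primes (cons {p} _ _ _ F) = p ∷ primes F

  primes-prime : ∀ {m} (F : PrimePowers m) → All Prime (primes F)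
  primes-prime one              = []
  primes-prime (cons pp _ _ F)  = pp ∷ primes-prime F

  PrimePowers-pos : ∀ {m} → PrimePowers m → 1 ℕ.≤ m
  PrimePowers-pos one                = ℕ.≤-refl
  PrimePowers-pos (cons {p} pp e _ F) = ℕ.*-mono-≤ (ℕ.m^n>0 p {{prime⇒nonZero pp}} e) (PrimePowers-pos F)

  ⌊*∣?⌋ : ∀ {a b} w → Coprimality.Coprime a b → ⌊ a ℕ.* b ∣? w ⌋ ≡ ⌊ a ∣? w ⌋ ∧ ⌊ b ∣? w ⌋
  ⌊*∣?⌋ {a} {b} w cop with a ℕ.* b ∣? w | a ∣? w | b ∣? w
  ... | yes _   | yes _  | yes _  = refl
  ... | yes ab∣ | no a∤  | _      = ⊥-elim (a∤ (∣-trans (m∣m*n b) ab∣))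
  ... | yes ab∣ | yes _  | no b∤  = ⊥-elim (b∤ (∣-trans (n∣m*n a) ab∣))
  ... | no ab∤  | yes a∣ | yes b∣ = ⊥-elim (ab∤ (coprime-∣* cop a∣ b∣))
  ... | no _    | no _   | _      = refl
  ... | no _    | yes _  | no _   = refl

  module _ {n N : ℕ} {H : Fin N → Cube n → Bool} where

    -- One divisibility test for each prime power of `m`. Each power is at most `m ≤ e`, so `e`
    -- serves as a common degree bound for all of them.
    divisibility-factors : ∀ {m} (F : PrimePowers m) ws {e ps} → m ℕ.≤ e → (∀ {p} → p ∈ˡ primes F → p ∈ˡ ps) →
      ∃[ τ ] (length τ ≡ length (primes F) × All (Residues {H = H} e ps) τ × (∀ x → ⌊ m ∣? total {H = H} ws x ⌋ ≡ product τ x))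
    divisibility-factors one ws m≤e sub = [] , refl , [] , λ x → 1∣ (total {H = H} ws x)
      where
      1∣ : ∀ w → ⌊ 1 ∣? w ⌋ ≡ true
      1∣ w with 1 ∣? w
      ... | yes _  = refl
      ... | no 1∤w = ⊥-elim (1∤w (divides w (sym (ℕ.*-identityʳ w))))
    divisibility-factors (cons {p} pp e {m} cop F) ws pm≤e sub with divisibility-factors F ws
        (ℕ.≤-trans (ℕ.m≤n*m m (p ℕ.^ e) {{ℕ.m^n≢0 p e {{prime⇒nonZero pp}}}}) pm≤e) (sub ∘ there)
    ... | τ , τ-length , τ∈ , eq = _ ∷ τ , cong suc τ-length ,
      Residues-∈ (sub (here refl)) (Residue-mono (ℕ.≤-trans (ℕ.m≤m*n (p ℕ.^ e) m {{ℕ.>-nonZero (PrimePowers-pos F)}}) pm≤e) (Residue-∣ pp e ws)) ∷ τ∈ ,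
      λ x → trans (⌊*∣?⌋ (total {H = H} ws x) cop) (cong (⌊ p ℕ.^ e ∣? total {H = H} ws x ⌋ ∧_) (eq x))

    module _ {m : ℕ} (F : PrimePowers m) {Q₀ : ℕ} (4≤Q₀ : 4 ℕ.≤ Q₀) (N≤ : suc N ℕ.≤ 2 ℕ.^ Q₀) (ps≤ : length (primes F) ℕ.≤ Q₀) where

      private
        -- The prime 2 joins those of the modulus because AND and OR gates are treated through
        -- parities.
        𝓒 : Class
        𝓒 = Residues {H = H} m (2 ∷ primes F)

      parity∈ : ∀ {h} → Residue {H = H} 2 1 h → 𝓒 h
      parity∈ r = inj₂ (Residue-mono (PrimePowers-pos F) r)

      module _ (Q : ℕ) (Q₀≤Q : Q₀ ℕ.≤ Q) where

        private
          4≤Q = ℕ.≤-trans 4≤Q₀ Q₀≤Q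
          0≤2⁻Q = ℚ.<⇒≤ (0<2⁻ Q)
        open Powers Q 4≤Q

        UnitComb-literals : ∀ (l : Fin N → Cube n → Bool) ws → (∀ i → Residue {H = H} 2 1 (l i)) →
          UnitComb 𝓒 (Q ℕ.^ 4) (Q ℕ.^ 4) (2⁻ Q) (λ x → not (any (λ i → l i x) ws))
        UnitComb-literals l ws l∈ = UnitComb-≗ eq (UnitComb-nor-code 𝓒 ys (λ a → parity∈ (Parity-not (Parity-dot a ys ys∈)))
            Q 4≤Q (ℕ.≤-trans N≤ (ℕ.^-monoʳ-≤ 2 Q₀≤Q)))
          where
          ys : Vec (Cube n → Bool) N
          ys = Vec.tabulate λ i x → occurs ws i ∧ l i x
          ys∈ : ∀ i → Residue {H = H} 2 1 (Vec.lookup ys i)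
          ys∈ i = subst (Residue {H = H} 2 1) (sym (Vec.lookup∘tabulate (λ i x → occurs ws i ∧ l i x) i)) (Parity-guard (occurs ws i) (l∈ i))
          eq : ∀ x → not (any (λ i → l i x) ws) ≡ not (nonzero (Vec.map (λ h → h x) ys))
          eq x = cong not (trans (any≡nonzero (λ i → l i x) ws) (cong nonzero (Vec.tabulate-∘ (λ h → h x) (λ i x → occurs ws i ∧ l i x))))

        -- AND is a nor of negated wires, OR the complement of a nor, and MOD the complement of an
        -- exact product of divisibility tests. Complementing adds one term, which exponent 5 in
        -- place of 4 absorbs.
        UnitComb-gate : ∀ (g : Gate m (Fin N)) → UnitComb 𝓒 (Q ℕ.^ 5) (Q ℕ.^ 5) (2⁻ Q) (λ x → evalGate (λ w → H w x) g)
        UnitComb-gate (AND ws) = UnitComb-≗ (λ x → all≡not-any-not (λ w → H w x) ws)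
          (UnitComb-mono Q^4≤Q^5 Q^4≤Q^5 (UnitComb-literals (λ w x → not (H w x)) ws λ i → Parity-not (Member⇒Residue 2 (i , λ _ → refl))))
          where
          Q^4≤Q^5 = ≤^-mono 4 5 (ℕ.n≤1+n 4) ℕ.≤-refl
        UnitComb-gate (OR ws) = UnitComb-≗ (λ x → sym (Bool.not-involutive (any (λ w → H w x) ws)))
          (UnitComb-mono (≤^-mono 4 5 (ℕ.n≤1+n 4) ℕ.≤-refl) (+-≤^ 4 (ℕ.m^n>0 Q 4) ℕ.≤-refl)
            (UnitComb-not (UnitComb-literals H ws λ i → Member⇒Residue 2 (i , λ _ → refl))))
        UnitComb-gate (NOT w) = UnitComb-mono {E = 1} {t = 1} (ℕ.m^n>0 Q 5) (ℕ.m^n>0 Q 5) (UnitComb-not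
          (UnitComb-exact (H w ∷ []) 0≤2⁻Q ℕ.≤-refl (Residues-Member (2 ∷ primes F) (w , λ _ → refl) ∷ []) λ x → sym (Bool.∧-identityʳ (H w x))))
        UnitComb-gate (MOD ws) with divisibility-factors F ws {ps = 2 ∷ primes F} ℕ.≤-refl there
        ... | τ , τ-length , τ∈ , eq = UnitComb-mono {E = Q} {t = 1} (≤^-mono 1 5 (ℕ.s≤s ℕ.z≤n) Q≤Q^1) (ℕ.m^n>0 Q 5)
          (UnitComb-not (UnitComb-exact τ 0≤2⁻Q (ℕ.≤-trans (ℕ.≤-reflexive τ-length) (ℕ.≤-trans ps≤ Q₀≤Q)) τ∈ eq))

open GateApproximation

-- Induction on the depth of the wires of a circuit

module Levels where
  open import Data.Rational.Base using (ℚ; 0ℚ; ½; _*_; _-_; ∣_∣)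
  open ℚ-Lemmas

  module _ {m : ℕ} where

    mapGate : ∀ {V W : Set} → (V → W) → Gate m V → Gate m W
    mapGate f (AND ws) = AND (map f ws)
    mapGate f (OR ws)  = OR (map f ws)
    mapGate f (MOD ws) = MOD (map f ws)
    mapGate f (NOT w)  = NOT (f w)

    evalGate-map : ∀ {V W : Set} (f : V → W) v g → evalGate v (mapGate f g) ≡ evalGate (v ∘ f) g
    evalGate-map f v (AND ws) = cong and (sym (List.map-∘ ws))
    evalGate-map f v (OR ws)  = cong or (sym (List.map-∘ ws))
    evalGate-map f v (MOD ws) = cong (λ bs → not ⌊ m ∣? sum bs ⌋) (sym (List.map-∘ ws))
    evalGate-map f v (NOT w)  = refl

    gateDepth-map : ∀ {V W : Set} (f : V → W) d g → gateDepth d (mapGate f g) ≡ gateDepth (d ∘ f) g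
    gateDepth-map f d (AND ws) = cong (λ ds → suc (foldr ℕ._⊔_ 0 ds)) (sym (List.map-∘ ws))
    gateDepth-map f d (OR ws)  = cong (λ ds → suc (foldr ℕ._⊔_ 0 ds)) (sym (List.map-∘ ws))
    gateDepth-map f d (MOD ws) = cong (λ ds → suc (foldr ℕ._⊔_ 0 ds)) (sym (List.map-∘ ws))
    gateDepth-map f d (NOT w)  = refl

    map-cong-≤ : ∀ {W A : Set} {d : W → ℕ} {u v : W → A} {ℓ} ws → foldr ℕ._⊔_ 0 (map d ws) ℕ.≤ ℓ →
      (∀ w → d w ℕ.≤ ℓ → u w ≡ v w) → map u ws ≡ map v ws
    map-cong-≤ []       _   h = refl
    map-cong-≤ {d = d} (w ∷ ws) d≤ h = cong₂ _∷_ (h w (ℕ.m⊔n≤o⇒m≤o (d w) _ d≤)) (map-cong-≤ ws (ℕ.m⊔n≤o⇒n≤o (d w) _ d≤) h)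

    evalGate-cong : ∀ {W : Set} {d : W → ℕ} {u v ℓ} g → gateDepth d g ℕ.≤ suc ℓ →
      (∀ w → d w ℕ.≤ ℓ → u w ≡ v w) → evalGate u g ≡ evalGate v g
    evalGate-cong (AND ws) (ℕ.s≤s d≤) h = cong and (map-cong-≤ ws d≤ h)
    evalGate-cong (OR ws)  (ℕ.s≤s d≤) h = cong or (map-cong-≤ ws d≤ h)
    evalGate-cong (MOD ws) (ℕ.s≤s d≤) h = cong (λ bs → not ⌊ m ∣? sum bs ⌋)
      (map-cong-≤ ws d≤ λ w dw → cong (λ b → if b then 1 else 0) (h w dw))
    evalGate-cong (NOT w)  (ℕ.s≤s d≤) h = cong not (h w d≤)

    gateDepth≥1 : ∀ {W : Set} {d : W → ℕ} (g : Gate m W) → 1 ℕ.≤ gateDepth d g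
    gateDepth≥1 (AND ws) = ℕ.s≤s ℕ.z≤n
    gateDepth≥1 (OR ws)  = ℕ.s≤s ℕ.z≤n
    gateDepth≥1 (MOD ws) = ℕ.s≤s ℕ.z≤n
    gateDepth≥1 (NOT w)  = ℕ.s≤s ℕ.z≤n

    module _ {n : ℕ} where

      wireValue : ∀ {s} → Gates m n s → Cube n → Fin n ⊎ Fin s → Bool
      wireValue gs x = [ lookup x , lookup (evalGates x gs) ]′

      wireDepth : ∀ {s} → Gates m n s → Fin n ⊎ Fin s → ℕ
      wireDepth gs = [ (λ _ → 0) , lookup (gateDepths gs) ]′

      -- A gate only sees the gates introduced before it. Its wires are shifted into the full
      -- sequence so that all gates read from one index set.
      gateAt : ∀ {s} (gs : Gates m n s) i → Σ[ g ∈ Gate m (Fin n ⊎ Fin s) ]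
        ((∀ x → lookup (evalGates x gs) i ≡ evalGate (wireValue gs x) g) × lookup (gateDepths gs) i ≡ gateDepth (wireDepth gs) g)
      gateAt (gs ▷ g) i with weakened i
        where
        value-suc : ∀ x w → wireValue (gs ▷ g) x (map₂ suc w) ≡ wireValue gs x w
        value-suc x (inj₁ _) = refl
        value-suc x (inj₂ _) = refl
        depth-suc : ∀ w → wireDepth (gs ▷ g) (map₂ suc w) ≡ wireDepth gs w
        depth-suc (inj₁ _) = refl
        depth-suc (inj₂ _) = refl
        -- The constant depth function 0 makes every wire count as shallow in `evalGate-cong`, so
        -- agreement is used at all wires.
        eval-weaken : ∀ x g′ → evalGate (wireValue (gs ▷ g) x) (mapGate (map₂ suc) g′) ≡ evalGate (wireValue gs x) g′
        eval-weaken x g′ = trans (evalGate-map (map₂ suc) (wireValue (gs ▷ g) x) g′)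
          (evalGate-cong {d = λ _ → 0} {ℓ = gateDepth (λ _ → 0) g′} g′ (ℕ.n≤1+n _) λ w _ → value-suc x w)
        depth-cong : ∀ {W : Set} {d e : W → ℕ} g → (∀ w → d w ≡ e w) → gateDepth {m} d g ≡ gateDepth e g
        depth-cong (AND ws) h = cong (λ ds → suc (foldr ℕ._⊔_ 0 ds)) (List.map-cong h ws)
        depth-cong (OR ws)  h = cong (λ ds → suc (foldr ℕ._⊔_ 0 ds)) (List.map-cong h ws)
        depth-cong (MOD ws) h = cong (λ ds → suc (foldr ℕ._⊔_ 0 ds)) (List.map-cong h ws)
        depth-cong (NOT w)  h = cong suc (h w)
        depth-weaken : ∀ g′ → gateDepth (wireDepth (gs ▷ g)) (mapGate (map₂ suc) g′) ≡ gateDepth (wireDepth gs) g′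
        depth-weaken g′ = trans (gateDepth-map (map₂ suc) (wireDepth (gs ▷ g)) g′) (depth-cong g′ depth-suc)
        weakened : ∀ i → Σ[ g′ ∈ Gate m (Fin n ⊎ Fin _) ]
          ((∀ x → lookup (evalGates x (gs ▷ g)) i ≡ evalGate (wireValue (gs ▷ g) x) g′) ×
           lookup (gateDepths (gs ▷ g)) i ≡ gateDepth (wireDepth (gs ▷ g)) g′)
        weakened zero    = mapGate (map₂ suc) g , (λ x → sym (eval-weaken x g)) , sym (depth-weaken g)
        weakened (suc i) with gateAt gs i
        ... | g′ , v≡ , d≡ = mapGate (map₂ suc) g′ , (λ x → trans (v≡ x) (sym (eval-weaken x g′))) , trans d≡ (sym (depth-weaken g′))
      ... | found = found

  -- `8 ^ suc k` pays for the `k` primes of the modulus and the extra prime 2; `13 = 3 + 2 * 5`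
  -- comes from approximating gates with exponent 5.
  exponent : ℕ → ℕ → ℕ
  exponent k zero    = 1
  exponent k (suc ℓ) = 13 ℕ.* (8 ℕ.^ suc k ℕ.* exponent k ℓ)

  module _ {m n s : ℕ} (gs : Gates m n s) where

    private
      N = n ℕ.+ s

      wire : Fin N → Fin n ⊎ Fin s
      wire = splitAt n

      index : Fin n ⊎ Fin s → Fin N
      index = join n s

    -- Deeper wires become false, so that all levels are indexed by the same wires.
    level : ℕ → Fin N → Cube n → Bool
    level ℓ i x = ⌊ wireDepth gs (wire i) ℕ.≤? ℓ ⌋ ∧ wireValue gs x (wire i)

    level-shallow : ∀ ℓ w x → wireDepth gs w ℕ.≤ ℓ → level ℓ (index w) x ≡ wireValue gs x w
    level-shallow ℓ w x d≤ = trans (cong (λ w → ⌊ wireDepth gs w ℕ.≤? ℓ ⌋ ∧ wireValue gs x w) (Fin.splitAt-join n s w)) shallow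
      where
      shallow : ⌊ wireDepth gs w ℕ.≤? ℓ ⌋ ∧ wireValue gs x w ≡ wireValue gs x w
      shallow with wireDepth gs w ℕ.≤? ℓ
      ... | yes _  = refl
      ... | no d≰  = ⊥-elim (d≰ d≤)

    level-step : ∀ ℓ i → (∀ x → level (suc ℓ) i x ≡ false) ⊎ Member (level ℓ) (level (suc ℓ) i) ⊎
      Σ[ g ∈ Gate m (Fin N) ] (∀ x → level (suc ℓ) i x ≡ evalGate (λ w → level ℓ w x) g)
    level-step ℓ i with wireDepth gs (wire i) ℕ.≤? suc ℓ
    ... | no _   = inj₁ λ _ → refl
    ... | yes d≤ with wire i in w≡
    ...   | inj₁ j = inj₂ (inj₁ (index (inj₁ j) , λ x → sym (level-shallow ℓ (inj₁ j) x ℕ.z≤n)))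
    ...   | inj₂ j with gateAt gs j
    ...     | g , v≡ , d≡ = inj₂ (inj₂ (mapGate index g , λ x → trans (v≡ x) (trans
                (evalGate-cong {d = wireDepth gs} g (subst (ℕ._≤ suc ℓ) d≡ d≤) λ w dw → sym (level-shallow ℓ w x dw))
                (sym (evalGate-map index (λ w → level ℓ w x) g)))))

    level-zero : ∀ i → (∀ x → level 0 i x ≡ false) ⊎ (∃[ j ] (∀ x → level 0 i x ≡ lookup x j))
    level-zero i with wireDepth gs (wire i) ℕ.≤? 0
    ... | no _   = inj₁ λ _ → refl
    ... | yes d≤ with wire i
    ...   | inj₁ j = inj₂ (j , λ _ → refl)
    ...   | inj₂ j with gateAt gs j
    ...     | g , _ , d≡ = ⊥-elim (ℕ.<⇒≱ (gateDepth≥1 g) (subst (ℕ._≤ 0) d≡ d≤))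

    inputs : ∀ τ → All (Member (level 0)) τ → (∀ x → product τ x ≡ false) ⊎
      (∃[ σ ] (length σ ℕ.≤ length τ × (∀ x → product τ x ≡ all (lookup x) σ)))
    inputs [] [] = inj₂ ([] , ℕ.z≤n , λ _ → refl)
    inputs (h ∷ τ) ((i , h≡) ∷ τ∈) with level-zero i | inputs τ τ∈
    ... | inj₁ z       | _                  = inj₁ λ x → cong (_∧ product τ x) (trans (h≡ x) (z x))
    ... | inj₂ _       | inj₁ z             = inj₁ λ x → trans (cong (h x ∧_) (z x)) (Bool.∧-zeroʳ (h x))
    ... | inj₂ (j , e) | inj₂ (σ , σ≤ , eq) = inj₂ (j ∷ σ , ℕ.s≤s σ≤ , λ x → cong₂ _∧_ (trans (h≡ x) (e x)) (eq x))

    -- No error arises at depth 0: a product of members is zero or a monomial in the input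
    -- variables, of degree at most `Q`.
    Good-inputs : ∀ {Q₀} → Good (Member (level 0)) Q₀ 1
    Good-inputs = good λ Q Q₀≤Q τ τ≤Q τ∈ c → exact Q c τ (inputs τ τ∈) τ≤Q
      where
      exact : ∀ Q c τ → (∀ x → product τ x ≡ false) ⊎ (∃[ σ ] (length σ ℕ.≤ length τ × (∀ x → product τ x ≡ all (lookup x) σ))) →
        length τ ℕ.≤ Q → Approximable (Q ℕ.^ 1) (2⁻ Q) (λ x → c * ⟦ product τ x ⟧)
      exact Q c τ (inj₁ z) _ = (λ _ → 0ℚ) , IsPoly-0 , λ x →
        subst (Near (2⁻ Q) 0ℚ) (sym (trans (cong (λ b → c * ⟦ b ⟧) (z x)) (ℚ.*-zeroʳ c))) (Near-refl (ℚ.<⇒≤ (0<2⁻ Q)))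
      exact Q c τ (inj₂ (σ , σ≤ , eq)) τ≤Q = (λ x → c * ⟦ all (lookup x) σ ⟧) ,
        IsPoly-product c σ (ℕ.≤-trans σ≤ (ℕ.≤-trans τ≤Q (ℕ.≤-reflexive (sym (ℕ.^-identityʳ Q))))) , λ x →
        subst (λ b → Near (2⁻ Q) (c * ⟦ all (lookup x) σ ⟧) (c * ⟦ b ⟧)) (sym (eq x)) (Near-refl (ℚ.<⇒≤ (0<2⁻ Q)))

    module _ (F : PrimePowers m) {Q₀ : ℕ} (4≤Q₀ : 4 ℕ.≤ Q₀) (m≤Q₀ : m ℕ.≤ Q₀) (N≤ : suc N ℕ.≤ 2 ℕ.^ Q₀)
             (ps≤ : length (primes F) ℕ.≤ Q₀) where

      -- One threshold `Q₀` serves all levels, since each closure step passes only larger parameters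
      -- to the level below.
      Good-level : ∀ ℓ → Good (Member (level ℓ)) Q₀ (exponent (length (primes F)) ℓ)
      Good-level zero    = Good-inputs
      Good-level (suc ℓ) = Good-Approximated 5 4≤Q₀ approximated
        (Good-Residues (2 ∷ primes F) (ℕ.≤-refl ∷ All.map (λ pp → ℕ.nonTrivial⇒n>1 _ {{prime⇒nonTrivial pp}}) (primes-prime F)) 4≤Q₀ m≤Q₀ N≤ (Good-level ℓ))
        where
        𝓒 : Class
        𝓒 = Residues {H = level ℓ} m (2 ∷ primes F)
        unitComb-step : ∀ i Q → Q₀ ℕ.≤ Q → UnitComb 𝓒 (Q ℕ.^ 5) (Q ℕ.^ 5) (2⁻ Q) (level (suc ℓ) i)
        unitComb-step i Q Q₀≤Q with level-step ℓ i
        ... | inj₁ z = unitComb (λ _ → 0ℚ) (λ _ → ℚ.≤-refl) (λ _ → 0≤1)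
                (λ x → ℚ.≤-trans (ℚ.≤-reflexive (cong (λ b → ∣ 0ℚ - ⟦ b ⟧ ∣) (z x))) (ℚ.<⇒≤ (0<2⁻ Q)))
                (nil λ _ → refl)
        ... | inj₂ (inj₁ h∈) = UnitComb-exact (level (suc ℓ) i ∷ []) (ℚ.<⇒≤ (0<2⁻ Q)) (ℕ.m^n>0 Q {{ℕ.>-nonZero (ℕ.≤-trans (ℕ.s≤s ℕ.z≤n) (ℕ.≤-trans 4≤Q₀ Q₀≤Q))}} 5)
                (Residues-Member (2 ∷ primes F) h∈ ∷ []) λ x → sym (Bool.∧-identityʳ (level (suc ℓ) i x))
        ... | inj₂ (inj₂ (g , eq)) = UnitComb-≗ eq (UnitComb-gate F 4≤Q₀ N≤ ps≤ Q Q₀≤Q g)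
        approximated : ∀ {h} → Member (level (suc ℓ)) h → Approximated 𝓒 Q₀ 5 h
        approximated (i , h≡) Q Q₀≤Q = UnitComb-≗ h≡ (unitComb-step i Q Q₀≤Q)

  module _ {m n : ℕ} (F : PrimePowers m) (C : Circuit m n) where

    circuit-approximable : ∀ {D} Q → 4 ℕ.≤ Q → m ℕ.≤ Q → suc (n ℕ.+ size C) ℕ.≤ 2 ℕ.^ Q → length (primes F) ℕ.≤ Q → depth C ℕ.≤ D →
      Approximable (Q ℕ.^ exponent (length (primes F)) D) (2⁻ Q) (λ x → ½ * ⟦ eval C x ⟧)
    circuit-approximable {D} Q 4≤Q m≤Q N≤ ps≤ depth≤ =

      (let P , P-poly , P-near = Good.approximate (Good-level (gates C) F 4≤Q m≤Q N≤ ps≤ D) Q ℕ.≤-refl (eval C ∷ []) (ℕ.≤-trans (ℕ.s≤s ℕ.z≤n) 4≤Q)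
                   ((join n (size C) (output C) , λ x → sym (level-shallow (gates C) D (output C) x depth≤)) ∷ []) ½
       in P , P-poly , λ x → subst (λ b → Near (2⁻ Q) (P x) (½ * ⟦ b ⟧)) (Bool.∧-identityʳ (eval C x)) (P-near x))

open Levels

-- From rational estimates to the real numbers of the statement

module RealBounds where
  open import Data.Rational.Base
  open import Data.Rational.Properties
  open import Data.Fin.Subset using (Subset)
  open import Data.Fin.Subset.Properties using (_∈?_)
  open ℚ-Solver.+-*-Solver using (solve; _:=_; :-_; _:-_)
  open ℚ-Lemmas
  open ≤-Reasoning

  ¼ : ℚ
  ¼ = ½ * ½

  seq-≡⇒≃ : ∀ x y → (∀ k → seq x k ≡ seq y k) → x ℝ.≃ y
  seq-≡⇒≃ x y eq δ 0<δ = 0 , λ k _ → begin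
    ∣ seq x k - seq y k ∣      ≡⟨ cong (λ p → ∣ p - seq y k ∣) (eq k) ⟩
    ∣ seq y k - seq y k ∣      ≡⟨ cong ∣_∣ (+-inverseʳ (seq y k)) ⟩
    0ℚ                         ≤⟨ <⇒≤ 0<δ ⟩
    δ                          ∎

  seq-≤⇒≤ : ∀ x y K → (∀ k → K ℕ.≤ k → seq x k ≤ seq y k) → x ℝ.≤ y
  seq-≤⇒≤ x y K le δ 0<δ = K , λ k K≤k → begin
    seq x k            ≤⟨ le k K≤k ⟩
    seq y k            ≡⟨ +-identityʳ (seq y k) ⟨
    seq y k + 0ℚ       ≤⟨ +-monoʳ-≤ (seq y k) (<⇒≤ 0<δ) ⟩
    seq y k + δ        ∎

  -- Stated for variables: comparing rational expressions that are only equal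
  -- after unfolding seq would normalise them.
  seq-+ : ∀ x y k → seq (x ℝ.+ y) k ≡ seq x k + seq y k
  seq-+ x y k = refl

  seq-* : ∀ x y k → seq (x ℝ.* y) k ≡ seq x k * seq y k
  seq-* x y k = refl

  seq-fromℚ : ∀ q k → seq (fromℚ q) k ≡ q
  seq-fromℚ q k = refl

  seq-foldr : ∀ {A : Set} {k} (f : A → ℝ → ℝ) (g : A → ℚ → ℚ) {e e′} → (∀ a y → seq (f a y) k ≡ g a (seq y k)) →
    {eq : seq e k ≡ e′} → ∀ L → seq (foldr f e L) k ≡ foldr g e′ L
  seq-foldr f g h {eq} []      = eq
  seq-foldr f g h {eq} (a ∷ L) = trans (h a _) (cong (g a) (seq-foldr f g h {eq} L))

  module _ {n : ℕ} where

    seq-bit : ∀ b k → seq (if b then 1ℝ else 0ℝ) k ≡ ⟦ b ⟧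
    seq-bit true  k = refl
    seq-bit false k = refl

    seq-monomial : ∀ (S : Subset n) x k → seq (monomial S x) k ≡ monomialℚ S x
    seq-monomial S x k = seq-foldr (λ i y → (if lookup x i then 1ℝ else 0ℝ) ℝ.* y) (λ i q → ⟦ lookup x i ⟧ * q)
      (λ i y → trans (seq-* (if lookup x i then 1ℝ else 0ℝ) y k) (cong (_* seq y k) (seq-bit (lookup x i) k))) {eq = refl} (filter (_∈? S) (allFin n))

    seq-polynomial : ∀ d (c : Subset n → ℚ) x k → seq (polynomial d (λ S → fromℚ (c S)) x) k ≡ polynomialℚ d c x
    seq-polynomial d c x k = seq-foldr (λ S y → fromℚ (c S) ℝ.* monomial S x ℝ.+ y) (λ S q → c S * monomialℚ S x + q)
      (λ S y → trans (seq-+ (fromℚ (c S) ℝ.* monomial S x) y k) (cong (_+ seq y k)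
        (trans (seq-* (fromℚ (c S)) (monomial S x) k) (trans (cong (_* seq (monomial S x) k) (seq-fromℚ (c S) k))
          (cong (c S *_) (seq-monomial S x k)))))) {eq = refl} (subsets≤ d)

  -- The norm has to be attained; for rational values a maximum point of the cube is found by
  -- comparisons.
  argmax : ∀ n (g : Cube n → ℚ) → ∃[ x ] (∀ y → g y ≤ g x)
  argmax zero    g = [] , λ { [] → ≤-refl }
  argmax (suc n) g with argmax n (g ∘ (false ∷_)) | argmax n (g ∘ (true ∷_))
  ... | x , x-max | y , y-max with ≤-total (g (false ∷ x)) (g (true ∷ y))
  ...   | inj₁ le = true ∷ y  , λ { (false ∷ z) → ≤-trans (x-max z) le ; (true ∷ z) → y-max z }
  ...   | inj₂ ge = false ∷ x , λ { (false ∷ z) → x-max z ; (true ∷ z) → ≤-trans (y-max z) ge }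

  -- At distance at most 1/4 from 0, `r` keeps clear of the half-integers, where ι jumps, so it is
  -- itself the representative in `[-1/2, 1/2)`.
  isAbsMod1 : ∀ p h z r → r ≡ p - h - fromℤ z → ∣ r ∣ ≤ ¼ → IsAbsMod1 (fromℚ p ℝ.- fromℚ h) (fromℚ ∣ r ∣)
  isAbsMod1 p h z r r≡ ∣r∣≤¼ = fromℚ r ,
    (ℤ.- z , seq-≡⇒≃ (fromℚ r) ((fromℚ p ℝ.- fromℚ h) ℝ.+ ℝ.fromℤ (ℤ.- z)) λ _ → trans r≡ (cong (λ w → p - h + w) (sym (fromℤ-neg z)))) ,
    seq-≤⇒≤ (fromℚ -½) (fromℚ r) 0 (λ _ _ → -½≤r) ,
    (¼ , positive⁻¹ ¼ , 0 , λ _ _ → ≤-trans (+-monoˡ-≤ ¼ (≤-trans (p≤∣p∣ r) ∣r∣≤¼)) (≤-reflexive {¼ + ¼} {½} refl)) ,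
    seq-≡⇒≃ (fromℚ ∣ r ∣) ℝ.∣ fromℚ r ∣ λ _ → refl
    where
    -½≤r : -½ ≤ r
    -½≤r = begin
      -½               ≤⟨ toWitness {a? = -½ ≤? - ¼} tt ⟩
      - ¼              ≤⟨ neg-antimono-≤ (≤-trans (≤-trans (p≤∣p∣ (- r)) (≤-reflexive (∣-p∣≡∣p∣ r))) ∣r∣≤¼) ⟩
      - (- r)          ≡⟨ solve 1 (λ r → :- (:- r) := r) refl r ⟩
      r                ∎

  isTorusPolynomial : ∀ {n d P} → IsPoly {n} d P → IsTorusPolynomial d (λ x → fromℚ (P x))
  isTorusPolynomial {d = d} {P} (c , P≡) = (λ S → fromℚ (c S)) , λ x → ℤ.+ 0 ,
    seq-≡⇒≃ (fromℚ (P x)) (polynomial d (λ S → fromℚ (c S)) x ℝ.+ ℝ.fromℤ (ℤ.+ 0)) λ k →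
      trans (P≡ x) (trans (sym (seq-polynomial d c x k)) (sym (+-identityʳ (seq (polynomial d (λ S → fromℚ (c S)) x) k))))

  approximates : ∀ {n} (ε : ℝ) (f : BooleanFunction n) (P r : Cube n → ℚ) (z : Cube n → ℤ) →
    (∀ x → r x ≡ P x - (if f x then ½ else 0ℚ) - fromℤ (z x)) → (∀ x → ∣ r x ∣ ≤ ¼) →
    ∀ K → (∀ x k → K ℕ.≤ k → ∣ r x ∣ ≤ seq ε k) → Approximates ε (λ x → fromℚ (P x)) f
  approximates {n} ε f P r z r≡ ∣r∣≤¼ K ∣r∣≤ε = attained (argmax n (λ x → ∣ r x ∣))
    where
    isAbs : ∀ x → IsAbsMod1 (fromℚ (P x) ℝ.- fromℚ (if f x then ½ else 0ℚ)) (fromℚ ∣ r x ∣)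
    isAbs x = isAbsMod1 (P x) (if f x then ½ else 0ℚ) (z x) (r x) (r≡ x) (∣r∣≤¼ x)
    attained : ∃[ x₀ ] (∀ x → ∣ r x ∣ ≤ ∣ r x₀ ∣) → Approximates ε (λ x → fromℚ (P x)) f
    attained (x₀ , maximal) = fromℚ ∣ r x₀ ∣ ,
      ((λ x → fromℚ ∣ r x ∣ , isAbs x , seq-≤⇒≤ (fromℚ ∣ r x ∣) (fromℚ ∣ r x₀ ∣) 0 (λ _ _ → maximal x)) , x₀ , isAbs x₀) ,
      seq-≤⇒≤ (fromℚ ∣ r x₀ ∣) ε K (∣r∣≤ε x₀)

  hasApproximation : ∀ {n d δ} (ε : ℝ) (f : BooleanFunction n) → δ ≤ ¼ → ∀ K → (∀ k → K ℕ.≤ k → δ ≤ seq ε k) →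
    Approximable d δ (λ x → ½ * ⟦ f x ⟧) → HasApproximation ε d f
  hasApproximation {δ = δ} ε f δ≤¼ K δ≤ε (P , P-poly , P-near) = (λ x → fromℚ (P x)) , isTorusPolynomial P-poly ,
    approximates ε f P (λ x → P x - ½ * ⟦ f x ⟧ - fromℤ (Near.winding (P-near x))) (λ x → Near.winding (P-near x))
      (λ x → cong (λ h → P x - h - fromℤ (Near.winding (P-near x))) (half≡ (f x)))
      (λ x → ≤-trans (Near.distance (P-near x)) δ≤¼) K
      (λ x k K≤k → ≤-trans (Near.distance (P-near x)) (δ≤ε k K≤k))
    where
    half≡ : ∀ b → ½ * ⟦ b ⟧ ≡ (if b then ½ else 0ℚ)
    half≡ true  = refl
    half≡ false = refl

  ⌊log₂⌋-shift : ∀ j a → 1 ℕ.≤ a → j ℕ.+ ⌊log₂ a ⌋ ℕ.≤ ⌊log₂ 2 ℕ.^ j ℕ.* a ⌋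
  ⌊log₂⌋-shift j a 1≤a = subst (ℕ._≤ ⌊log₂ 2 ℕ.^ j ℕ.* a ⌋) (⌊log₂[2^n]⌋≡n (j ℕ.+ ⌊log₂ a ⌋)) (⌊log₂⌋-mono-≤
    (ℕ.≤-trans (ℕ.≤-reflexive (ℕ.^-distribˡ-+-* 2 j ⌊log₂ a ⌋)) (ℕ.*-monoʳ-≤ (2 ℕ.^ j) (ℕ-Lemmas.2^⌊log₂n⌋≤n a 1≤a))))

  -- The rounding loses nothing at powers of two: for `q = a / b` and `K = k + 1`, `2 ^ t * b ≤ a`
  -- gives `2 ^ (t * K) * b ^ K ≤ a ^ K`, and the power of two raises the rounded logarithm of
  -- `b ^ K` by at least `t * K`.
  log₂-approx-≥ : ∀ k t q → 0ℚ < q → fromℕ (2 ℕ.^ t) ≤ q → fromℕ t ≤ log₂-approx k q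
  log₂-approx-≥ k t q 0<q 2^t≤q = begin
    fromℕ t
      ≡⟨ *-identityʳ (fromℕ t) ⟨
    fromℕ t * 1ℚ
      ≡⟨ cong (fromℕ t *_) (n/n≡1 k) ⟨
    fromℕ t * (fromℕ (suc k) * unit k)
      ≡⟨ trans (sym (*-assoc (fromℕ t) (fromℕ (suc k)) (unit k))) (cong (_* unit k) (sym (fromℕ-* t (suc k)))) ⟩
    fromℕ (t ℕ.* suc k) * unit k
      ≤⟨ *-monoʳ (unit k) (<⇒≤ (unit>0 k)) (fromℤ-mono t*K≤) ⟩
    fromℤ (ℤ.+ α ℤ.- ℤ.+ β) * unit k
      ≡⟨ i/n≡i*unit (ℤ.+ α ℤ.- ℤ.+ β) k ⟨
    log₂-approx k q ∎
    where
    α = ⌊log₂ num q ℕ.^ suc k ⌋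
    β = ⌊log₂ ↧ₙ q ℕ.^ suc k ⌋
    2^t*d≤num : 2 ℕ.^ t ℕ.* ↧ₙ q ℕ.≤ num q
    2^t*d≤num = fromℕ-cancel (begin
      fromℕ (2 ℕ.^ t ℕ.* ↧ₙ q)          ≡⟨ fromℕ-* (2 ℕ.^ t) (↧ₙ q) ⟩
      fromℕ (2 ℕ.^ t) * fromℕ (↧ₙ q)    ≤⟨ *-monoʳ (fromℕ (↧ₙ q)) (0≤fromℕ (↧ₙ q)) 2^t≤q ⟩
      q * fromℕ (↧ₙ q)                  ≡⟨ q*↧q≡num q 0<q ⟩
      fromℕ (num q)                     ∎)
    shifted : t ℕ.* suc k ℕ.+ β ℕ.≤ α
    shifted = ℕ.≤-trans (⌊log₂⌋-shift (t ℕ.* suc k) (↧ₙ q ℕ.^ suc k) (ℕ.m^n>0 (↧ₙ q) (suc k)))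
      (⌊log₂⌋-mono-≤ (ℕ.≤-trans
        (ℕ.≤-reflexive (trans (cong (ℕ._* ↧ₙ q ℕ.^ suc k) (sym (ℕ.^-*-assoc 2 t (suc k)))) (sym (ℕ-Lemmas.^-distribʳ-* (2 ℕ.^ t) (↧ₙ q) (suc k)))))
        (ℕ.^-monoˡ-≤ (suc k) 2^t*d≤num)))
    t*K≤ : ℤ.+ (t ℕ.* suc k) ℤ.≤ ℤ.+ α ℤ.- ℤ.+ β
    t*K≤ = subst (ℤ._≤ ℤ.+ α ℤ.- ℤ.+ β)
      (trans (cong (ℤ._- ℤ.+ β) (ℤ.pos-+ (t ℕ.* suc k) β)) (trans (ℤ.+-assoc (ℤ.+ (t ℕ.* suc k)) (ℤ.+ β) (ℤ.- (ℤ.+ β)))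
        (trans (cong (ℤ._+_ (ℤ.+ (t ℕ.* suc k))) (ℤ.+-inverseʳ (ℤ.+ β))) (ℤ.+-identityʳ (ℤ.+ (t ℕ.* suc k))))))
      (ℤ.+-monoˡ-≤ (ℤ.- (ℤ.+ β)) (ℤ.+≤+ shifted))

  seq-^ : ∀ x C k → seq (x ℝ.^ C) k ≡ power (seq x k) C
  seq-^ x zero    k = refl
  seq-^ x (suc C) k = cong (seq x k *_) (seq-^ x C k)

  power-mono : ∀ {t v} C → fromℕ t ≤ v → fromℕ (t ℕ.^ C) ≤ power v C
  power-mono         zero    t≤v = ≤-refl
  power-mono {t} {v} (suc C) t≤v = ≤-trans (≤-reflexive (fromℕ-* t (t ℕ.^ C)))
    (*-mono (0≤fromℕ t) (≤-trans (0≤fromℕ (t ℕ.^ C)) (power-mono C t≤v)) t≤v (power-mono C t≤v))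

  seq-bound : ∀ C (x : ℝ) k t → fromℕ t ≤ seq x k → fromℕ (C ℕ.* t ℕ.^ C) ≤ seq (ℝ.fromℕ C ℝ.* x ℝ.^ C) k
  seq-bound C x k t t≤ = begin
    fromℕ (C ℕ.* t ℕ.^ C)                  ≡⟨ fromℕ-* C (t ℕ.^ C) ⟩
    fromℕ C * fromℕ (t ℕ.^ C)              ≤⟨ *-monoˡ (fromℕ C) (0≤fromℕ C) (power-mono C t≤) ⟩
    fromℕ C * power (seq x k) C            ≡⟨ cong (fromℕ C *_) (seq-^ x C k) ⟨
    fromℕ C * seq (x ℝ.^ C) k              ≡⟨ cong (_* seq (x ℝ.^ C) k) (seq-fromℚ (fromℕ C) k) ⟨
    seq (ℝ.fromℕ C) k * seq (x ℝ.^ C) k    ≡⟨ seq-* (ℝ.fromℕ C) (x ℝ.^ C) k ⟨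
    seq (ℝ.fromℕ C ℝ.* x ℝ.^ C) k          ∎

  seq-log₂ : ∀ x k → seq (log₂ x) k ≡ log₂-approx k (seq (proj₁ x) k)
  seq-log₂ x k = refl

  seq-/ : ∀ x y k → seq (proj₁ (x ℝ./ y)) k ≡ seq (proj₁ x) k * seq (y ℝ.⁻¹) k
  seq-/ x y k = refl

  startIndex : ℝ⁺ → ℕ
  startIndex (_ , _ , _ , N , _) = N

  -- The reciprocal sequence starts where the given one is bounded away from 0. Because of this
  -- shift, bounds on ε are later required at all large indices.
  seq-⁻¹ : ∀ x k → 0ℚ ≤ seq (x ℝ.⁻¹) k × seq (proj₁ x) (startIndex x ℕ.+ k) * seq (x ℝ.⁻¹) k ≡ 1ℚ
  seq-⁻¹ (x , δ , 0<δ , N , δ≤x) k =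
    <⇒≤ (positive⁻¹ ((1/ e) {{>-nonZero 0<e}}) {{1/pos⇒pos e {{positive 0<e}}}}) , *-inverseʳ e {{>-nonZero 0<e}}
    where
    e = seq x (N ℕ.+ k)
    0<e : 0ℚ < e
    0<e = <-≤-trans 0<δ (ℝ-Lemmas.0+δ≤q⇒δ≤q δ e (δ≤x (N ℕ.+ k) (ℕ.m≤m+n N k)))

  quotient-≥ : ∀ a b {e i} → 0ℚ ≤ i → e * i ≡ 1ℚ → a * e ≤ b → a ≤ b * i
  quotient-≥ a b {e} {i} 0≤i ei≡1 ae≤b = begin
    a              ≡⟨ *-identityʳ a ⟨
    a * 1ℚ         ≡⟨ cong (a *_) ei≡1 ⟨
    a * (e * i)    ≡⟨ *-assoc a e i ⟨
    a * e * i      ≤⟨ *-monoʳ i 0≤i ae≤b ⟩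
    b * i          ∎

  seq-log₂-≥ : ∀ (x y : ℝ⁺) t k → fromℕ (2 ℕ.^ t) * seq (proj₁ y) (startIndex y ℕ.+ k) ≤ seq (proj₁ x) k → fromℕ t ≤ seq (log₂ (x ℝ./ y)) k
  seq-log₂-≥ x y t k h = subst (fromℕ t ≤_) (sym (seq-log₂ (x ℝ./ y) k))
    (log₂-approx-≥ k t (seq (proj₁ (x ℝ./ y)) k) (<-≤-trans (positive⁻¹ 1ℚ) (≤-trans (fromℕ-mono (ℕ.m^n>0 2 t)) 2^t≤)) 2^t≤)
    where
    2^t≤ : fromℕ (2 ℕ.^ t) ≤ seq (proj₁ (x ℝ./ y)) k
    2^t≤ = subst (fromℕ (2 ℕ.^ t) ≤_) (sym (seq-/ x y k))
      (quotient-≥ (fromℕ (2 ℕ.^ t)) (seq (proj₁ x) k) (proj₁ (seq-⁻¹ y k)) (proj₂ (seq-⁻¹ y k)) h)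

  seq-fromℕ⁺ : ∀ n .{{_ : ℕ.NonZero n}} k → seq (proj₁ (fromℕ⁺ n)) k ≡ fromℕ n
  seq-fromℕ⁺ (suc m) k = refl

  ≤-bound : ∀ n .{{_ : ℕ.NonZero n}} (y : ℝ⁺) t K → (∀ j → K ℕ.≤ j → fromℕ (2 ℕ.^ t) * seq (proj₁ y) j ≤ fromℕ n) →
    ∀ C d → d ℕ.≤ C ℕ.* t ℕ.^ C → ℝ.fromℕ d ℝ.≤ ℝ.fromℕ C ℝ.* log₂ (fromℕ⁺ n ℝ./ y) ℝ.^ C
  ≤-bound n y t K 2^tε≤n C d d≤ = seq-≤⇒≤ (ℝ.fromℕ d) (ℝ.fromℕ C ℝ.* log₂ (fromℕ⁺ n ℝ./ y) ℝ.^ C) K λ k K≤k →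
    ≤-trans (fromℕ-mono d≤) (seq-bound C (log₂ (fromℕ⁺ n ℝ./ y)) k t
      (seq-log₂-≥ (fromℕ⁺ n) y t k (≤-trans (2^tε≤n (startIndex y ℕ.+ k) (ℕ.≤-trans K≤k (ℕ.m≤n+m k (startIndex y))))
        (≤-reflexive (sym (seq-fromℕ⁺ n k))))))

open RealBounds

-- Size bounds in powers of two, and a dyadic scale for `n / ε`

module DyadicScale where
  open import Data.Rational.Base
  open import Data.Rational.Properties
  open ℚ-Solver.+-*-Solver using (solve; _:=_; _:+_; _:*_; :-_; _:-_; con)
  open ℚ-Lemmas

  a+b≤2ab : ∀ a b → 1 ℕ.≤ a → 1 ℕ.≤ b → a ℕ.+ b ℕ.≤ 2 ℕ.* (a ℕ.* b)
  a+b≤2ab a b 1≤a 1≤b = begin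
    a ℕ.+ b                                ≡⟨ cong₂ ℕ._+_ (ℕ.*-identityʳ a) (ℕ.*-identityˡ b) ⟨
    a ℕ.* 1 ℕ.+ 1 ℕ.* b                    ≤⟨ ℕ.+-mono-≤ (ℕ.*-monoʳ-≤ a 1≤b) (ℕ.*-monoˡ-≤ b 1≤a) ⟩
    a ℕ.* b ℕ.+ a ℕ.* b                    ≡⟨ cong (a ℕ.* b ℕ.+_) (ℕ.+-identityʳ (a ℕ.* b)) ⟨
    2 ℕ.* (a ℕ.* b)                        ∎
    where open ℕ.≤-Reasoning

  -- Since `x + y ≤ 2 x y` for positive numbers, a sum costs no more than a product and a factor 2,
  -- and that factor is at most `2 ^ T`.
  2^-sum : ∀ {x y} a b T → 1 ℕ.≤ T → x ℕ.≤ 2 ℕ.^ (a ℕ.* T) → y ℕ.≤ 2 ℕ.^ (b ℕ.* T) → x ℕ.+ y ℕ.≤ 2 ℕ.^ (suc (a ℕ.+ b) ℕ.* T)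
  2^-sum {x} {y} a b T 1≤T x≤ y≤ = begin
    x ℕ.+ y                                                  ≤⟨ ℕ.+-mono-≤ x≤ y≤ ⟩
    2 ℕ.^ (a ℕ.* T) ℕ.+ 2 ℕ.^ (b ℕ.* T)                      ≤⟨ a+b≤2ab (2 ℕ.^ (a ℕ.* T)) (2 ℕ.^ (b ℕ.* T)) (ℕ.m^n>0 2 (a ℕ.* T)) (ℕ.m^n>0 2 (b ℕ.* T)) ⟩
    2 ℕ.* (2 ℕ.^ (a ℕ.* T) ℕ.* 2 ℕ.^ (b ℕ.* T))              ≡⟨ cong (2 ℕ.*_) (ℕ.^-distribˡ-+-* 2 (a ℕ.* T) (b ℕ.* T)) ⟨
    2 ℕ.^ suc (a ℕ.* T ℕ.+ b ℕ.* T)                          ≡⟨ cong (λ e → 2 ℕ.^ suc e) (ℕ.*-distribʳ-+ T a b) ⟨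
    2 ℕ.^ (1 ℕ.+ (a ℕ.+ b) ℕ.* T)                            ≤⟨ ℕ.^-monoʳ-≤ 2 (ℕ.+-monoˡ-≤ ((a ℕ.+ b) ℕ.* T) 1≤T) ⟩
    2 ℕ.^ (suc (a ℕ.+ b) ℕ.* T)                              ∎
    where open ℕ.≤-Reasoning

  -- For `n ≤ 2 ^ T`, a Horner step spends `c` on the constant, as `c ≤ 2 ^ c`, one on the
  -- multiplication by `n`, and one on the addition.
  polyExponent : List ℕ → ℕ
  polyExponent []       = 0
  polyExponent (c ∷ cs) = suc (c ℕ.+ suc (polyExponent cs))

  evalPoly≤ : ∀ cs n T → 1 ℕ.≤ T → n ℕ.≤ 2 ℕ.^ T → evalPoly cs n ℕ.≤ 2 ℕ.^ (polyExponent cs ℕ.* T)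
  evalPoly≤ []       n T 1≤T n≤ = ℕ.z≤n
  evalPoly≤ (c ∷ cs) n T 1≤T n≤ = 2^-sum c (suc (polyExponent cs)) T 1≤T
    (ℕ.≤-trans (n≤2^n c) (ℕ.^-monoʳ-≤ 2 (ℕ.≤-trans (ℕ.≤-reflexive (sym (ℕ.*-identityʳ c))) (ℕ.*-monoʳ-≤ c 1≤T))))
    (ℕ.≤-trans (ℕ.*-mono-≤ n≤ (evalPoly≤ cs n T 1≤T n≤)) (ℕ.≤-reflexive (sym (ℕ.^-distribˡ-+-* 2 T (polyExponent cs ℕ.* T)))))

  open ≤-Reasoning

  module _ (e : ℚ) (0<e : 0ℚ < e) (n : ℕ) where

    n≤2^u*e : ∃[ u ] fromℕ n ≤ fromℕ (2 ℕ.^ u) * e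
    n≤2^u*e = let k , unit≤e = archimedean e 0<e in n ℕ.* suc k , (begin
      fromℕ n                                    ≡⟨ *-identityʳ (fromℕ n) ⟨
      fromℕ n * 1ℚ                               ≡⟨ cong (fromℕ n *_) (n/n≡1 k) ⟨
      fromℕ n * (fromℕ (suc k) * unit k)         ≡⟨ *-assoc (fromℕ n) (fromℕ (suc k)) (unit k) ⟨
      fromℕ n * fromℕ (suc k) * unit k           ≡⟨ cong (_* unit k) (fromℕ-* n (suc k)) ⟨
      fromℕ (n ℕ.* suc k) * unit k               ≤⟨ *-mono (0≤fromℕ (n ℕ.* suc k)) (<⇒≤ 0<e) (fromℕ-mono (n≤2^n (n ℕ.* suc k))) unit≤e ⟩
      fromℕ (2 ℕ.^ (n ℕ.* suc k)) * e            ∎)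

    DyadicScale : ℕ → Set
    DyadicScale t = fromℕ n ≤ fromℕ (2 ℕ.^ suc t) * e × (t ≡ 0 ⊎ fromℕ (2 ℕ.^ t) * e ≤ fromℕ n)

    -- Descends from an exponent that is large enough and stops at the earliest reversal of the
    -- inequality or at 0. All comparisons are between rationals, hence decidable.
    dyadic-scale : ∃[ t ] DyadicScale t
    dyadic-scale = descend (proj₁ n≤2^u*e) (proj₂ n≤2^u*e)
      where
      descend : ∀ u → fromℕ n ≤ fromℕ (2 ℕ.^ u) * e → ∃[ t ] DyadicScale t
      compare : ∀ u → fromℕ n ≤ fromℕ (2 ℕ.^ suc u) * e →
        fromℕ (2 ℕ.^ u) * e ≤ fromℕ n ⊎ fromℕ n ≤ fromℕ (2 ℕ.^ u) * e → ∃[ t ] DyadicScale t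
      descend zero    h = 0 , ≤-trans h (*-monoʳ {fromℕ (2 ℕ.^ 0)} {fromℕ (2 ℕ.^ 1)} e (<⇒≤ 0<e) (fromℕ-mono {1} {2} (ℕ.s≤s ℕ.z≤n))) , inj₁ refl
      descend (suc u) h = compare u h (≤-total (fromℕ (2 ℕ.^ u) * e) (fromℕ n))
      compare u h (inj₁ le) = u , h , inj₂ le
      compare u h (inj₂ ge) = descend u ge

  module _ (n : ℕ) (1≤n : 1ℚ ≤ fromℕ n) (ε : ℝ) (K : ℕ) (η : ℚ) (0<η : 0ℚ < η) (4η≤ε : η + η + η + η ≤ seq ε K)
           (ε≤1 : ∀ {j} → K ℕ.≤ j → seq ε j ≤ 1ℚ)
           (close : ∀ i j → K ℕ.≤ i → K ℕ.≤ j → ∣ seq ε i - seq ε j ∣ ≤ η) where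

    private
      e₀ e : ℚ
      e₀ = seq ε K
      e  = e₀ + η

    ε≤e : ∀ {j} → K ℕ.≤ j → seq ε j ≤ e
    ε≤e {j} K≤j = ∣-∣≤⇒≤+ (seq ε j) e₀ (close j K K≤j ℕ.≤-refl)

    -- Late terms are at least `e₀ - η`, and `4 η ≤ e₀` gives `½ (e₀ + η) ≤ e₀ - η`. So the rational
    -- `e` overestimates every late term of `ε` by a factor of at most 2.
    ½e≤ε : ∀ {j} → K ℕ.≤ j → ½ * e ≤ seq ε j
    ½e≤ε {j} K≤j = begin
      ½ * (e₀ + η)
        ≡⟨ solve 2 (λ x y → con ½ :* (x :+ y) := con ½ :* x :+ con ½ :* (y :+ y :+ y :+ y) :+ :- (con ½ :* y) :- y) refl e₀ η ⟩
      ½ * e₀ + ½ * (η + η + η + η) + - (½ * η) - η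
        ≤⟨ +-monoˡ-≤ (- η) (+-mono-≤ (+-monoʳ-≤ (½ * e₀) (*-monoˡ ½ (<⇒≤ (positive⁻¹ ½)) 4η≤ε)) (neg-antimono-≤ (<⇒≤ (*-pos (positive⁻¹ ½) 0<η)))) ⟩
      ½ * e₀ + ½ * e₀ + 0ℚ - η
        ≡⟨ solve 2 (λ x y → con ½ :* x :+ con ½ :* x :+ con 0ℚ :- y := x :- y) refl e₀ η ⟩
      e₀ - η
        ≤⟨ +-monoˡ-≤ (- η) (∣-∣≤⇒≤+ e₀ (seq ε j) (close K j ℕ.≤-refl K≤j)) ⟩
      seq ε j + η - η
        ≡⟨ solve 2 (λ x y → x :+ y :- y := x) refl (seq ε j) η ⟩
      seq ε j ∎

    η≤e₀ : η ≤ e₀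
    η≤e₀ = begin
      η                    ≡⟨ trans (+-identityˡ (0ℚ + η)) (+-identityˡ η) ⟨
      0ℚ + (0ℚ + η)        ≤⟨ +-mono-≤ (<⇒≤ 0<η) (+-monoˡ-≤ η (≤-trans (<⇒≤ 0<η) (≤-trans (≤-reflexive (sym (+-identityʳ η))) (+-monoʳ-≤ η (<⇒≤ 0<η))))) ⟩
      η + (η + η + η)      ≡⟨ solve 1 (λ y → y :+ (y :+ y :+ y) := y :+ y :+ y :+ y) refl η ⟩
      η + η + η + η        ≤⟨ 4η≤ε ⟩
      e₀                   ∎

    e≤2 : e ≤ fromℕ 2
    e≤2 = ≤-trans (+-mono-≤ (ε≤1 ℕ.≤-refl) (≤-trans η≤e₀ (ε≤1 ℕ.≤-refl))) (≤-reflexive {1ℚ + 1ℚ} {fromℕ 2} refl)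

    0<e : 0ℚ < e
    0<e = <-≤-trans 0<η (≤-trans (≤-reflexive (sym (+-identityˡ η))) (+-monoˡ-≤ η (≤-trans (<⇒≤ 0<η) η≤e₀)))

    Scale : ℕ → Set
    Scale t = n ℕ.≤ 2 ℕ.^ (2 ℕ.+ t) × (∀ j → K ℕ.≤ j → 2⁻ (2 ℕ.+ t) ≤ seq ε j × fromℕ (2 ℕ.^ t) * seq ε j ≤ fromℕ n)

    -- The offset in `2 + t` has two sources: the search leaves a gap of one power of two, and a
    -- second one is lost through `½ e ≤ ε` in the lower bound for `ε`, or through `e ≤ 2` in the
    -- bound for `n`. At `t = 0` the upper bound is just `ε ≤ 1 ≤ n`.
    dyadic⇒scale : ∀ t → DyadicScale e 0<e n t → Scale t
    dyadic⇒scale t (n≤2^[1+t]*e , alt) = n≤ , λ j K≤j → lower K≤j , upper K≤j alt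
      where
      n≤ : n ℕ.≤ 2 ℕ.^ (2 ℕ.+ t)
      n≤ = fromℕ-cancel (begin
        fromℕ n                              ≤⟨ n≤2^[1+t]*e ⟩
        fromℕ (2 ℕ.^ suc t) * e              ≤⟨ *-monoˡ (fromℕ (2 ℕ.^ suc t)) (0≤fromℕ (2 ℕ.^ suc t)) e≤2 ⟩
        fromℕ (2 ℕ.^ suc t) * fromℕ 2        ≡⟨ trans (*-comm (fromℕ (2 ℕ.^ suc t)) (fromℕ 2)) (sym (fromℕ-* 2 (2 ℕ.^ suc t))) ⟩
        fromℕ (2 ℕ.^ (2 ℕ.+ t))              ∎)
      2⁻≤e : 2⁻ suc t ≤ e
      2⁻≤e = begin
        2⁻ suc t                                        ≡⟨ *-identityˡ (2⁻ suc t) ⟨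
        1ℚ * 2⁻ suc t                                   ≤⟨ *-monoʳ (2⁻ suc t) (<⇒≤ (0<2⁻ (suc t))) (≤-trans 1≤n n≤2^[1+t]*e) ⟩
        fromℕ (2 ℕ.^ suc t) * e * 2⁻ suc t              ≡⟨ solve 3 (λ a b c → a :* b :* c := a :* c :* b) refl (fromℕ (2 ℕ.^ suc t)) e (2⁻ suc t) ⟩
        fromℕ (2 ℕ.^ suc t) * 2⁻ suc t * e              ≡⟨ trans (cong (_* e) (2^*2⁻≡1 (suc t))) (*-identityˡ e) ⟩
        e                                               ∎
      lower : ∀ {j} → K ℕ.≤ j → 2⁻ (2 ℕ.+ t) ≤ seq ε j
      lower K≤j = ≤-trans (*-monoˡ ½ (<⇒≤ (positive⁻¹ ½)) 2⁻≤e) (½e≤ε K≤j)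
      upper : ∀ {j t} → K ℕ.≤ j → t ≡ 0 ⊎ fromℕ (2 ℕ.^ t) * e ≤ fromℕ n → fromℕ (2 ℕ.^ t) * seq ε j ≤ fromℕ n
      upper {j}     K≤j (inj₁ refl) = ≤-trans (≤-reflexive (trans (cong (_* seq ε j) {x = fromℕ (2 ℕ.^ 0)} {y = 1ℚ} refl) (*-identityˡ (seq ε j)))) (≤-trans (ε≤1 K≤j) 1≤n)
      upper {j} {t} K≤j (inj₂ 2^te≤n) = ≤-trans (*-monoˡ (fromℕ (2 ℕ.^ t)) (0≤fromℕ (2 ℕ.^ t)) (ε≤e K≤j)) 2^te≤n

  scale : ∀ n → 1 ℕ.≤ n → (ε : ℝ) → 0ℝ ℝ.< ε → ε ℝ.< 1ℝ → ∃[ t ] ∃[ K ] (n ℕ.≤ 2 ℕ.^ (2 ℕ.+ t) ×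
    (∀ j → K ℕ.≤ j → 2⁻ (2 ℕ.+ t) ≤ seq ε j × fromℕ (2 ℕ.^ t) * seq ε j ≤ fromℕ n))
  scale n 0<n ε (δ , 0<δ , N , δ≤) (δ′ , 0<δ′ , N′ , ≤1) = go (cauchy ε (δ * ½ * ½) (half (half 0<δ)))
    where
    go : ∃[ N″ ] (∀ i j → N″ ℕ.≤ i → N″ ℕ.≤ j → ∣ seq ε i - seq ε j ∣ ≤ δ * ½ * ½) →
      ∃[ t ] ∃[ K ] (n ℕ.≤ 2 ℕ.^ (2 ℕ.+ t) × (∀ j → K ℕ.≤ j → 2⁻ (2 ℕ.+ t) ≤ seq ε j × fromℕ (2 ℕ.^ t) * seq ε j ≤ fromℕ n))
    go (N″ , close) = finish (dyadic-scale (seq ε K + δ * ½ * ½) 0<e′ n)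
      where
      K = N ℕ.⊔ N′ ℕ.⊔ N″
      N′≤ : ∀ {j} → K ℕ.≤ j → N′ ℕ.≤ j
      N′≤ K≤j = ℕ.m⊔n≤o⇒n≤o N N′ (ℕ.m⊔n≤o⇒m≤o (N ℕ.⊔ N′) N″ K≤j)
      N″≤ : ∀ {j} → K ℕ.≤ j → N″ ℕ.≤ j
      N″≤ K≤j = ℕ.m⊔n≤o⇒n≤o (N ℕ.⊔ N′) N″ K≤j
      δ≤ε : δ ≤ seq ε K
      δ≤ε = ℝ-Lemmas.0+δ≤q⇒δ≤q δ (seq ε K) (δ≤ K (ℕ.m⊔n≤o⇒m≤o N N′ (ℕ.m⊔n≤o⇒m≤o (N ℕ.⊔ N′) N″ (ℕ.≤-refl {K}))))
      ε≤1 : ∀ {j} → K ℕ.≤ j → seq ε j ≤ 1ℚ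
      ε≤1 {j} K≤j = begin
        seq ε j              ≡⟨ +-identityʳ (seq ε j) ⟨
        seq ε j + 0ℚ         ≤⟨ +-monoʳ-≤ (seq ε j) (<⇒≤ 0<δ′) ⟩
        seq ε j + δ′         ≤⟨ ≤1 j (N′≤ K≤j) ⟩
        1ℚ                   ∎
      quarters : ∀ η → η ≡ δ * ½ * ½ → η + η + η + η ≡ δ
      quarters η refl = trans (solve 2 (λ d h → d :* h :* h :+ d :* h :* h :+ d :* h :* h :+ d :* h :* h := d :* ((h :+ h) :* (h :+ h))) refl δ ½) (*-identityʳ δ)
      1≤n : 1ℚ ≤ fromℕ n
      1≤n = fromℕ-mono {1} {n} 0<n
      4η≤ε = ≤-trans (≤-reflexive (quarters (δ * ½ * ½) refl)) δ≤ε
      close′ : ∀ i j → K ℕ.≤ i → K ℕ.≤ j → ∣ seq ε i - seq ε j ∣ ≤ δ * ½ * ½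
      close′ i j K≤i K≤j = close i j (N″≤ K≤i) (N″≤ K≤j)
      0<e′ = 0<e n 1≤n ε K (δ * ½ * ½) (half (half 0<δ)) 4η≤ε ε≤1 close′
      finish : ∃[ t ] DyadicScale (seq ε K + δ * ½ * ½) 0<e′ n t →
        ∃[ t ] ∃[ K ] (n ℕ.≤ 2 ℕ.^ (2 ℕ.+ t) × (∀ j → K ℕ.≤ j → 2⁻ (2 ℕ.+ t) ≤ seq ε j × fromℕ (2 ℕ.^ t) * seq ε j ≤ fromℕ n))
      finish (t , s) = t , K , dyadic⇒scale n 1≤n ε K (δ * ½ * ½) (half (half 0<δ)) 4η≤ε ε≤1 close′ t s

open DyadicScale

open import Defs

-- Choice of the constants and conclusion

constant-approximable : ∀ {n} (f : BooleanFunction n) → Approximable 0 (2⁻ 2) (λ x → ½ ℚ.* ⟦ f x ⟧)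
constant-approximable f = _ , IsPoly-product ¼ [] ℕ.z≤n , λ x → Near-close (¼-close (f x))
  where
  ¼-close : ∀ b → ℚ.∣ ¼ ℚ.* ⟦ true ⟧ ℚ.- ½ ℚ.* ⟦ b ⟧ ∣ ℚ.≤ 2⁻ 2
  ¼-close true  = toWitness {a? = ℚ.∣ ¼ ℚ.* ⟦ true ⟧ ℚ.- ½ ℚ.* ⟦ true ⟧ ∣ ℚ.≤? 2⁻ 2} tt
  ¼-close false = toWitness {a? = ℚ.∣ ¼ ℚ.* ⟦ true ⟧ ℚ.- ½ ℚ.* ⟦ false ⟧ ∣ ℚ.≤? 2⁻ 2} tt

Approximable-≗ : ∀ {n d δ} {f g : BooleanFunction n} → (∀ x → f x ≡ g x) →
  Approximable d δ (λ x → ½ ℚ.* ⟦ f x ⟧) → Approximable d δ (λ x → ½ ℚ.* ⟦ g x ⟧)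
Approximable-≗ {δ = δ} f≡g (P , P-poly , P-near) = P , P-poly , λ x → subst (λ b → Near δ (P x) (½ ℚ.* ⟦ b ⟧)) (f≡g x) (P-near x)

module Degree (κ a : ℕ) (4≤κ : 4 ℕ.≤ κ) where
  open ℕ.≤-Reasoning

  -- One number acts as factor and as exponent. The factor `(3 * κ) ^ a` arises from `2 + t ≤ 3 * t`
  -- for `t ≥ 1`; the summand `a` makes `C` large enough as an exponent.
  C : ℕ
  C = (3 ℕ.* κ) ℕ.^ a ℕ.+ a

  3κ≢0 : NonZero (3 ℕ.* κ)
  3κ≢0 = ℕ.>-nonZero (ℕ.*-mono-≤ {1} {3} (ℕ.s≤s ℕ.z≤n) (ℕ.≤-trans (ℕ.s≤s ℕ.z≤n) 4≤κ))

  0<C : 0 ℕ.< C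
  0<C = ℕ.≤-trans (ℕ.m^n>0 (3 ℕ.* κ) {{3κ≢0}} a) (ℕ.m≤m+n _ a)

  degree≤ : ∀ t → (κ ℕ.* (2 ℕ.+ suc t)) ℕ.^ a ℕ.≤ C ℕ.* suc t ℕ.^ C
  degree≤ t = begin
    (κ ℕ.* (2 ℕ.+ suc t)) ℕ.^ a                ≤⟨ ℕ.^-monoˡ-≤ a (ℕ.*-monoʳ-≤ κ 2+≤) ⟩
    (κ ℕ.* (3 ℕ.* suc t)) ℕ.^ a                ≡⟨ cong (ℕ._^ a) (trans (sym (ℕ.*-assoc κ 3 (suc t))) (cong (ℕ._* suc t) (ℕ.*-comm κ 3))) ⟩
    (3 ℕ.* κ ℕ.* suc t) ℕ.^ a                  ≡⟨ ℕ-Lemmas.^-distribʳ-* (3 ℕ.* κ) (suc t) a ⟩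
    (3 ℕ.* κ) ℕ.^ a ℕ.* suc t ℕ.^ a            ≤⟨ ℕ.*-mono-≤ (ℕ.m≤m+n ((3 ℕ.* κ) ℕ.^ a) a) (ℕ.^-monoʳ-≤ (suc t) (ℕ.m≤n+m a ((3 ℕ.* κ) ℕ.^ a))) ⟩
    C ℕ.* suc t ℕ.^ C                          ∎
    where
    2+≤ : 2 ℕ.+ suc t ℕ.≤ 3 ℕ.* suc t
    2+≤ = ℕ.≤-trans (ℕ.≤-reflexive (ℕ.+-comm 2 (suc t))) (ℕ.+-monoʳ-≤ (suc t) (ℕ.*-monoʳ-≤ 2 (ℕ.s≤s ℕ.z≤n)))

Conclusion : ∀ {n} → .{{NonZero n}} → ℕ → BooleanFunction n → (ε : ℝ) → 0ℝ < ε → Set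
Conclusion {n} C f ε 0<ε =
  let bound = fromℕ C * log₂ (fromℕ⁺ n / (ε , 0<ε)) ^ C in
  (∃[ d ] (fromℕ d ≤ bound × HasApproximation ε d f)) ×
  (∀ d → IsToroidalDegree ε f d → fromℕ d ≤ bound)

conclude : ∀ {n} → .{{_ : NonZero n}} → ∀ C f ε 0<ε → ∀ {N} →
  (∀ d → d ℕ.≤ N → fromℕ d ≤ fromℕ C * log₂ (fromℕ⁺ n / (ε , 0<ε)) ^ C) →
  ∃[ d ] (d ℕ.≤ N × HasApproximation ε d f) → Conclusion {n} C f ε 0<ε
conclude C f ε 0<ε within (d , d≤ , approx) = (d , within d d≤ , approx) ,
  λ e (_ , minimal) → within e (ℕ.≤-trans (minimal d approx) d≤)

module _ (f : BooleanFamily) (acc : ACC⁰ f) where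
  open ACC⁰ acc

  private
    modulus≢0 : NonZero modulus
    modulus≢0 = ℕ.>-nonZero (ℕ.≤-trans (ℕ.s≤s ℕ.z≤n) modulus≥2)

    F : PrimePowers modulus
    F = primePowers modulus {{modulus≢0}}

    -- `κ` adds up all lower bounds that `circuit-approximable` places on `Q`, so `Q = κ * T` meets
    -- each of them. The `3` in `w` pays for the two additions in `1 + (n + size)` and for
    -- `n ≤ 2 ^ T`.
    ω w κ a : ℕ
    ω = length (primes F)
    w = 3 ℕ.+ polyExponent sizeBound
    κ = 4 ℕ.+ (modulus ℕ.+ (ω ℕ.+ w))
    a = exponent ω maxDepth

  size≤ : ∀ n → .{{_ : NonZero n}} → ∀ T → 1 ℕ.≤ T → n ℕ.≤ 2 ℕ.^ T → suc (n ℕ.+ size (circuit n)) ℕ.≤ 2 ℕ.^ (w ℕ.* T)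
  size≤ n T 1≤T n≤ = 2^-sum {1} 0 (2 ℕ.+ polyExponent sizeBound) T 1≤T ℕ.≤-refl
    (2^-sum 1 (polyExponent sizeBound) T 1≤T (subst (λ e → n ℕ.≤ 2 ℕ.^ e) (sym (ℕ.+-identityʳ T)) n≤)
      (ℕ.≤-trans (size-bounded n) (evalPoly≤ sizeBound n T 1≤T n≤)))

  approximable : ∀ n → .{{_ : NonZero n}} → ∀ T → 1 ℕ.≤ T → n ℕ.≤ 2 ℕ.^ T →
    Approximable ((κ ℕ.* T) ℕ.^ a) (2⁻ (κ ℕ.* T)) (λ x → ½ ℚ.* ⟦ f n x ⟧)
  approximable n T 1≤T n≤ = Approximable-≗ (computes n) (circuit-approximable F (circuit n) (κ ℕ.* T)
    (below (ℕ.m≤m+n 4 _)) (below (ℕ.≤-trans (ℕ.m≤m+n modulus (ω ℕ.+ w)) (ℕ.m≤n+m _ 4)))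
    (ℕ.≤-trans (size≤ n T 1≤T n≤) (ℕ.^-monoʳ-≤ 2 (ℕ.*-monoˡ-≤ T (ℕ.≤-trans (ℕ.m≤n+m w ω) (ℕ.≤-trans (ℕ.m≤n+m _ modulus) (ℕ.m≤n+m _ 4))))))
    (below (ℕ.≤-trans (ℕ.m≤m+n ω w) (ℕ.≤-trans (ℕ.m≤n+m _ modulus) (ℕ.m≤n+m _ 4))))
    (depth-bounded n))
    where
    below : ∀ {z} → z ℕ.≤ κ → z ℕ.≤ κ ℕ.* T
    below {z} z≤κ = ℕ.≤-trans (ℕ.≤-reflexive (sym (ℕ.*-identityʳ z))) (ℕ.*-mono-≤ z≤κ 1≤T)

  open Degree κ a (ℕ.m≤m+n 4 (modulus ℕ.+ (ω ℕ.+ w))) public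

  -- At `t = 0` the degree budget `C * 0 ^ C` is 0, so only a constant is affordable, and `2⁻ 2 ≤ ε`
  -- makes 1/4 good enough. For larger `t` the precision `2⁻ (κ * T)` with `T = 2 + t` is below both
  -- 1/4 and `ε`.
  approximation : ∀ n .{{_ : NonZero n}} (ε : ℝ) t K → n ℕ.≤ 2 ℕ.^ (2 ℕ.+ t) → (∀ k → K ℕ.≤ k → 2⁻ (2 ℕ.+ t) ℚ.≤ seq ε k) →
    ∃[ d ] (d ℕ.≤ C ℕ.* t ℕ.^ C × HasApproximation ε d (f n))
  approximation n ε zero    K n≤ 2⁻≤ε = 0 , ℕ.z≤n ,
    hasApproximation ε (f n) (ℚ.≤-reflexive {2⁻ 2} {¼} refl) K 2⁻≤ε (constant-approximable (f n))
  approximation n ε (suc t) K n≤ 2⁻≤ε = (κ ℕ.* T) ℕ.^ a , degree≤ t ,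
    hasApproximation ε (f n) (ℚ.≤-trans (2⁻-antimono (ℕ.≤-trans (ℕ.m≤m+n 2 (suc t)) T≤κT)) (ℚ.≤-reflexive {2⁻ 2} {¼} refl)) K
      (λ k K≤k → ℚ.≤-trans (2⁻-antimono T≤κT) (2⁻≤ε k K≤k)) (approximable n T (ℕ.s≤s ℕ.z≤n) n≤)
    where
    T = 2 ℕ.+ suc t
    T≤κT : T ℕ.≤ κ ℕ.* T
    T≤κT = ℕ.m≤n*m T κ

  conclusion : ∀ n .{{_ : NonZero n}} (ε : ℝ) (0<ε : 0ℝ < ε) → ∃[ t ] ∃[ K ] (n ℕ.≤ 2 ℕ.^ (2 ℕ.+ t) ×
    (∀ j → K ℕ.≤ j → 2⁻ (2 ℕ.+ t) ℚ.≤ seq ε j × ℚ-Lemmas.fromℕ (2 ℕ.^ t) ℚ.* seq ε j ℚ.≤ ℚ-Lemmas.fromℕ n)) →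
    Conclusion C (f n) ε 0<ε
  conclusion n ε 0<ε (t , K , n≤ , window) = conclude C (f n) ε 0<ε
    (≤-bound n (ε , 0<ε) t K (λ j K≤j → proj₂ (window j K≤j)) C)
    (approximation n ε t K n≤ λ k K≤k → proj₁ (window k K≤k))

corollary2p11 : (f : BooleanFamily) → ACC⁰ f →
    ∃[ C ] (0 ℕ.< C ×
    (∀ (n : ℕ) .{{_ : NonZero n}} (ε : ℝ) (0<ε : 0ℝ < ε) → ε < 1ℝ →
    let bound = fromℕ C * log₂ (fromℕ⁺ n / (ε , 0<ε)) ^ C in
    (∃[ d ] (fromℕ d ≤ bound × HasApproximation ε d (f n))) ×
    (∀ d → IsToroidalDegree ε (f n) d → fromℕ d ≤ bound)))
corollary2p11 f acc = C f acc , 0<C f acc , λ n ε 0<ε ε<1 →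
  conclusion f acc n ε 0<ε (scale n (ℕ.>-nonZero⁻¹ n) ε 0<ε ε<1)
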